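{- Let $[M;\mathcal{L}]$ with $M=[A;P;B]$ be a countable formal mathematical system and let $\mathcal{D}$ be a model for $[M;\mathcal{L}]$, with universe $\mathcal{D}_*$, set of names $\mathcal{N}=\{\alpha_d : d\in\mathcal{D}_*\}$, predicates $p_n$ ($p\in P$, $n\ge 0$), and extended list sets $\hat{\mathcal{L}},\hat{\mathcal{L}}_*$. Let $[M'';\mathcal{L}'']$, the function $\psi$, the sets $A',\mathcal{N}',B',\mathcal{L}'$ and the system $[M';\mathcal{L}']$ with $M'=[A';P;B']$ be obtained from $[M;\mathcal{L}]$ and $\mathcal{D}$ by the construction described in the context, and let $\mathcal{L}'_*$, $\mathcal{L}''_*$ be the sets of variable-free lists in $\mathcal{L}'$, $\mathcal{L}''$. Then: (a) $[M';\mathcal{L}']$ is a complete countable Henkin system, and it extends the original countable system $[M;\mathcal{L}]$. (b) The complete Henkin system $[M'';\mathcal{L}'']$ is a conservative extension of $[M';\mathcal{L}']$. (c) Form the countable subset $\mathcal{D}_{0,*}=\{d\in\mathcal{D}_* : \alpha_d\in\mathcal{N}'\}\subseteq\mathcal{D}_*$, and note that $\mathcal{L}'_*\subseteq\mathcal{L}''_*=\hat{\mathcal{L}}_*$. Define the restriction $\mathcal{D}_0:\mathcal{L}'_*\to\mathcal{D}_{0,*}$ of $\mathcal{D}$ by $\mathcal{D}_0(\lambda)=\mathcal{D}(\lambda)$ for all $\lambda\in\mathcal{L}'_*$. For every $p\in P$ put $p'_0=p_0$ and $p'_n=p_n\cap\mathcal{D}_{0,*}^n$ for all $n\ge1$,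 and use the predicates $p'_n$, $n\geq 0$, to extend $\mathcal{D}_0$ to all closed formulas $F$ of $[M';\mathcal{L}']$ by $\mathcal{D}_0(F)=\mathcal{D}(F)$. Then $\mathcal{D}_0$ is a well-defined countable model of $[M;\mathcal{L}]$, and the models $\mathcal{D}$ and $\mathcal{D}_0$ are elementarily equivalent for $[M;\mathcal{L}]$. Here the names of $\mathcal{D}_0$ are the members of the countable set $\mathcal{N}'$, where $\alpha_d\in\mathcal{N}'$ denotes the same individual $d\in\mathcal{D}_{0,*}$ in both models.
   Context: "Countable" means finite or countably infinite. **Syntax.** $X=\{\mathbf{x}_1,\mathbf{x}_2,\ldots\}$ is the countably infinite alphabet of variables. Let $A$ be a set of constant/operation symbols and $P$ a set of predicate symbols. $A$-lists are the strings generated by: every $x\in X$ and every $a\in A$ is an $A$-list; if $\lambda$ is an $A$-list and $f\in A$ then $f(\lambda)$ is an $A$-list; if $\lambda,\mu$ are $A$-lists then the concatenation $\lambda\mu$ is an $A$-list. $\mathrm{var}(\lambda)$ is the set of variables occurring in $\lambda$; $\lambda\frac{\mu}{x}$ is the list obtained by replacing $x$ everywhere in $\lambda$ by $\mu$. Formulas are written in prefix notation. Prime formulas are $\sim\lambda,\mu$ (equality), $p$, and $p\,\lambda_1,\ldots,\lambda_n$ for $p\in P$, $n\ge1$ and argument lists $\lambda,\mu,\lambda_i$ (a predicate symbol may be used with any number of arguments). If $F,G$ are formulas and $x\in X$, then $\neg F$, $\to FG$, $\leftrightarrow FG$, $\&FG$, $\vee FG$, $\forall xF$, $\exists xF$ are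 formulas. $\mathrm{var}(F)$ is the set of all variables of $F$, $\mathrm{free}(F)$ the set of variables occurring free in $F$; $F$ is closed if $\mathrm{free}(F)=\emptyset$. $F\frac{\lambda}{x}=\mathrm{SbF}(F;\lambda;x)$ is the result of replacing every free occurrence of $x$ in $F$ by $\lambda$. The condition $\mathrm{CF}(F;\lambda;x)$ says that this substitution is collision-free: no free occurrence of $x$ in $F$ lies in the scope of a quantifier $\forall y$ or $\exists y$ with $y\in\mathrm{var}(\lambda)$. **Formal mathematical systems.** $[M;\mathcal{L}]$ with $M=[A;P;B]$ consists of $A$, $P$, a set $\mathcal{L}$ of $A$-lists with $X\subseteq\mathcal{L}$ and $\lambda\frac{\mu}{x}\in\mathcal{L}$ for all $\lambda,\mu\in\mathcal{L}$, $x\in X$, and a set $B$ of formulas (basis axioms) with all argument lists in $\mathcal{L}$. Formulas of $[M;\mathcal{L}]$ are the formulas over $A,P$ all of whose argument lists are in $\mathcal{L}$. It is countable if $A$ and $P$ are countable. $\Pi(M;\mathcal{L})$ is the set of formulas of $[M;\mathcal{L}]$ provable by the following Hilbert-style calculus, in which all formulas have argument lists in $\mathcal{L}$. Axioms: the formulas in $B$; all $\alpha(F_1,\ldots,F_j)$ for propositional tautologies $\alpha$; equality axioms $\sim x,x$; $\to\mathrm{SbF}(\sim\lambda,\mu;x;y)\to\sim x,y\,\sim\lambda,\mu$ ($x,y\in X$, $\lambda,\mu\in\mathcal{L}$); $\to\sim x_1,y_1\ldots\to\sim x_n,y_n\to p\,x_1,\ldots,x_n\;p\,y_1,\ldots,y_n$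 ($p\in P$, $n\ge1$, $x_i,y_i\in X$); quantifier axioms $\to\forall xF\,F$; $\to\forall x\to FG\;\to F\,\forall xG$ if $x\notin\mathrm{free}(F)$; $\leftrightarrow\neg\forall x\neg F\;\exists xF$. Rules: (a) axioms may be written down; (b) from $F$ and $\to FG$ infer $G$; (c) from $F$ infer $F\frac{\lambda}{x}$ if $x\in X$, $\lambda\in\mathcal{L}$ and $\mathrm{CF}(F;\lambda;x)$; (d) from $F$ infer $\forall xF$. $[M;\mathcal{L}]$ is contradictory if every formula of $[M;\mathcal{L}]$ is in $\Pi(M;\mathcal{L})$, otherwise consistent. It is a Henkin system if for every $x\in X$ and every formula $F$ of $[M;\mathcal{L}]$ with $\mathrm{free}(F)\subseteq\{x\}$ there is a constant $c\in\mathcal{L}$ (a single symbol of $A$) with $\to\exists xF\,F\frac{c}{x}\in\Pi(M;\mathcal{L})$ (equivalently, with $\leftrightarrow$ instead of $\to$). It is complete if for every closed formula $F$ of $[M;\mathcal{L}]$: $F\notin\Pi(M;\mathcal{L})\Leftrightarrow\neg F\in\Pi(M;\mathcal{L})$. A system $[M_2;\mathcal{L}_2]$, $M_2=[A_2;P_2;B_2]$, is an extension of $[M_1;\mathcal{L}_1]$, $M_1=[A_1;P_1;B_1]$, if $A_1\subseteq A_2$, $P_1\subseteq P_2$, $\mathcal{L}_1\subseteq\mathcal{L}_2$ and $\Pi(M_1;\mathcal{L}_1)\subseteq\Pi(M_2;\mathcal{L}_2)$; it is a conservative extension if in addition every formula of $[M_1;\mathcal{L}_1]$ lying in $\Pi(M_2;\mathcal{L}_2)$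 lies in $\Pi(M_1;\mathcal{L}_1)$. **Models.** A model $\mathcal{D}$ of $[M;\mathcal{L}]$ consists of: (1) a nonempty set $\mathcal{D}_*$ (universe; its members are individuals); (2) for each $d\in\mathcal{D}_*$ exactly one name $\alpha_d$, with different individuals having different names; $\mathcal{N}=\{\alpha_d:d\in\mathcal{D}_*\}$ consists of symbols different from those of $[M;\mathcal{L}]$; (3) the extended system $[\hat M;\hat{\mathcal{L}}]$ with $\hat A=A\cup\mathcal{N}$, $\hat M=[\hat A;P;B]$, $\hat{\mathcal{L}}=\{\lambda\frac{\kappa_1}{x_1}\ldots\frac{\kappa_m}{x_m}:\lambda\in\mathcal{L},x_i\in X,\kappa_i\in\mathcal{N},m\ge0\}$; $\hat{\mathcal{L}}_*$ is the set of $\lambda\in\hat{\mathcal{L}}$ with $\mathrm{var}(\lambda)=\emptyset$; (4) a surjective function $\mathcal{D}:\hat{\mathcal{L}}_*\to\mathcal{D}_*$ with $\mathcal{D}(\lambda\frac{\mu}{x})=\mathcal{D}(\lambda\frac{\alpha_{\mathcal{D}(\mu)}}{x})$ for all $\mu\in\hat{\mathcal{L}}_*$, $x\in X$, $\lambda\in\hat{\mathcal{L}}$ with $\mathrm{var}(\lambda)\subseteq\{x\}$; (5) for each $p\in P$ and $n\in\mathbb{N}_0$ an $n$-ary predicate $p_n\subseteq\mathcal{D}_*^n$, where for $n=0$, $p_0\in\{\top,\bot\}$ is a truth value; (6) an extension of $\mathcal{D}$ assigning a truth value to each closed formula of $[\hat M;\hat{\mathcal{L}}]$: $\mathcal{D}(\sim\lambda,\mu)=\top$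 iff $\mathcal{D}(\lambda)=\mathcal{D}(\mu)$; $\mathcal{D}(p)=p_0$; $\mathcal{D}(p\,\lambda_1,\ldots,\lambda_n)=\top$ iff $(\mathcal{D}(\lambda_1),\ldots,\mathcal{D}(\lambda_n))\in p_n$; the connectives $\neg,\to,\leftrightarrow,\&,\vee$ are interpreted classically; for $\mathrm{free}(F)\subseteq\{x\}$, $\mathcal{D}(\forall xF)=\top$ iff $\mathcal{D}(F\frac{\lambda}{x})=\top$ for all $\lambda\in\hat{\mathcal{L}}_*$, and $\mathcal{D}(\exists xF)=\top$ iff $\mathcal{D}(F\frac{\lambda}{x})=\top$ for some $\lambda\in\hat{\mathcal{L}}_*$; (7) a formula $F$ of $[\hat M;\hat{\mathcal{L}}]$ with $\mathrm{free}(F)=\{x_1,\ldots,x_m\}$ is called valid in $\mathcal{D}$ iff $\mathcal{D}(F\frac{\lambda_1}{x_1}\ldots\frac{\lambda_m}{x_m})=\top$ for all $\lambda_1,\ldots,\lambda_m\in\hat{\mathcal{L}}_*$; (8) every $F\in B$ is valid in $\mathcal{D}$. A model is countable if its universe is countable. Two models of $[M;\mathcal{L}]$ are elementarily equivalent for $[M;\mathcal{L}]$ if they assign the same truth value to every closed formula of $[M;\mathcal{L}]$. **Construction.** Fix the countable $[M;\mathcal{L}]$ and its model $\mathcal{D}$. *The system $[M'';\mathcal{L}'']$:* $A''=\hat A$, $B''=\{G: G\text{ a formula of }[\hat M;\hat{\mathcal{L}}]\text{ valid in }\mathcal{D}\}$, $M''=[A'';P;B'']$, $\mathcal{L}''=\hat{\mathcal{L}}$.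 (It is a complete Henkin system.) *Henkin constants:* Put $A^{(0)}=A$, $\mathcal{L}^{(0)}=\mathcal{L}$, $M^{(0)}=M$. For each pair $(x;F)$ with $x\in X$ and $F$ a formula of $[M^{(0)};\mathcal{L}^{(0)}]$ with $\mathrm{free}(F)\subseteq\{x\}$ choose exactly one new constant $\omega_{\exists xF}$, a Henkin constant of rank 1; $\mathcal{H}^{(1)}$ is the set of these. For $n\ge2$, for each closed formula $\exists xF$ of $[M^{(n-1)};\mathcal{L}^{(n-1)}]$ such that at least one Henkin constant of rank $n-1$ occurs in $F$, form a new Henkin constant $\omega_{\exists xF}$ of rank $n$; $\mathcal{H}^{(n)}$ is the set of these. For $n\ge1$ put $A^{(n)}=A^{(n-1)}\cup\mathcal{H}^{(n)}$ (with $A^{(n-1)}\cap\mathcal{H}^{(n)}=\emptyset$), $M^{(n)}=[A^{(n)};P;B]$, $\mathcal{L}^{(n)}=\{\lambda\frac{c_1}{x_1}\ldots\frac{c_m}{x_m}:\lambda\in\mathcal{L}^{(n-1)},x_i\in X,c_i\in\mathcal{H}^{(n)},m\ge0\}$. Distinct pairs $(x;F)$ have distinct Henkin constants. Put $\mathcal{H}=\bigcup_{k\ge1}\mathcal{H}^{(k)}$, $A^{(\infty)}=\bigcup_n A^{(n)}$, $\mathcal{L}^{(\infty)}=\bigcup_n\mathcal{L}^{(n)}$, $M^{(\infty)}=[A^{(\infty)};P;B]$. *The function $\psi$ and the systems $[\tilde M^{(n)};\tilde{\mathcal{L}}^{(n)}]$, $\tilde M^{(n)}=[\tilde A^{(n)};P;\tilde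 B^{(n)}]$:* For $n=0$: $\tilde A^{(0)}=A$, $\tilde{\mathcal{L}}^{(0)}=\mathcal{L}$, $\tilde B^{(0)}=\{G:G\text{ a formula of }[M;\mathcal{L}]\text{ valid in }\mathcal{D}\}$, and $\psi(F)=F$ for every formula $F$ of $[M;\mathcal{L}]$. For $n\ge1$, suppose $\psi(F)$ is defined for all formulas $F$ of $[M^{(n-1)};\mathcal{L}^{(n-1)}]$ and $\psi(c)$ for all Henkin constants of rank $<n$. For each Henkin constant $\omega_{\exists xF}$ of rank $n$ choose exactly one $d\in\mathcal{D}_*$ with $\leftrightarrow\exists x\psi(F)\;\psi(F)\frac{\alpha_d}{x}\in\Pi(M'';\mathcal{L}'')$ (such $d$ exists) and put $\psi(\omega_{\exists xF})=\alpha_d$. If $F$ is a formula of $[M^{(n)};\mathcal{L}^{(n)}]$ in which exactly the distinct rank-$n$ Henkin constants $c_1,\ldots,c_j$ ($j\ge1$) occur, ordered by first occurrence, let $x_1,\ldots,x_j$ be distinct variables not in $\mathrm{var}(F)$, let $G$ (a formula of $[M^{(n-1)};\mathcal{L}^{(n-1)}]$) be $F$ with each $c_i$ replaced everywhere by $x_i$, and put $\psi(F)=\psi(G)\frac{\psi(c_1)}{x_1}\ldots\frac{\psi(c_j)}{x_j}$. Put $\tilde A^{(n)}=\tilde A^{(n-1)}\cup\{\psi(c):c\in\mathcal{H}^{(n)}\}$, $\tilde B^{(n)}=\{\psi(G):G\text{ a formula of }[M^{(n)};\mathcal{L}^{(n)}],\ \psi(G)\text{ valid in }\mathcal{D}\}$,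 $\tilde{\mathcal{L}}^{(n)}=\{\lambda\frac{\kappa_1}{x_1}\ldots\frac{\kappa_m}{x_m}:\lambda\in\tilde{\mathcal{L}}^{(n-1)},x_i\in X,\kappa_i\in\tilde A^{(n)}\setminus A,m\ge0\}$. *The system $[M';\mathcal{L}']$:* $A'=\bigcup_{n\ge0}\tilde A^{(n)}$, $\mathcal{N}'=A'\setminus A\subseteq\mathcal{N}$, $B'=\bigcup_{n\ge0}\tilde B^{(n)}$, $\mathcal{L}'=\bigcup_{n\ge0}\tilde{\mathcal{L}}^{(n)}$, $M'=[A';P;B']$. -}

module Defs where

open import Data.Bool using (Bool; true; not; _∧_; _∨_; _xor_)
open import Data.Empty using (⊥)
open import Data.Fin using (Fin)
open import Data.List using (List; []; _∷_; [_]; _++_; concat; concatMap; map)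
open import Data.List.Membership.Propositional using (_∈_; _∉_)
open import Data.List.Relation.Binary.Pointwise using (Pointwise)
open import Data.List.Relation.Unary.All using (All)
open import Data.List.Relation.Unary.AllPairs using (AllPairs)
open import Data.List.Relation.Unary.Unique.Propositional using (Unique)
open import Data.Nat using (ℕ; zero; suc; _≟_)
open import Data.Product using (Σ; ∃; ∃-syntax; _×_; _,_; proj₁; proj₂)
open import Data.Sum using (_⊎_)
open import Data.Unit using (⊤)
open import Data.Vec as Vec using (Vec; []; _∷_; toList)
import Data.Vec.Relation.Binary.Pointwise.Inductive as VecPointwise
import Data.Vec.Relation.Unary.All as VecAll
open import Function.Bundles using (_⇔_)
open import Level using (0ℓ)
open import Relation.Binary.PropositionalEquality using (_≡_; _≢_)
open import Relation.Nullary using (¬_; yes; no)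
open import Relation.Unary using (Pred; _⊆_; _∪_; _∩_; _∖_)

-- Throughout, S is the type of all symbols that may serve as constant or
-- operation symbols (including names and Henkin constants), Q the type of all
-- predicate symbols and I a type of individuals.  Sets of symbols, lists,
-- formulas and individuals are predicates on these types, so that inclusions
-- between formal systems are literal inclusions.

private variable
  S Q I X : Set
  n : ℕ

-- Finite or countably infinite: K is the range of a partial function on ℕ,
-- namely of the single-valued relation "n is a code of a".  A code may depend
-- on the evidence for membership; for proof-irrelevant K this is an injection
-- of K into ℕ.
Countable : Pred X 0ℓ → Set
Countable {X} K =
  Σ ({a : X} → K a → ℕ) λ code →
    ∀ {a b} (p : K a) (q : K b) → code p ≡ code q → a ≡ b

Var : Set
Var = ℕ

data Token (S : Set) : Set where
  var    : Var → Token S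
  sym    : S → Token S
  lp rp  : Token S

Str : Set → Set
Str S = List (Token S)

data IsList (A : Pred S 0ℓ) : Pred (Str S) 0ℓ where
  variable-list : ∀ x → IsList A [ var x ]
  symbol-list   : ∀ {a} → A a → IsList A [ sym a ]
  application   : ∀ {f l} → A f → IsList A l →
                  IsList A (sym f ∷ lp ∷ l ++ [ rp ])
  concatenation : ∀ {l m} → IsList A l → IsList A m → IsList A (l ++ m)

_∈var_ : Var → Str S → Set
x ∈var l = var x ∈ l

Ground : Pred (Str S) 0ℓ
Ground l = ∀ x → ¬ x ∈var l

substToken : Str S → Var → Token S → Str S
substToken m x (var y) with x ≟ y
... | yes _ = m
... | no  _ = [ var y ]
substToken m x t = [ t ]

_⟦_/_⟧ : Str S → Str S → Var → Str S
l ⟦ m / x ⟧ = concatMap (substToken m x) l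

symbolsOfStr : Str S → List S
symbolsOfStr []          = []
symbolsOfStr (sym a ∷ l) = a ∷ symbolsOfStr l
symbolsOfStr (_     ∷ l) = symbolsOfStr l

-- The set of all λ κ₁/x₁ … κₘ/xₘ (m ≥ 0) with λ ∈ L and κᵢ ∈ K.
data Adjoin (L : Pred (Str S) 0ℓ) (K : Pred S 0ℓ) : Pred (Str S) 0ℓ where
  base : ∀ {l} → L l → Adjoin L K l
  step : ∀ {l c} x → Adjoin L K l → K c → Adjoin L K (l ⟦ [ sym c ] / x ⟧)

-- `rel p []` is the prime formula p without arguments.
data Formula (S Q : Set) : Set where
  eq              : Str S → Str S → Formula S Q
  rel             : Q → Vec (Str S) n → Formula S Q
  neg             : Formula S Q → Formula S Q
  imp iff con dis : Formula S Q → Formula S Q → Formula S Q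
  all ex          : Var → Formula S Q → Formula S Q

_∈free_ : Var → Formula S Q → Set
x ∈free eq l m   = x ∈var l ⊎ x ∈var m
x ∈free rel p ls = x ∈var concat (toList ls)
x ∈free neg F    = x ∈free F
x ∈free imp F G  = x ∈free F ⊎ x ∈free G
x ∈free iff F G  = x ∈free F ⊎ x ∈free G
x ∈free con F G  = x ∈free F ⊎ x ∈free G
x ∈free dis F G  = x ∈free F ⊎ x ∈free G
x ∈free all y F  = x ≢ y × x ∈free F
x ∈free ex y F   = x ≢ y × x ∈free F

_∈varᶠ_ : Var → Formula S Q → Set
x ∈varᶠ eq l m   = x ∈var l ⊎ x ∈var m
x ∈varᶠ rel p ls = x ∈var concat (toList ls)
x ∈varᶠ neg F    = x ∈varᶠ F
x ∈varᶠ imp F G  = x ∈varᶠ F ⊎ x ∈varᶠ G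
x ∈varᶠ iff F G  = x ∈varᶠ F ⊎ x ∈varᶠ G
x ∈varᶠ con F G  = x ∈varᶠ F ⊎ x ∈varᶠ G
x ∈varᶠ dis F G  = x ∈varᶠ F ⊎ x ∈varᶠ G
x ∈varᶠ all y F  = x ≡ y ⊎ x ∈varᶠ F
x ∈varᶠ ex y F   = x ≡ y ⊎ x ∈varᶠ F

Closed : Pred (Formula S Q) 0ℓ
Closed F = ∀ x → ¬ x ∈free F

FreeOnly : Var → Pred (Formula S Q) 0ℓ
FreeOnly x F = ∀ y → y ∈free F → y ≡ x

-- SbF (F; l; x)
_⟦_/_⟧ᶠ : Formula S Q → Str S → Var → Formula S Q
eq k m   ⟦ l / x ⟧ᶠ = eq (k ⟦ l / x ⟧) (m ⟦ l / x ⟧)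
rel p ls ⟦ l / x ⟧ᶠ = rel p (Vec.map (_⟦ l / x ⟧) ls)
neg F    ⟦ l / x ⟧ᶠ = neg (F ⟦ l / x ⟧ᶠ)
imp F G  ⟦ l / x ⟧ᶠ = imp (F ⟦ l / x ⟧ᶠ) (G ⟦ l / x ⟧ᶠ)
iff F G  ⟦ l / x ⟧ᶠ = iff (F ⟦ l / x ⟧ᶠ) (G ⟦ l / x ⟧ᶠ)
con F G  ⟦ l / x ⟧ᶠ = con (F ⟦ l / x ⟧ᶠ) (G ⟦ l / x ⟧ᶠ)
dis F G  ⟦ l / x ⟧ᶠ = dis (F ⟦ l / x ⟧ᶠ) (G ⟦ l / x ⟧ᶠ)
all y F  ⟦ l / x ⟧ᶠ with x ≟ y
... | yes _ = all y F
... | no  _ = all y (F ⟦ l / x ⟧ᶠ)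
ex y F   ⟦ l / x ⟧ᶠ with x ≟ y
... | yes _ = ex y F
... | no  _ = ex y (F ⟦ l / x ⟧ᶠ)

-- F l₁/x₁ … lₘ/xₘ, performed from left to right
substAll : Formula S Q → List (Var × Str S) → Formula S Q
substAll F []            = F
substAll F ((x , l) ∷ σ) = substAll (F ⟦ l / x ⟧ᶠ) σ

CF : Formula S Q → Str S → Var → Set
CF (eq _ _)  l x = ⊤
CF (rel _ _) l x = ⊤
CF (neg F)   l x = CF F l x
CF (imp F G) l x = CF F l x × CF G l x
CF (iff F G) l x = CF F l x × CF G l x
CF (con F G) l x = CF F l x × CF G l x
CF (dis F G) l x = CF F l x × CF G l x
CF (all y F) l x = x ∈free all y F → ¬ y ∈var l × CF F l x
CF (ex y F)  l x = x ∈free ex y F → ¬ y ∈var l × CF F l x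

-- The constant and operation symbols of F, in the order of their occurrence.
symbolsOf : Formula S Q → List S
symbolsOf (eq l m)   = symbolsOfStr l ++ symbolsOfStr m
symbolsOf (rel p ls) = symbolsOfStr (concat (toList ls))
symbolsOf (neg F)    = symbolsOf F
symbolsOf (imp F G)  = symbolsOf F ++ symbolsOf G
symbolsOf (iff F G)  = symbolsOf F ++ symbolsOf G
symbolsOf (con F G)  = symbolsOf F ++ symbolsOf G
symbolsOf (dis F G)  = symbolsOf F ++ symbolsOf G
symbolsOf (all _ F)  = symbolsOf F
symbolsOf (ex _ F)   = symbolsOf F

data PropForm (j : ℕ) : Set where
  atom            : Fin j → PropForm j
  neg             : PropForm j → PropForm j
  imp iff con dis : PropForm j → PropForm j → PropForm j

_⇒ᵇ_ _⇔ᵇ_ : Bool → Bool → Bool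
a ⇒ᵇ b = not a ∨ b
a ⇔ᵇ b = not (a xor b)

eval : (Fin n → Bool) → PropForm n → Bool
eval v (atom i)  = v i
eval v (neg α)   = not (eval v α)
eval v (imp α β) = eval v α ⇒ᵇ eval v β
eval v (iff α β) = eval v α ⇔ᵇ eval v β
eval v (con α β) = eval v α ∧ eval v β
eval v (dis α β) = eval v α ∨ eval v β

Tautology : PropForm n → Set
Tautology α = ∀ v → eval v α ≡ true

instantiate : (Fin n → Formula S Q) → PropForm n → Formula S Q
instantiate F (atom i)  = F i
instantiate F (neg α)   = neg (instantiate F α)
instantiate F (imp α β) = imp (instantiate F α) (instantiate F β)
instantiate F (iff α β) = iff (instantiate F α) (instantiate F β)
instantiate F (con α β) = con (instantiate F α) (instantiate F β)
instantiate F (dis α β) = dis (instantiate F α) (instantiate F β)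

record System (S Q : Set) : Set₁ where
  field
    symbols    : Pred S 0ℓ
    predicates : Pred Q 0ℓ
    lists      : Pred (Str S) 0ℓ
    basis      : Pred (Formula S Q) 0ℓ

open System public

-- Symbols of F are checked through `lists M`, which consists of
-- `symbols M`-lists in any formal system.
IsFormula : System S Q → Pred (Formula S Q) 0ℓ
IsFormula M (eq l m)   = lists M l × lists M m
IsFormula M (rel p ls) = predicates M p × VecAll.All (lists M) ls
IsFormula M (neg F)    = IsFormula M F
IsFormula M (imp F G)  = IsFormula M F × IsFormula M G
IsFormula M (iff F G)  = IsFormula M F × IsFormula M G
IsFormula M (con F G)  = IsFormula M F × IsFormula M G
IsFormula M (dis F G)  = IsFormula M F × IsFormula M G
IsFormula M (all _ F)  = IsFormula M F
IsFormula M (ex _ F)   = IsFormula M F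

record IsSystem (M : System S Q) : Set where
  field
    lists⊆IsList   : lists M ⊆ IsList (symbols M)
    variables      : ∀ x → lists M [ var x ]
    lists-subst    : ∀ {l m} x → lists M l → lists M m → lists M (l ⟦ m / x ⟧)
    basis⊆formulas : basis M ⊆ IsFormula M

IsCountable : System S Q → Set
IsCountable M = Countable (symbols M) × Countable (predicates M)

eqVar : Var × Var → Formula S Q
eqVar (x , y) = eq [ var x ] [ var y ]

-- → ∼x₁,y₁ … → ∼xₙ,yₙ G
eqVars⇒ : Vec (Var × Var) n → Formula S Q → Formula S Q
eqVars⇒ []         G = G
eqVars⇒ (xy ∷ xys) G = imp (eqVar xy) (eqVars⇒ xys G)

-- Π(M; L)
data Provable (M : System S Q) : Pred (Formula S Q) 0ℓ where
  basis-axiom : ∀ {F} → basis M F → Provable M F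
  tautology   : (α : PropForm n) (F : Fin n → Formula S Q) →
                Tautology α → (∀ i → IsFormula M (F i)) →
                Provable M (instantiate F α)
  eq-refl     : ∀ x → Provable M (eq [ var x ] [ var x ])
  -- SbF (∼l,m; x; y) replaces y by x.
  eq-subst    : ∀ x y {l m} → lists M l → lists M m →
                Provable M (imp (eq l m ⟦ [ var x ] / y ⟧ᶠ)
                                (imp (eqVar (x , y)) (eq l m)))
  eq-rel      : ∀ {p} → predicates M p → (xys : Vec (Var × Var) (suc n)) →
                Provable M
                  (eqVars⇒ xys
                    (imp (rel p (Vec.map (λ xy → [ var (proj₁ xy) ]) xys))
                         (rel p (Vec.map (λ xy → [ var (proj₂ xy) ]) xys))))
  all-elim    : ∀ x {F} → IsFormula M F → Provable M (imp (all x F) F)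
  all-imp     : ∀ x {F G} → IsFormula M F → IsFormula M G → ¬ x ∈free F →
                Provable M (imp (all x (imp F G)) (imp F (all x G)))
  all-ex      : ∀ x {F} → IsFormula M F →
                Provable M (iff (neg (all x (neg F))) (ex x F))
  mp          : ∀ {F G} → Provable M F → Provable M (imp F G) → Provable M G
  subst-rule  : ∀ x {l F} → Provable M F → lists M l → CF F l x →
                Provable M (F ⟦ l / x ⟧ᶠ)
  gen         : ∀ x {F} → Provable M F → Provable M (all x F)

IsHenkin : System S Q → Set
IsHenkin {S} M =
  ∀ x F → IsFormula M F → FreeOnly x F →
    ∃[ c ] symbols M c × lists M [ sym c ]
         × Provable M (imp (ex x F) (F ⟦ [ sym c ] / x ⟧ᶠ))

IsComplete : System S Q → Set
IsComplete M =
  ∀ F → IsFormula M F → Closed F → (¬ Provable M F) ⇔ Provable M (neg F)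

record IsExtension (M₁ M₂ : System S Q) : Set where
  field
    symbols⊆    : symbols M₁ ⊆ symbols M₂
    predicates⊆ : predicates M₁ ⊆ predicates M₂
    lists⊆      : lists M₁ ⊆ lists M₂
    provable⊆   : Provable M₁ ⊆ Provable M₂

record IsConservativeExtension (M₁ M₂ : System S Q) : Set where
  field
    isExtension  : IsExtension M₁ M₂
    conservative : ∀ {F} → IsFormula M₁ F → Provable M₂ F → Provable M₁ F

-- The data of a model.  Individuals are the members of `universe`; `name d`
-- is α_d.  The functions are total on the ambient types, but only the
-- following values matter: `name` on the universe, `value` on the ground
-- lists and `truth` on the closed formulas of the extended system.
record Structure (S Q I : Set) : Set₁ where
  field
    universe : Pred I 0ℓ
    name     : I → S
    value    : Str S → I
    pred₀    : Q → Bool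
    pred₊    : Q → Pred (Vec I (suc n)) 0ℓ
    truth    : Formula S Q → Bool

open Structure public

Names : Structure S Q I → Pred S 0ℓ
Names 𝒟 s = ∃[ d ] universe 𝒟 d × s ≡ name 𝒟 d

-- [M̂; L̂]
hat : System S Q → Structure S Q I → System S Q
hat M 𝒟 = record
  { symbols    = symbols M ∪ Names 𝒟
  ; predicates = predicates M
  ; lists      = Adjoin (lists M) (Names 𝒟)
  ; basis      = basis M
  }

GroundLists : System S Q → Pred (Str S) 0ℓ
GroundLists M = lists M ∩ Ground

ClosedFormulas : System S Q → Pred (Formula S Q) 0ℓ
ClosedFormulas M = IsFormula M ∩ Closed

-- σ lists the free variables x₁, …, xₘ of F, each exactly once and in any
-- order, together with the ground lists that are substituted for them.
record Valid (M : System S Q) (𝒟 : Structure S Q I) (F : Formula S Q) : Set where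
  field
    isFormula : IsFormula (hat M 𝒟) F
    true-at   : (σ : List (Var × Str S)) →
                Unique (map proj₁ σ) →
                (∀ x → x ∈ map proj₁ σ ⇔ x ∈free F) →
                All (λ xl → GroundLists (hat M 𝒟) (proj₂ xl)) σ →
                truth 𝒟 (substAll F σ) ≡ true

record IsModel (M : System S Q) (𝒟 : Structure S Q I) : Set where
  private
    M̂  = hat M 𝒟
    L̂  = lists M̂
    L̂∗ = GroundLists M̂
    F̂∗ = ClosedFormulas M̂
    _⊨_ : Structure S Q I → Formula S Q → Set
    𝒟 ⊨ F = truth 𝒟 F ≡ true
  field
    nonempty       : ∃[ d ] universe 𝒟 d
    name-injective : ∀ {d e} → universe 𝒟 d → universe 𝒟 e →
                     name 𝒟 d ≡ name 𝒟 e → d ≡ e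
    name-new       : ∀ {d} → universe 𝒟 d → ¬ symbols M (name 𝒟 d)
    value∈universe : ∀ {l} → L̂∗ l → universe 𝒟 (value 𝒟 l)
    value-onto     : ∀ {d} → universe 𝒟 d → ∃[ l ] L̂∗ l × value 𝒟 l ≡ d
    value-subst    : ∀ {l m} x → L̂ l → (∀ y → y ∈var l → y ≡ x) → L̂∗ m →
                     value 𝒟 (l ⟦ m / x ⟧)
                       ≡ value 𝒟 (l ⟦ [ sym (name 𝒟 (value 𝒟 m)) ] / x ⟧)
    pred⊆universe  : ∀ {p} → predicates M p → {ds : Vec I (suc n)} →
                     pred₊ 𝒟 p ds → VecAll.All (universe 𝒟) ds
    truth-eq       : ∀ {l m} → F̂∗ (eq l m) →
                     (𝒟 ⊨ eq l m) ⇔ (value 𝒟 l ≡ value 𝒟 m)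
    truth-rel₀     : ∀ {p} → F̂∗ (rel p []) →
                     truth 𝒟 (rel p []) ≡ pred₀ 𝒟 p
    truth-rel₊     : ∀ {p} {ls : Vec (Str S) (suc n)} → F̂∗ (rel p ls) →
                     (𝒟 ⊨ rel p ls) ⇔ pred₊ 𝒟 p (Vec.map (value 𝒟) ls)
    truth-neg      : ∀ {F} → F̂∗ F → truth 𝒟 (neg F) ≡ not (truth 𝒟 F)
    truth-imp      : ∀ {F G} → F̂∗ F → F̂∗ G →
                     truth 𝒟 (imp F G) ≡ truth 𝒟 F ⇒ᵇ truth 𝒟 G
    truth-iff      : ∀ {F G} → F̂∗ F → F̂∗ G →
                     truth 𝒟 (iff F G) ≡ truth 𝒟 F ⇔ᵇ truth 𝒟 G
    truth-con      : ∀ {F G} → F̂∗ F → F̂∗ G →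
                     truth 𝒟 (con F G) ≡ truth 𝒟 F ∧ truth 𝒟 G
    truth-dis      : ∀ {F G} → F̂∗ F → F̂∗ G →
                     truth 𝒟 (dis F G) ≡ truth 𝒟 F ∨ truth 𝒟 G
    truth-all      : ∀ {F} x → IsFormula M̂ F → FreeOnly x F →
                     (𝒟 ⊨ all x F) ⇔ (∀ l → L̂∗ l → 𝒟 ⊨ (F ⟦ l / x ⟧ᶠ))
    truth-ex       : ∀ {F} x → IsFormula M̂ F → FreeOnly x F →
                     (𝒟 ⊨ ex x F) ⇔ (∃[ l ] L̂∗ l × 𝒟 ⊨ (F ⟦ l / x ⟧ᶠ))
    basis-valid    : ∀ {F} → basis M F → Valid M 𝒟 F

ElementarilyEquivalent : System S Q → (𝒟₁ 𝒟₂ : Structure S Q I) → Set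
ElementarilyEquivalent M 𝒟₁ 𝒟₂ =
  ∀ F → ClosedFormulas M F → truth 𝒟₁ F ≡ truth 𝒟₂ F

-- [M″; L″]
M″ : System S Q → Structure S Q I → System S Q
M″ M 𝒟 = record
  { symbols    = symbols (hat M 𝒟)
  ; predicates = predicates M
  ; lists      = lists (hat M 𝒟)
  ; basis      = Valid M 𝒟
  }

-- ω x F is the Henkin constant ω_{∃xF}; it only matters for the pairs (x; F)
-- that have a rank.

module _ (M : System S Q) (ω : Var → Formula S Q → S) where

  mutual
    -- [M⁽ⁿ⁾; L⁽ⁿ⁾]
    level : ℕ → System S Q
    level zero    = M
    level (suc n) = record
      { symbols    = symbols (level n) ∪ Henkin (suc n)
      ; predicates = predicates M
      ; lists      = Adjoin (lists (level n)) (Henkin (suc n))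
      ; basis      = basis M
      }

    -- The pairs (x; F) whose Henkin constant has rank n.
    HasRank : ℕ → Var → Formula S Q → Set
    HasRank zero          x F = ⊥
    HasRank (suc zero)    x F = IsFormula (level zero) F × FreeOnly x F
    HasRank (suc (suc n)) x F =
      IsFormula (level (suc n)) F × Closed (ex x F) ×
      ∃[ c ] Henkin (suc n) c × c ∈ symbolsOf F

    -- H⁽ⁿ⁾
    Henkin : ℕ → Pred S 0ℓ
    Henkin n c = ∃[ x ] ∃[ F ] HasRank n x F × c ≡ ω x F

  record AreHenkinConstants : Set where
    field
      new      : ∀ n {c} → symbols (level n) c → ¬ Henkin (suc n) c
      distinct : ∀ m n {x y F G} → HasRank m x F → HasRank n y G →
                 ω x F ≡ ω y G → x ≡ y × F ≡ G

data ReplaceToken (cxs : List (S × Var)) : Token S → Token S → Set where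
  replaced : ∀ {c x} → (c , x) ∈ cxs → ReplaceToken cxs (sym c) (var x)
  kept     : ∀ {c} → c ∉ map proj₁ cxs → ReplaceToken cxs (sym c) (sym c)
  var      : ∀ {x} → ReplaceToken cxs (var x) (var x)
  lp       : ReplaceToken cxs lp lp
  rp       : ReplaceToken cxs rp rp

-- G is F with each cᵢ replaced everywhere by xᵢ.  This is a relation since
-- equality on S need not be decidable.
data Replace {S Q : Set} (cxs : List (S × Var)) : Formula S Q → Formula S Q → Set where
  eq  : ∀ {l l′ m m′} → Pointwise (ReplaceToken cxs) l l′ →
        Pointwise (ReplaceToken cxs) m m′ →
        Replace cxs (eq l m) (eq l′ m′)
  rel : ∀ {p} {ls ls′ : Vec (Str S) n} →
        VecPointwise.Pointwise (Pointwise (ReplaceToken cxs)) ls ls′ →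
        Replace cxs (rel p ls) (rel p ls′)
  neg : ∀ {F F′} → Replace cxs F F′ → Replace cxs (neg F) (neg F′)
  imp : ∀ {F F′ G G′} → Replace cxs F F′ → Replace cxs G G′ →
        Replace cxs (imp F G) (imp F′ G′)
  iff : ∀ {F F′ G G′} → Replace cxs F F′ → Replace cxs G G′ →
        Replace cxs (iff F G) (iff F′ G′)
  con : ∀ {F F′ G G′} → Replace cxs F F′ → Replace cxs G G′ →
        Replace cxs (con F G) (con F′ G′)
  dis : ∀ {F F′ G G′} → Replace cxs F F′ → Replace cxs G G′ →
        Replace cxs (dis F G) (dis F′ G′)
  all : ∀ {x F F′} → Replace cxs F F′ → Replace cxs (all x F) (all x F′)
  ex  : ∀ {x F F′} → Replace cxs F F′ → Replace cxs (ex x F) (ex x F′)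

-- For c ≢ d occurring in s: the first occurrence of c precedes that of d.
FirstBefore : List S → S → S → Set
FirstBefore s c d = ∃[ u ] ∃[ v ] s ≡ u ++ c ∷ v × d ∉ u

-- cs consists of exactly the members of K occurring in F, without repetition
-- and ordered by first occurrence.
record Enumerates (K : Pred S 0ℓ) (F : Formula S Q) (cs : List S) : Set where
  field
    unique  : Unique cs
    exactly : ∀ c → c ∈ cs ⇔ (K c × c ∈ symbolsOf F)
    ordered : AllPairs (FirstBefore (symbolsOf F)) cs

module _ (M : System S Q) (𝒟 : Structure S Q I) (ω : Var → Formula S Q → S) where

  -- ψ on formulas, and a choice of individuals δ giving ψ(c) = α_{δ c} on
  -- Henkin constants; both are only constrained on formulas and Henkin
  -- constants of the systems `level M ω n`.
  record IsPsi (ψ : Formula S Q → Formula S Q) (δ : S → I) : Set where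
    field
      ψ-base   : ∀ {F} → IsFormula M F → ψ F ≡ F
      choice∈  : ∀ n {c} → Henkin M ω n c → universe 𝒟 (δ c)
      choice   : ∀ n {x F} → HasRank M ω n x F →
                 Provable (M″ M 𝒟)
                   (iff (ex x (ψ F))
                        (ψ F ⟦ [ sym (name 𝒟 (δ (ω x F))) ] / x ⟧ᶠ))
      -- cxs is the list of pairs (c₁ , x₁), …, (cⱼ , xⱼ).
      ψ-step   : ∀ n {F G} (cxs : List (S × Var)) →
                 IsFormula (level M ω (suc n)) F →
                 cxs ≢ [] →
                 Enumerates (Henkin M ω (suc n)) F (map proj₁ cxs) →
                 Unique (map proj₂ cxs) →
                 All (λ cx → ¬ proj₂ cx ∈varᶠ F) cxs →
                 Replace cxs F G →
                 ψ F ≡ substAll (ψ G)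
                   (map (λ cx → proj₂ cx , [ sym (name 𝒟 (δ (proj₁ cx))) ]) cxs)

  module _ (ψ : Formula S Q → Formula S Q) (δ : S → I) where

    symbols~ : ℕ → Pred S 0ℓ
    symbols~ zero      = symbols M
    symbols~ (suc n) s =
      symbols~ n s ⊎ (∃[ c ] Henkin M ω (suc n) c × s ≡ name 𝒟 (δ c))

    basis~ : ℕ → Pred (Formula S Q) 0ℓ
    basis~ zero    F = IsFormula M F × Valid M 𝒟 F
    basis~ (suc n) F =
      ∃[ G ] IsFormula (level M ω (suc n)) G × F ≡ ψ G × Valid M 𝒟 (ψ G)

    lists~ : ℕ → Pred (Str S) 0ℓ
    lists~ zero    = lists M
    lists~ (suc n) = Adjoin (lists~ n) (symbols~ (suc n) ∖ symbols M)

    -- [M′; L′]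
    M′ : System S Q
    M′ = record
      { symbols    = λ s → ∃[ n ] symbols~ n s
      ; predicates = predicates M
      ; lists      = λ l → ∃[ n ] lists~ n l
      ; basis      = λ F → ∃[ n ] basis~ n F
      }

    N′ : Pred S 0ℓ
    N′ = symbols M′ ∖ symbols M

    𝒟₀ : Structure S Q I
    𝒟₀ = record
      { universe = universe₀
      ; name     = name 𝒟
      ; value    = value 𝒟
      ; pred₀    = pred₀ 𝒟
      ; pred₊    = λ p ds → pred₊ 𝒟 p ds × VecAll.All universe₀ ds
      ; truth    = truth 𝒟
      }
      where
      universe₀ : Pred I 0ℓ
      universe₀ d = universe 𝒟 d × N′ (name 𝒟 d)

{-# OPTIONS --safe #-}
module Submission where

-- Call a list without variables ground, and let T ρ F be the truth value in 𝒟
-- of the formula F under an assignment ρ of ground lists to the variables.  T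
-- obeys the clauses of Tarski's definition of truth, and F is valid if and only
-- if T ρ F is true for all ρ (valid⇒holds, holds⇒valid).  All axioms of
-- [M″; L″] are valid and the rules preserve validity (sound), so [M″; L″]
-- proves exactly the valid formulas.  It is complete because a closed formula
-- or its negation is true.  It is a Henkin system because a true formula ∃xF
-- has a true instance F(l), in which the ground list l may be exchanged for the
-- name of its value (T-value-cong).
--
-- The function ψ does nothing but replace every Henkin constant c by the name
-- ψ(c) (ψ-interprets).  This is proved by induction on the rank: the constants
-- of highest rank are replaced by fresh variables, ψ is applied to the formula
-- so obtained, which belongs to the previous level, and the names are
-- substituted for the variables.  Conversely, in a formula F of [M′; L′] every
-- name that is not a symbol of M comes from a Henkin constant, and putting
-- these constants in place of the names yields a formula G with ψ(G) = F
-- (ψ-onto).  Hence every valid formula of [M′; L′] is one of its axioms.  As the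
-- axioms of [M′; L′] are also axioms of [M″; L″], the two systems prove the same
-- formulas of [M′; L′], namely the valid ones; completeness and conservativity
-- follow.  If ∃xF belongs to [M′; L′] and F = ψ(G), then the pair (x; G) has a
-- Henkin constant c of some rank, and by its choice ψ(c) is a witness for ∃xF
-- (witness′).
--
-- These witnesses are names of individuals of 𝒟₀.  So an existential formula
-- with parameters in 𝒟₀ that is true in 𝒟 has a true instance with a parameter
-- in 𝒟₀, which is the Tarski-Vaught criterion: the quantifiers may be
-- restricted to the universe of 𝒟₀ without changing any truth value
-- (D₀-truth-all, D₀-truth-ex).  Applied to ∃x (x = l) it shows that the universe
-- of 𝒟₀ contains the values of all ground lists of [M′; L′].
--
-- Two points need care.  The lists obtained by substituting constants are
-- again closed under substitution (adjoin-closed); this rests on a description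
-- of such lists by simultaneous substitutions, with variables renamed apart.
-- And the Henkin constants of a formula can only be listed without repetition
-- if equality of the symbols of each level is decidable.  Formulas are
-- therefore coded by natural numbers, and the codes of formulas serve as codes
-- of Henkin constants for the next level (lv-coding).  The same codes show that
-- A′ is countable.

open import Defs
open import Data.Bool using (Bool; true; false; not; _∧_; _∨_)
open import Data.Empty using (⊥; ⊥-elim)
open import Data.Fin using (Fin)
open import Data.List using (List; []; _∷_; [_]; _++_; concat; concatMap; map; filter; deduplicate)
open import Data.List.Membership.DecPropositional using (_∈?_)
open import Data.List.Membership.Propositional using (_∈_)
open import Data.List.Membership.Propositional.Properties
  using (∈-++⁺ˡ; ∈-++⁺ʳ; ∈-++⁻; ∈-map⁺; ∈-map⁻; ∈-filter⁺; ∈-filter⁻; ∈-deduplicate⁺; ∈-deduplicate⁻)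
open import Data.List.Properties using (++-identityʳ; concatMap-++)
  renaming (map-∘ to List-map-∘; map-id to List-map-id)
open import Data.List.Relation.Binary.Pointwise as PW using (Pointwise; []; _∷_)
open import Data.List.Relation.Unary.All using (All; []; _∷_)
  renaming (map to All-map; lookup to All-lookup; tabulate to All-tabulate)
open import Data.List.Relation.Unary.All.Properties using () renaming (++⁺ to All-++⁺; ++⁻ to All-++⁻)
open import Data.List.Relation.Unary.AllPairs using (AllPairs; []; _∷_) renaming (map to AllPairs-map)
open import Data.List.Relation.Unary.Any using (here; there)
open import Data.List.Relation.Unary.Unique.DecPropositional.Properties using (deduplicate-!)
open import Data.List.Relation.Unary.Unique.Propositional using (Unique)
open import Data.Nat using (ℕ; zero; suc; _+_; _⊔_; _≟_; _<_; _≤_; _≤′_; ≤′-refl; ≤′-step)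
open import Data.Nat.Binary using (ℕᵇ; 2[1+_]; 1+[2_]; toℕ) renaming (zero to 0ᵇ)
open import Data.Nat.Binary.Properties using (toℕ-injective; 2[1+_]-injective; 1+[2_]-injective)
open import Data.Nat.Properties
  using (m≤m⊔n; m≤n⊔m; m≤m+n; +-cancelˡ-≡; ≤-refl; ≤-trans; <⇒≤; <-≤-trans; <-irrefl; ≤⇒≤′)
open import Data.Product using (Σ; ∃; ∃-syntax; _×_; _,_; proj₁; proj₂)
open import Data.Sum using (_⊎_; inj₁; inj₂) renaming (map to ⊎-map)
open import Data.Unit using (tt)
open import Data.Vec as Vec using (Vec; []; _∷_; toList)
open import Data.Vec.Properties using () renaming (map-∘ to Vec-map-∘; map-id to Vec-map-id)
import Data.Vec.Relation.Binary.Pointwise.Inductive as VecPW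
open VecPW using ([]; _∷_)
import Data.Vec.Relation.Unary.All as VecAll
open VecAll using ([]; _∷_)
open import Data.Vec.Relation.Unary.All.Properties using () renaming (map⁺ to VecAll-map⁺)
open import Function using (_∘_; id)
open import Function.Bundles using (_⇔_; mk⇔; Equivalence)
open import Level using (0ℓ)
open import Relation.Binary.PropositionalEquality
  using (_≡_; _≢_; refl; trans; cong; cong₂; subst; subst₂; module ≡-Reasoning)
  renaming (sym to ≡-sym)
open import Relation.Nullary using (¬_; Dec; yes; no)
open import Relation.Nullary.Decidable using (¬?; map′)
open import Relation.Unary using (Pred; Irrelevant; _⊆_; _≐_; _∪_)

open Equivalence using (to; from)

private variable
  S Q X Y : Set
  m n : ℕ

-- Simultaneous substitution into lists

-- An assignment of lists to all variables.
Env : Set → Set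
Env S = Var → Str S

infixl 20 _[_↦_]

-- ρ with its value at x changed to m.
_[_↦_] : (Var → X) → Var → X → Var → X
(ρ [ x ↦ m ]) y with x ≟ y
... | yes _ = m
... | no  _ = ρ y

-- The identical substitution.
ids : Env S
ids x = [ var x ]

-- The list that replaces a single token.
bindToken : Env S → Token S → Str S
bindToken ρ (var x) = ρ x
bindToken ρ (sym a) = [ sym a ]
bindToken ρ lp      = [ lp ]
bindToken ρ rp      = [ rp ]

-- The list obtained from l by replacing all variables simultaneously.
bind : Env S → Str S → Str S
bind ρ = concatMap (bindToken ρ)

update-same : (ρ : Var → X) (x : Var) (m : X) → (ρ [ x ↦ m ]) x ≡ m
update-same ρ x m with x ≟ x
... | yes _  = refl
... | no x≢x = ⊥-elim (x≢x refl)

update-other : (ρ : Var → X) {x y : Var} (m : X) → x ≢ y → (ρ [ x ↦ m ]) y ≡ ρ y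
update-other ρ {x} {y} m x≢y with x ≟ y
... | yes x≡y = ⊥-elim (x≢y x≡y)
... | no _    = refl

update-cong : {ρ σ : Var → X} {x y : Var} (m : X) → (x ≢ y → ρ y ≡ σ y) →
              (ρ [ x ↦ m ]) y ≡ (σ [ x ↦ m ]) y
update-cong {x = x} {y} m h with x ≟ y
... | yes _   = refl
... | no  x≢y = h x≢y

update-all : {P : Pred X 0ℓ} {ρ : Var → X} (x : Var) {m : X} →
             (∀ y → P (ρ y)) → P m → ∀ y → P ((ρ [ x ↦ m ]) y)
update-all x ρ∈P m∈P y with x ≟ y
... | yes _ = m∈P
... | no  _ = ρ∈P y

bind-cong : {ρ σ : Env S} (l : Str S) → (∀ x → x ∈var l → ρ x ≡ σ x) →
            bind ρ l ≡ bind σ l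
bind-cong []          h = refl
bind-cong (var x ∷ l) h =
  cong₂ _++_ (h x (here refl)) (bind-cong l λ y y∈ → h y (there y∈))
bind-cong (sym a ∷ l) h = cong (sym a ∷_) (bind-cong l λ y y∈ → h y (there y∈))
bind-cong (lp ∷ l)    h = cong (lp ∷_) (bind-cong l λ y y∈ → h y (there y∈))
bind-cong (rp ∷ l)    h = cong (rp ∷_) (bind-cong l λ y y∈ → h y (there y∈))

bind-ids : (l : Str S) → bind ids l ≡ l
bind-ids []          = refl
bind-ids (var x ∷ l) = cong (var x ∷_) (bind-ids l)
bind-ids (sym a ∷ l) = cong (sym a ∷_) (bind-ids l)
bind-ids (lp ∷ l)    = cong (lp ∷_) (bind-ids l)
bind-ids (rp ∷ l)    = cong (rp ∷_) (bind-ids l)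

bind-++ : (ρ : Env S) (l m : Str S) → bind ρ (l ++ m) ≡ bind ρ l ++ bind ρ m
bind-++ ρ = concatMap-++ (bindToken ρ)

bind-bind : (ρ σ : Env S) (l : Str S) → bind ρ (bind σ l) ≡ bind (bind ρ ∘ σ) l
bind-bind ρ σ []          = refl
bind-bind ρ σ (var x ∷ l) =
  trans (bind-++ ρ (σ x) (bind σ l)) (cong (bind ρ (σ x) ++_) (bind-bind ρ σ l))
bind-bind ρ σ (sym a ∷ l) = cong (sym a ∷_) (bind-bind ρ σ l)
bind-bind ρ σ (lp ∷ l)    = cong (lp ∷_) (bind-bind ρ σ l)
bind-bind ρ σ (rp ∷ l)    = cong (rp ∷_) (bind-bind ρ σ l)

subst≡bind : (l m : Str S) (x : Var) → l ⟦ m / x ⟧ ≡ bind (ids [ x ↦ m ]) l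
subst≡bind []          m x = refl
subst≡bind (var y ∷ l) m x with x ≟ y
... | yes _ = cong (m ++_) (subst≡bind l m x)
... | no  _ = cong (var y ∷_) (subst≡bind l m x)
subst≡bind (sym a ∷ l) m x = cong (sym a ∷_) (subst≡bind l m x)
subst≡bind (lp ∷ l)    m x = cong (lp ∷_) (subst≡bind l m x)
subst≡bind (rp ∷ l)    m x = cong (rp ∷_) (subst≡bind l m x)

-- Substituting after a simultaneous substitution.
bind-subst : {ρ σ : Env S} (l m : Str S) (x : Var) →
             (∀ y → y ∈var l → ρ y ⟦ m / x ⟧ ≡ σ y) →
             bind ρ l ⟦ m / x ⟧ ≡ bind σ l
bind-subst {ρ = ρ} {σ} l m x h = begin
  bind ρ l ⟦ m / x ⟧                ≡⟨ subst≡bind (bind ρ l) m x ⟩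
  bind (ids [ x ↦ m ]) (bind ρ l)   ≡⟨ bind-bind _ ρ l ⟩
  bind (bind (ids [ x ↦ m ]) ∘ ρ) l
    ≡⟨ bind-cong l (λ y y∈ → trans (≡-sym (subst≡bind (ρ y) m x)) (h y y∈)) ⟩
  bind σ l                          ∎
  where open ≡-Reasoning

subst-fresh : (l m : Str S) {x : Var} → ¬ x ∈var l → l ⟦ m / x ⟧ ≡ l
subst-fresh l m {x} x∉l = trans (subst≡bind l m x)
  (trans (bind-cong l λ y y∈ → update-other ids {x} m λ { refl → x∉l y∈ }) (bind-ids l))

subst-self : (l : Str S) (x : Var) → l ⟦ [ var x ] / x ⟧ ≡ l
subst-self l x = trans (subst≡bind l [ var x ] x)
  (trans (bind-cong l λ y _ → lemma y) (bind-ids l))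
  where
  lemma : ∀ y → (ids [ x ↦ [ var x ] ]) y ≡ ids y
  lemma y with x ≟ y
  ... | yes refl = refl
  ... | no  _    = refl

ids-subst-same : (m : Str S) (x : Var) → ids x ⟦ m / x ⟧ ≡ m
ids-subst-same m x = trans (subst≡bind [ var x ] m x)
  (trans (++-identityʳ _) (update-same ids x m))

ids-subst-other : (m : Str S) {x y : Var} → x ≢ y → ids y ⟦ m / x ⟧ ≡ ids y
ids-subst-other m x≢y = subst-fresh _ m λ { (here refl) → x≢y refl }

-- Variables of l, with repetitions.
varsOf : Str S → List Var
varsOf []          = []
varsOf (var x ∷ l) = x ∷ varsOf l
varsOf (sym _ ∷ l) = varsOf l
varsOf (lp ∷ l)    = varsOf l
varsOf (rp ∷ l)    = varsOf l

varsOf⁺ : (l : Str S) {x : Var} → x ∈var l → x ∈ varsOf l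
varsOf⁺ (var _ ∷ l) (here refl) = here refl
varsOf⁺ (var _ ∷ l) (there x∈)  = there (varsOf⁺ l x∈)
varsOf⁺ (sym _ ∷ l) (there x∈)  = varsOf⁺ l x∈
varsOf⁺ (lp ∷ l)    (there x∈)  = varsOf⁺ l x∈
varsOf⁺ (rp ∷ l)    (there x∈)  = varsOf⁺ l x∈

varsOf⁻ : (l : Str S) {x : Var} → x ∈ varsOf l → x ∈var l
varsOf⁻ (var _ ∷ l) (here refl) = here refl
varsOf⁻ (var _ ∷ l) (there x∈)  = there (varsOf⁻ l x∈)
varsOf⁻ (sym _ ∷ l) x∈          = there (varsOf⁻ l x∈)
varsOf⁻ (lp ∷ l)    x∈          = there (varsOf⁻ l x∈)
varsOf⁻ (rp ∷ l)    x∈          = there (varsOf⁻ l x∈)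

∈-bind⁻ : (ρ : Env S) (l : Str S) {z : Var} → z ∈var bind ρ l →
          ∃[ x ] x ∈var l × z ∈var ρ x
∈-bind⁻ ρ (var x ∷ l) z∈ with ∈-++⁻ (ρ x) z∈
... | inj₁ z∈ρx = x , here refl , z∈ρx
... | inj₂ z∈l  with ∈-bind⁻ ρ l z∈l
...   | y , y∈ , z∈ρy = y , there y∈ , z∈ρy
∈-bind⁻ ρ (sym _ ∷ l) (there z∈) with ∈-bind⁻ ρ l z∈
... | y , y∈ , z∈ρy = y , there y∈ , z∈ρy
∈-bind⁻ ρ (lp ∷ l) (there z∈) with ∈-bind⁻ ρ l z∈
... | y , y∈ , z∈ρy = y , there y∈ , z∈ρy
∈-bind⁻ ρ (rp ∷ l) (there z∈) with ∈-bind⁻ ρ l z∈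
... | y , y∈ , z∈ρy = y , there y∈ , z∈ρy

∈-bind⁺ : (ρ : Env S) (l : Str S) {x z : Var} → x ∈var l → z ∈var ρ x →
          z ∈var bind ρ l
∈-bind⁺ ρ (var x ∷ l) (here refl) z∈ = ∈-++⁺ˡ z∈
∈-bind⁺ ρ (var x ∷ l) (there x∈)  z∈ = ∈-++⁺ʳ (ρ x) (∈-bind⁺ ρ l x∈ z∈)
∈-bind⁺ ρ (sym _ ∷ l) (there x∈)  z∈ = there (∈-bind⁺ ρ l x∈ z∈)
∈-bind⁺ ρ (lp ∷ l)    (there x∈)  z∈ = there (∈-bind⁺ ρ l x∈ z∈)
∈-bind⁺ ρ (rp ∷ l)    (there x∈)  z∈ = there (∈-bind⁺ ρ l x∈ z∈)

maxVar : List Var → ℕ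
maxVar []       = 0
maxVar (x ∷ xs) = suc x ⊔ maxVar xs

<-maxVar : {x : Var} {xs : List Var} → x ∈ xs → x < maxVar xs
<-maxVar {xs = x ∷ xs} (here refl) = m≤m⊔n (suc x) (maxVar xs)
<-maxVar {xs = x ∷ xs} (there x∈)  = <-≤-trans (<-maxVar x∈) (m≤n⊔m (suc x) (maxVar xs))

-- A strict upper bound of the variables of l.
bound : Str S → ℕ
bound l = maxVar (varsOf l)

<-bound : (l : Str S) {x : Var} → x ∈var l → x < bound l
<-bound l x∈ = <-maxVar (varsOf⁺ l x∈)

-- Closure of sets of lists under substitution

-- A simultaneous substitution ρ is carried out by first renaming each variable
-- x to r x and then substituting ρ x for r x, one variable after the other.
-- The hypotheses on ρ and r say that no step affects what another one has
-- produced or has still to treat.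
sequential :
  (P : Pred (Str S) 0ℓ) (r : Var → Var) (ρ : Env S) (l : Str S) →
  (∀ x → x ∈var l → ∀ {m} → P m → P (m ⟦ ρ x / r x ⟧)) →
  (∀ x y → x ∈var l → y ∈var l → ρ y ⟦ ρ x / r x ⟧ ≡ ρ y) →
  (∀ x y → x ∈var l → y ∈var l → x ≢ y → ids (r y) ⟦ ρ x / r x ⟧ ≡ ids (r y)) →
  P (bind (ids ∘ r) l) → P (bind ρ l)
sequential {S} P r ρ l closed ρ-fixed r-fixed =
  go (varsOf l) (varsOf⁻ l) (ids ∘ r) λ y y∈ → inj₂ (varsOf⁺ l y∈ , refl)
  where
  -- xs are the variables still to be treated, e the assignment reached so far.
  go : (xs : List Var) → (∀ {x} → x ∈ xs → x ∈var l) → (e : Env S) →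
       (∀ y → y ∈var l → e y ≡ ρ y ⊎ (y ∈ xs × e y ≡ ids (r y))) →
       P (bind e l) → P (bind ρ l)
  go [] _ e inv Pe = subst P (bind-cong l λ y y∈ → done (inv y y∈)) Pe
    where
    done : ∀ {y} → e y ≡ ρ y ⊎ (y ∈ [] × e y ≡ ids (r y)) → e y ≡ ρ y
    done (inj₁ e≡) = e≡
  go (x ∷ xs) xs⊆l e inv Pe =
    go xs (xs⊆l ∘ there) (e [ x ↦ ρ x ]) inv′
      (subst P (bind-subst l (ρ x) (r x) update-correct) (closed x x∈l Pe))
    where
    x∈l : x ∈var l
    x∈l = xs⊆l (here refl)

    inv′ : ∀ y → y ∈var l → (e [ x ↦ ρ x ]) y ≡ ρ y ⊎ (y ∈ xs × (e [ x ↦ ρ x ]) y ≡ ids (r y))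
    inv′ y y∈ with x ≟ y
    ... | yes refl = inj₁ refl
    ... | no x≢y with inv y y∈
    ...   | inj₁ e≡                = inj₁ e≡
    ...   | inj₂ (here refl , e≡)  = ⊥-elim (x≢y refl)
    ...   | inj₂ (there y∈xs , e≡) = inj₂ (y∈xs , e≡)

    update-correct : ∀ y → y ∈var l → e y ⟦ ρ x / r x ⟧ ≡ (e [ x ↦ ρ x ]) y
    update-correct y y∈ with x ≟ y | inv y y∈
    ... | yes refl | inj₁ e≡       rewrite e≡ = ρ-fixed x x x∈l x∈l
    ... | yes refl | inj₂ (_ , e≡) rewrite e≡ = ids-subst-same (ρ x) (r x)
    ... | no x≢y   | inj₁ e≡       rewrite e≡ = ρ-fixed x y x∈l y∈
    ... | no x≢y   | inj₂ (_ , e≡) rewrite e≡ = r-fixed x y x∈l y∈ x≢y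

-- A set of lists that contains the variables and is closed under the
-- substitution of one of its members for a single variable.
record SubstClosed (L : Pred (Str S) 0ℓ) : Set where
  field
    variable∈ : ∀ x → L [ var x ]
    subst∈    : ∀ {l m} x → L l → L m → L (l ⟦ m / x ⟧)

open SubstClosed

-- Closure under single substitutions entails closure under simultaneous ones:
-- the variables of l are first moved out of the way, to variables occurring
-- neither in l nor in the lists substituted for them.
bind∈ : {L : Pred (Str S) 0ℓ} → SubstClosed L → (ρ : Env S) → (∀ x → L (ρ x)) →
        ∀ {l} → L l → L (bind ρ l)
bind∈ {L = L} closed ρ ρ∈L {l} l∈L =
  sequential L shift ρ l
    (λ x _ m∈L → subst∈ closed (shift x) m∈L (ρ∈L x))
    (λ x y _ y∈ → subst-fresh (ρ y) (ρ x) (shift∉ρ x y∈))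
    (λ x y _ _ x≢y → ids-subst-other (ρ x) (x≢y ∘ +-cancelˡ-≡ B x y))
    shifted
  where
  B : ℕ
  B = bound l ⊔ bound (bind ρ l)

  shift : Var → Var
  shift x = B + x

  shift∉ρ : ∀ x {y} → y ∈var l → ¬ shift x ∈var ρ y
  shift∉ρ x y∈ z∈ = <-irrefl refl (<-≤-trans (<-bound (bind ρ l) (∈-bind⁺ ρ l y∈ z∈))
    (≤-trans (m≤n⊔m (bound l) _) (m≤m+n B x)))

  x≢shift : ∀ {x} y → x ∈var l → x ≢ shift y
  x≢shift {x} y x∈ e≡ = <-irrefl e≡
    (<-≤-trans (<-bound l x∈) (≤-trans (m≤m⊔n (bound l) _) (m≤m+n B y)))

  shifted : L (bind (ids ∘ shift) l)
  shifted = sequential L id (ids ∘ shift) l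
    (λ x _ m∈L → subst∈ closed x m∈L (variable∈ closed (shift x)))
    (λ x y x∈ _ → ids-subst-other _ (x≢shift y x∈))
    (λ x y _ _ x≢y → ids-subst-other _ x≢y)
    (subst L (≡-sym (bind-ids l)) l∈L)

-- What may be substituted for a variable: a variable or a member of K.
Choice : Pred S 0ℓ → Set
Choice K = Var ⊎ ∃ K

choiceToken : {K : Pred S 0ℓ} → Choice K → Token S
choiceToken (inj₁ x)       = var x
choiceToken (inj₂ (c , _)) = sym c

-- σ as a simultaneous substitution.
choose : {K : Pred S 0ℓ} → (Var → Choice K) → Env S
choose σ x = [ choiceToken (σ x) ]

-- The members of Adjoin L K are results of simultaneous substitutions of
-- variables and members of K in lists of L.  The converse, choose⇒adjoin, needs
-- that L is closed under substitution.
adjoin⇒choose : {L : Pred (Str S) 0ℓ} {K : Pred S 0ℓ} → ∀ {l} → Adjoin L K l →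
                ∃[ l₀ ] Σ (Var → Choice K) λ σ → L l₀ × l ≡ bind (choose σ) l₀
adjoin⇒choose (base {l} l∈L) = l , inj₁ , l∈L , ≡-sym (bind-ids l)
adjoin⇒choose {K = K} (step {c = c} x l∈ c∈K) with adjoin⇒choose l∈
... | l₀ , σ , l₀∈L , refl =
  l₀ , τ ∘ σ , l₀∈L , bind-subst l₀ [ sym c ] x (λ y _ → τ-correct (σ y))
  where
  τ : Choice K → Choice K
  τ (inj₁ y) with x ≟ y
  ... | yes _ = inj₂ (c , c∈K)
  ... | no  _ = inj₁ y
  τ (inj₂ k) = inj₂ k

  τ-correct : ∀ k → [ choiceToken k ] ⟦ [ sym c ] / x ⟧ ≡ [ choiceToken (τ k) ]
  τ-correct (inj₁ y) with x ≟ y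
  ... | yes _ = refl
  ... | no  _ = refl
  τ-correct (inj₂ _) = refl

choose⇒adjoin : {L : Pred (Str S) 0ℓ} {K : Pred S 0ℓ} → SubstClosed L →
                (σ : Var → Choice K) → ∀ {l} → L l → Adjoin L K (bind (choose σ) l)
choose⇒adjoin {L = L} {K} closed σ {l} l∈L =
  sequential (Adjoin L K) (λ x → r x (σ x)) (choose σ) l
    (λ x _ → step∈ x (σ x))
    (λ x y _ y∈ → fixed x (σ x) (choose σ y) (∈-bind⁺ (choose σ) l y∈))
    (λ x y x∈ y∈ x≢y → ids-fixed x y (σ x) (σ y) x≢y (∈-bind⁺ (choose σ) l y∈))
    (base (bind∈ closed _ (λ x → variable∈ closed _) l∈L))
  where
  B : ℕ
  B = bound (bind (choose σ) l)

  -- Variables replaced by members of K are first renamed to fresh ones, the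
  -- others at once to their final value.
  r : Var → Choice K → Var
  r x (inj₁ y) = y
  r x (inj₂ _) = B + x

  B+x∉ : ∀ x → ¬ (B + x) ∈var bind (choose σ) l
  B+x∉ x z∈ = <-irrefl refl (<-≤-trans (<-bound _ z∈) (m≤m+n B x))

  step∈ : ∀ x k {m} → Adjoin L K m → Adjoin L K (m ⟦ [ choiceToken k ] / r x k ⟧)
  step∈ x (inj₁ y)         m∈ = subst (Adjoin L K) (≡-sym (subst-self _ y)) m∈
  step∈ x (inj₂ (c , c∈K)) m∈ = step (B + x) m∈ c∈K

  fixed : ∀ x k m → (∀ {z} → z ∈var m → z ∈var bind (choose σ) l) →
          m ⟦ [ choiceToken k ] / r x k ⟧ ≡ m
  fixed x (inj₁ y) m m⊆ = subst-self m y
  fixed x (inj₂ _) m m⊆ = subst-fresh m _ (B+x∉ x ∘ m⊆)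

  ids-fixed : ∀ x y k k′ → x ≢ y →
              (∀ {z} → z ∈var [ choiceToken k′ ] → z ∈var bind (choose σ) l) →
              ids (r y k′) ⟦ [ choiceToken k ] / r x k ⟧ ≡ ids (r y k′)
  ids-fixed x y k        (inj₁ z) x≢y k′⊆ = fixed x k [ var z ] k′⊆
  ids-fixed x y (inj₁ w) (inj₂ _) x≢y k′⊆ = subst-self _ w
  ids-fixed x y (inj₂ _) (inj₂ _) x≢y k′⊆ =
    ids-subst-other _ (x≢y ∘ +-cancelˡ-≡ B x y)

double : ℕ → ℕ
double zero    = zero
double (suc n) = suc (suc (double n))

-- The inverse of the bijection of ℕ ⊎ ℕ onto ℕ given by n ↦ 2n and n ↦ 2n + 1.
parity : ℕ → ℕ ⊎ ℕ
parity zero          = inj₁ zero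
parity (suc zero)    = inj₂ zero
parity (suc (suc n)) with parity n
... | inj₁ k = inj₁ (suc k)
... | inj₂ k = inj₂ (suc k)

parity-even : ∀ n → parity (double n) ≡ inj₁ n
parity-even zero = refl
parity-even (suc n) rewrite parity-even n = refl

parity-odd : ∀ n → parity (suc (double n)) ≡ inj₂ n
parity-odd zero = refl
parity-odd (suc n) rewrite parity-odd n = refl

-- The substitution of one list of Adjoin L K in another is again obtained from
-- a list of L by a simultaneous substitution of variables and members of K.
adjoin-closed : {L : Pred (Str S) 0ℓ} {K : Pred S 0ℓ} → SubstClosed L →
                SubstClosed (Adjoin L K)
adjoin-closed closed .variable∈ x = base (variable∈ closed x)
adjoin-closed {S} {L} {K} closed .subst∈ x l∈ m∈
  with adjoin⇒choose l∈ | adjoin⇒choose m∈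
... | l₀ , σ , l₀∈L , refl | m₀ , τ , m₀∈L , refl =
  subst (Adjoin L K) (≡-sym e≡)
    (choose⇒adjoin closed σ⊎τ (bind∈ closed ρ (λ y → ρ∈L (σ y) y) l₀∈L))
  where
  -- The variables y of l₀ become 2y and the variables z of m₀ become 2z + 1, to
  -- keep them apart.
  σ⊎τ : Var → Choice K
  σ⊎τ y with parity y
  ... | inj₁ k = σ k
  ... | inj₂ k = τ k

  m₁ : Str S
  m₁ = bind (ids ∘ suc ∘ double) m₀

  -- The list of L put in place of a variable y of l₀ with σ y = k.
  ρ-at : Choice K → Env S
  ρ-at (inj₁ z) y with x ≟ z
  ... | yes _ = m₁
  ... | no  _ = ids (double y)
  ρ-at (inj₂ _) y = ids (double y)

  ρ : Env S
  ρ y = ρ-at (σ y) y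

  ρ∈L : ∀ k y → L (ρ-at k y)
  ρ∈L (inj₁ z) y with x ≟ z
  ... | yes _ = bind∈ closed _ (λ _ → variable∈ closed _) m₀∈L
  ... | no  _ = variable∈ closed _
  ρ∈L (inj₂ _) y = variable∈ closed _

  mτ : Str S
  mτ = bind (choose τ) m₀

  m₁-correct : bind (choose σ⊎τ) m₁ ≡ mτ
  m₁-correct = trans (bind-bind _ _ m₀) (bind-cong m₀ λ y _ → odd y)
    where
    odd : ∀ y → bind (choose σ⊎τ) (ids (suc (double y))) ≡ choose τ y
    odd y rewrite parity-odd y = refl

  even : ∀ y → choose σ⊎τ (double y) ≡ choose σ y
  even y rewrite parity-even y = refl

  ρ-correct : ∀ k y → [ choiceToken k ] ≡ choose σ y →
              [ choiceToken k ] ⟦ mτ / x ⟧ ≡ bind (choose σ⊎τ) (ρ-at k y)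
  ρ-correct (inj₁ z) y k≡ with x ≟ z
  ... | yes refl = trans (++-identityʳ mτ) (≡-sym m₁-correct)
  ... | no  _    = trans k≡ (≡-sym (trans (++-identityʳ _) (even y)))
  ρ-correct (inj₂ _) y k≡ = trans k≡ (≡-sym (trans (++-identityʳ _) (even y)))

  e≡ : bind (choose σ) l₀ ⟦ mτ / x ⟧ ≡ bind (choose σ⊎τ) (bind ρ l₀)
  e≡ = trans (bind-subst l₀ mτ x (λ y _ → ρ-correct (σ y) y refl))
             (≡-sym (bind-bind _ ρ l₀))

adjoin-mono : {L L′ : Pred (Str S) 0ℓ} {K K′ : Pred S 0ℓ} → L ⊆ L′ → K ⊆ K′ →
              Adjoin L K ⊆ Adjoin L′ K′
adjoin-mono L⊆ K⊆ (base l∈)       = base (L⊆ l∈)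
adjoin-mono L⊆ K⊆ (step x l∈ c∈K) = step x (adjoin-mono L⊆ K⊆ l∈) (K⊆ c∈K)

isList-mono : {A A′ : Pred S 0ℓ} → A ⊆ A′ → IsList A ⊆ IsList A′
isList-mono A⊆ (variable-list x)     = variable-list x
isList-mono A⊆ (symbol-list a∈)      = symbol-list (A⊆ a∈)
isList-mono A⊆ (application f∈ l∈)   = application (A⊆ f∈) (isList-mono A⊆ l∈)
isList-mono A⊆ (concatenation l∈ m∈) = concatenation (isList-mono A⊆ l∈) (isList-mono A⊆ m∈)

isList-subst : {A : Pred S 0ℓ} {l m : Str S} (x : Var) → IsList A l → IsList A m →
               IsList A (l ⟦ m / x ⟧)
isList-subst {m = m} x (variable-list y) m∈ with x ≟ y
... | yes _ = subst (IsList _) (≡-sym (++-identityʳ m)) m∈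
... | no  _ = variable-list y
isList-subst x (symbol-list a∈) m∈ = symbol-list a∈
isList-subst {m = m} x (application {f} {l} f∈ l∈) m∈ =
  subst (IsList _) (cong (λ k → sym f ∷ lp ∷ k) (≡-sym (concatMap-++ (substToken m x) l [ rp ])))
    (application f∈ (isList-subst x l∈ m∈))
isList-subst {m = m} x (concatenation {k} {l} k∈ l∈) m∈ =
  subst (IsList _) (≡-sym (concatMap-++ (substToken m x) k l))
    (concatenation (isList-subst x k∈ m∈) (isList-subst x l∈ m∈))

adjoin-isList : {L : Pred (Str S) 0ℓ} {A K : Pred S 0ℓ} →
                L ⊆ IsList A → K ⊆ A → Adjoin L K ⊆ IsList A
adjoin-isList L⊆ K⊆ (base l∈)       = L⊆ l∈
adjoin-isList L⊆ K⊆ (step x l∈ c∈K) =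
  isList-subst x (adjoin-isList L⊆ K⊆ l∈) (symbol-list (K⊆ c∈K))

-- Simultaneous substitution into formulas

-- The formula in which every free occurrence of each variable x is replaced by
-- ρ x.  Collisions are not prevented.
bindᶠ : Env S → Formula S Q → Formula S Q
bindᶠ ρ (eq l m)   = eq (bind ρ l) (bind ρ m)
bindᶠ ρ (rel p ls) = rel p (Vec.map (bind ρ) ls)
bindᶠ ρ (neg F)    = neg (bindᶠ ρ F)
bindᶠ ρ (imp F G)  = imp (bindᶠ ρ F) (bindᶠ ρ G)
bindᶠ ρ (iff F G)  = iff (bindᶠ ρ F) (bindᶠ ρ G)
bindᶠ ρ (con F G)  = con (bindᶠ ρ F) (bindᶠ ρ G)
bindᶠ ρ (dis F G)  = dis (bindᶠ ρ F) (bindᶠ ρ G)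
bindᶠ ρ (all x F)  = all x (bindᶠ (ρ [ x ↦ ids x ]) F)
bindᶠ ρ (ex x F)   = ex x (bindᶠ (ρ [ x ↦ ids x ]) F)

map-cong-vars : {f g : Str S → X} (ls : Vec (Str S) n) →
                (∀ l → (∀ x → x ∈var l → x ∈var concat (toList ls)) → f l ≡ g l) →
                Vec.map f ls ≡ Vec.map g ls
map-cong-vars []       h = refl
map-cong-vars (l ∷ ls) h =
  cong₂ _∷_ (h l λ x → ∈-++⁺ˡ)
            (map-cong-vars ls λ m m⊆ → h m λ x x∈ → ∈-++⁺ʳ l (m⊆ x x∈))

concat-bind : (ρ : Env S) (ls : Vec (Str S) n) →
              concat (toList (Vec.map (bind ρ) ls)) ≡ bind ρ (concat (toList ls))
concat-bind ρ []       = refl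
concat-bind ρ (l ∷ ls) =
  trans (cong (bind ρ l ++_) (concat-bind ρ ls)) (≡-sym (bind-++ ρ l (concat (toList ls))))

-- Free variables of F, with repetitions.
freeVars : Formula S Q → List Var
freeVars (eq l m)   = varsOf l ++ varsOf m
freeVars (rel p ls) = varsOf (concat (toList ls))
freeVars (neg F)    = freeVars F
freeVars (imp F G)  = freeVars F ++ freeVars G
freeVars (iff F G)  = freeVars F ++ freeVars G
freeVars (con F G)  = freeVars F ++ freeVars G
freeVars (dis F G)  = freeVars F ++ freeVars G
freeVars (all x F)  = filter (λ y → ¬? (y ≟ x)) (freeVars F)
freeVars (ex x F)   = filter (λ y → ¬? (y ≟ x)) (freeVars F)

∈-++-cong⁺ : {P₁ P₂ : Set} {x : X} {xs ys : List X} →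
             (P₁ → x ∈ xs) → (P₂ → x ∈ ys) → P₁ ⊎ P₂ → x ∈ xs ++ ys
∈-++-cong⁺ f g (inj₁ p) = ∈-++⁺ˡ (f p)
∈-++-cong⁺ {xs = xs} f g (inj₂ p) = ∈-++⁺ʳ xs (g p)

∈-++-cong⁻ : {P₁ P₂ : Set} {x : X} (xs : List X) {ys : List X} →
             (x ∈ xs → P₁) → (x ∈ ys → P₂) → x ∈ xs ++ ys → P₁ ⊎ P₂
∈-++-cong⁻ xs f g x∈ with ∈-++⁻ xs x∈
... | inj₁ p = inj₁ (f p)
... | inj₂ p = inj₂ (g p)

freeVars⁺ : (F : Formula S Q) {x : Var} → x ∈free F → x ∈ freeVars F
freeVars⁺ (eq l m)   = ∈-++-cong⁺ (varsOf⁺ l) (varsOf⁺ m)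
freeVars⁺ (rel p ls) = varsOf⁺ (concat (toList ls))
freeVars⁺ (neg F)    = freeVars⁺ F
freeVars⁺ (imp F G)  = ∈-++-cong⁺ (freeVars⁺ F) (freeVars⁺ G)
freeVars⁺ (iff F G)  = ∈-++-cong⁺ (freeVars⁺ F) (freeVars⁺ G)
freeVars⁺ (con F G)  = ∈-++-cong⁺ (freeVars⁺ F) (freeVars⁺ G)
freeVars⁺ (dis F G)  = ∈-++-cong⁺ (freeVars⁺ F) (freeVars⁺ G)
freeVars⁺ (all x F)  (x≢ , x∈) = ∈-filter⁺ (λ y → ¬? (y ≟ x)) (freeVars⁺ F x∈) x≢
freeVars⁺ (ex x F)   (x≢ , x∈) = ∈-filter⁺ (λ y → ¬? (y ≟ x)) (freeVars⁺ F x∈) x≢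

freeVars⁻ : (F : Formula S Q) {x : Var} → x ∈ freeVars F → x ∈free F
freeVars⁻ (eq l m)   = ∈-++-cong⁻ (varsOf l) (varsOf⁻ l) (varsOf⁻ m)
freeVars⁻ (rel p ls) = varsOf⁻ (concat (toList ls))
freeVars⁻ (neg F)    = freeVars⁻ F
freeVars⁻ (imp F G)  = ∈-++-cong⁻ (freeVars F) (freeVars⁻ F) (freeVars⁻ G)
freeVars⁻ (iff F G)  = ∈-++-cong⁻ (freeVars F) (freeVars⁻ F) (freeVars⁻ G)
freeVars⁻ (con F G)  = ∈-++-cong⁻ (freeVars F) (freeVars⁻ F) (freeVars⁻ G)
freeVars⁻ (dis F G)  = ∈-++-cong⁻ (freeVars F) (freeVars⁻ F) (freeVars⁻ G)
freeVars⁻ (all x F) {y} y∈ with ∈-filter⁻ (λ y → ¬? (y ≟ x)) {v = y} {xs = freeVars F} y∈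
... | y∈F , y≢x = y≢x , freeVars⁻ F y∈F
freeVars⁻ (ex x F) {y} y∈ with ∈-filter⁻ (λ y → ¬? (y ≟ x)) {v = y} {xs = freeVars F} y∈
... | y∈F , y≢x = y≢x , freeVars⁻ F y∈F

_∈free?_ : (x : Var) (F : Formula S Q) → Dec (x ∈free F)
x ∈free? F = map′ (freeVars⁻ F) (freeVars⁺ F) (_∈?_ _≟_ x (freeVars F))

bindᶠ-cong : {ρ σ : Env S} (F : Formula S Q) → (∀ x → x ∈free F → ρ x ≡ σ x) →
             bindᶠ ρ F ≡ bindᶠ σ F
bindᶠ-cong (eq l m)   h =
  cong₂ eq (bind-cong l λ x → h x ∘ inj₁) (bind-cong m λ x → h x ∘ inj₂)
bindᶠ-cong (rel p ls) h =
  cong (rel p) (map-cong-vars ls λ l l⊆ → bind-cong l λ x x∈ → h x (l⊆ x x∈))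
bindᶠ-cong (neg F)    h = cong neg (bindᶠ-cong F h)
bindᶠ-cong (imp F G)  h =
  cong₂ imp (bindᶠ-cong F λ x → h x ∘ inj₁) (bindᶠ-cong G λ x → h x ∘ inj₂)
bindᶠ-cong (iff F G)  h =
  cong₂ iff (bindᶠ-cong F λ x → h x ∘ inj₁) (bindᶠ-cong G λ x → h x ∘ inj₂)
bindᶠ-cong (con F G)  h =
  cong₂ con (bindᶠ-cong F λ x → h x ∘ inj₁) (bindᶠ-cong G λ x → h x ∘ inj₂)
bindᶠ-cong (dis F G)  h =
  cong₂ dis (bindᶠ-cong F λ x → h x ∘ inj₁) (bindᶠ-cong G λ x → h x ∘ inj₂)
bindᶠ-cong (all y F)  h =
  cong (all y) (bindᶠ-cong F λ x x∈ → update-cong (ids y) λ y≢x → h x (y≢x ∘ ≡-sym , x∈))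
bindᶠ-cong (ex y F)   h =
  cong (ex y) (bindᶠ-cong F λ x x∈ → update-cong (ids y) λ y≢x → h x (y≢x ∘ ≡-sym , x∈))

ids-update-ids : ∀ x y → (ids {S = S} [ x ↦ ids x ]) y ≡ ids y
ids-update-ids x y with x ≟ y
... | yes refl = refl
... | no  _    = refl

bindᶠ-ids : (F : Formula S Q) → bindᶠ ids F ≡ F
bindᶠ-ids (eq l m)   = cong₂ eq (bind-ids l) (bind-ids m)
bindᶠ-ids (rel p ls) =
  cong (rel p) (trans (map-cong-vars ls λ l _ → bind-ids l) (Vec-map-id ls))
bindᶠ-ids (neg F)    = cong neg (bindᶠ-ids F)
bindᶠ-ids (imp F G)  = cong₂ imp (bindᶠ-ids F) (bindᶠ-ids G)
bindᶠ-ids (iff F G)  = cong₂ iff (bindᶠ-ids F) (bindᶠ-ids G)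
bindᶠ-ids (con F G)  = cong₂ con (bindᶠ-ids F) (bindᶠ-ids G)
bindᶠ-ids (dis F G)  = cong₂ dis (bindᶠ-ids F) (bindᶠ-ids G)
bindᶠ-ids (all y F)  =
  cong (all y) (trans (bindᶠ-cong F λ x _ → ids-update-ids y x) (bindᶠ-ids F))
bindᶠ-ids (ex y F)   =
  cong (ex y) (trans (bindᶠ-cong F λ x _ → ids-update-ids y x) (bindᶠ-ids F))

-- Each variable is left alone or replaced by a ground list.  No collisions can
-- occur under such a substitution.
Simple : Env S → Set
Simple σ = ∀ z → Ground (σ z) ⊎ σ z ≡ ids z

simple-update : {σ : Env S} → Simple σ → ∀ x → Simple (σ [ x ↦ ids x ])
simple-update simple x z with x ≟ z
... | yes refl = inj₂ refl
... | no  _    = simple z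

-- A single substitution, collision-free or not, following a simultaneous one.
bindᶠ-then-subst : {σ τ : Env S} (F : Formula S Q) (l : Str S) (x : Var) → Simple σ →
                   (∀ z → z ∈free F → τ z ≡ σ z ⟦ l / x ⟧) →
                   bindᶠ σ F ⟦ l / x ⟧ᶠ ≡ bindᶠ τ F
bindᶠ-then-subst (eq k m) l x s h =
  cong₂ eq (bind-subst k l x λ z → ≡-sym ∘ h z ∘ inj₁) (bind-subst m l x λ z → ≡-sym ∘ h z ∘ inj₂)
bindᶠ-then-subst {σ = σ} (rel p ls) l x s h =
  cong (rel p) (trans (≡-sym (Vec-map-∘ (_⟦ l / x ⟧) (bind σ) ls))
    (map-cong-vars ls λ k k⊆ → bind-subst k l x λ z z∈ → ≡-sym (h z (k⊆ z z∈))))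
bindᶠ-then-subst (neg F)   l x s h = cong neg (bindᶠ-then-subst F l x s h)
bindᶠ-then-subst (imp F G) l x s h =
  cong₂ imp (bindᶠ-then-subst F l x s λ z → h z ∘ inj₁) (bindᶠ-then-subst G l x s λ z → h z ∘ inj₂)
bindᶠ-then-subst (iff F G) l x s h =
  cong₂ iff (bindᶠ-then-subst F l x s λ z → h z ∘ inj₁) (bindᶠ-then-subst G l x s λ z → h z ∘ inj₂)
bindᶠ-then-subst (con F G) l x s h =
  cong₂ con (bindᶠ-then-subst F l x s λ z → h z ∘ inj₁) (bindᶠ-then-subst G l x s λ z → h z ∘ inj₂)
bindᶠ-then-subst (dis F G) l x s h =
  cong₂ dis (bindᶠ-then-subst F l x s λ z → h z ∘ inj₁) (bindᶠ-then-subst G l x s λ z → h z ∘ inj₂)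
bindᶠ-then-subst {σ = σ} {τ} (all y F) l x s h with x ≟ y
... | yes refl = cong (all y) (bindᶠ-cong F λ z z∈ → update-cong (ids y) λ y≢z →
        unaffected (s z) y≢z (h z (y≢z ∘ ≡-sym , z∈)))
  where
  unaffected : ∀ {z} → Ground (σ z) ⊎ σ z ≡ ids z → y ≢ z → τ z ≡ σ z ⟦ l / y ⟧ → σ z ≡ τ z
  unaffected {z} (inj₁ g) y≢z e = ≡-sym (trans e (subst-fresh (σ z) l (g y)))
  unaffected {z} (inj₂ i) y≢z e rewrite i = ≡-sym (trans e (ids-subst-other l y≢z))
... | no x≢y = cong (all y) (bindᶠ-then-subst F l x (simple-update s y) h′)
  where
  h′ : ∀ z → z ∈free F → (τ [ y ↦ ids y ]) z ≡ (σ [ y ↦ ids y ]) z ⟦ l / x ⟧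
  h′ z z∈ with y ≟ z
  ... | yes refl = ≡-sym (ids-subst-other l x≢y)
  ... | no y≢z   = h z (y≢z ∘ ≡-sym , z∈)
bindᶠ-then-subst {σ = σ} {τ} (ex y F) l x s h with x ≟ y
... | yes refl = cong (ex y) (bindᶠ-cong F λ z z∈ → update-cong (ids y) λ y≢z →
        unaffected (s z) y≢z (h z (y≢z ∘ ≡-sym , z∈)))
  where
  unaffected : ∀ {z} → Ground (σ z) ⊎ σ z ≡ ids z → y ≢ z → τ z ≡ σ z ⟦ l / y ⟧ → σ z ≡ τ z
  unaffected {z} (inj₁ g) y≢z e = ≡-sym (trans e (subst-fresh (σ z) l (g y)))
  unaffected {z} (inj₂ i) y≢z e rewrite i = ≡-sym (trans e (ids-subst-other l y≢z))
... | no x≢y = cong (ex y) (bindᶠ-then-subst F l x (simple-update s y) h′)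
  where
  h′ : ∀ z → z ∈free F → (τ [ y ↦ ids y ]) z ≡ (σ [ y ↦ ids y ]) z ⟦ l / x ⟧
  h′ z z∈ with y ≟ z
  ... | yes refl = ≡-sym (ids-subst-other l x≢y)
  ... | no y≢z   = h z (y≢z ∘ ≡-sym , z∈)

substᶠ≡bindᶠ : (F : Formula S Q) (l : Str S) (x : Var) → F ⟦ l / x ⟧ᶠ ≡ bindᶠ (ids [ x ↦ l ]) F
substᶠ≡bindᶠ F l x =
  trans (cong (_⟦ l / x ⟧ᶠ) (≡-sym (bindᶠ-ids F)))
    (bindᶠ-then-subst F l x (λ _ → inj₂ refl) λ z _ →
      trans (≡-sym (++-identityʳ _)) (≡-sym (subst≡bind (ids z) l x)))

substᶠ-fresh : (F : Formula S Q) (l : Str S) {x : Var} → ¬ x ∈free F → F ⟦ l / x ⟧ᶠ ≡ F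
substᶠ-fresh F l {x} x∉F = trans (substᶠ≡bindᶠ F l x)
  (trans (bindᶠ-cong F λ z z∈ → update-other ids {x} l λ { refl → x∉F z∈ }) (bindᶠ-ids F))

-- A simultaneous substitution following a single, collision-free one.
subst-then-bindᶠ : {ρ τ : Env S} (F : Formula S Q) (l : Str S) (x : Var) → CF F l x →
                   (∀ z → z ∈free F → τ z ≡ bind ρ ((ids [ x ↦ l ]) z)) →
                   bindᶠ ρ (F ⟦ l / x ⟧ᶠ) ≡ bindᶠ τ F
bind-after-subst : {ρ τ : Env S} (k l : Str S) (x : Var) →
                   (∀ z → z ∈var k → τ z ≡ bind ρ ((ids [ x ↦ l ]) z)) →
                   bind ρ (k ⟦ l / x ⟧) ≡ bind τ k
bind-after-subst {ρ = ρ} k l x h =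
  trans (cong (bind ρ) (subst≡bind k l x))
    (trans (bind-bind ρ _ k) (bind-cong k λ z z∈ → ≡-sym (h z z∈)))

-- The cases of a quantifier over a variable y other than x, and over x itself.
private
  under-binder : {ρ τ : Env S} (F : Formula S Q) (l : Str S) {x y : Var} → x ≢ y →
                 (x ∈free F → ¬ y ∈var l) →
                 (∀ z → z ≢ y → z ∈free F → τ z ≡ bind ρ ((ids [ x ↦ l ]) z)) →
                 ∀ z → z ∈free F →
                 (τ [ y ↦ ids y ]) z ≡ bind (ρ [ y ↦ ids y ]) ((ids [ x ↦ l ]) z)
  under-binder {ρ = ρ} F l {x} {y} x≢y y∉l h z z∈ with y ≟ z | x ≟ z
  ... | yes refl | yes refl = ⊥-elim (x≢y refl)
  ... | yes refl | no  _    = ≡-sym (trans (++-identityʳ _) (update-same ρ y (ids y)))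
  ... | no y≢z   | yes refl = trans (h z (y≢z ∘ ≡-sym) z∈)
        (trans (cong (bind ρ) (update-same ids x l))
          (bind-cong l λ w w∈ → ≡-sym (update-other ρ {y} (ids y) λ { refl → y∉l z∈ w∈ })))
  ... | no y≢z   | no x≢z   = trans (h z (y≢z ∘ ≡-sym) z∈)
        (trans (cong (bind ρ) (update-other ids {x} l x≢z))
          (cong (_++ []) (≡-sym (update-other ρ {y} (ids y) y≢z))))

  at-binder : {ρ τ : Env S} (F : Formula S Q) (l : Str S) {y : Var} →
              (∀ z → z ≢ y → z ∈free F → τ z ≡ bind ρ ((ids [ y ↦ l ]) z)) →
              bindᶠ (ρ [ y ↦ ids y ]) F ≡ bindᶠ (τ [ y ↦ ids y ]) F
  at-binder {ρ = ρ} F l {y} h = bindᶠ-cong F λ z z∈ → update-cong (ids y) λ y≢z →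
    ≡-sym (trans (h z (y≢z ∘ ≡-sym) z∈)
      (trans (cong (bind ρ) (update-other ids {y} l y≢z)) (++-identityʳ _)))

subst-then-bindᶠ (eq k m) l x cf h =
  cong₂ eq (bind-after-subst k l x λ z → h z ∘ inj₁) (bind-after-subst m l x λ z → h z ∘ inj₂)
subst-then-bindᶠ {ρ = ρ} (rel p ls) l x cf h =
  cong (rel p) (trans (≡-sym (Vec-map-∘ (bind ρ) (_⟦ l / x ⟧) ls))
    (map-cong-vars ls λ k k⊆ → bind-after-subst k l x λ z z∈ → h z (k⊆ z z∈)))
subst-then-bindᶠ (neg F)   l x cf h = cong neg (subst-then-bindᶠ F l x cf h)
subst-then-bindᶠ (imp F G) l x (cf , cg) h =
  cong₂ imp (subst-then-bindᶠ F l x cf λ z → h z ∘ inj₁) (subst-then-bindᶠ G l x cg λ z → h z ∘ inj₂)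
subst-then-bindᶠ (iff F G) l x (cf , cg) h =
  cong₂ iff (subst-then-bindᶠ F l x cf λ z → h z ∘ inj₁) (subst-then-bindᶠ G l x cg λ z → h z ∘ inj₂)
subst-then-bindᶠ (con F G) l x (cf , cg) h =
  cong₂ con (subst-then-bindᶠ F l x cf λ z → h z ∘ inj₁) (subst-then-bindᶠ G l x cg λ z → h z ∘ inj₂)
subst-then-bindᶠ (dis F G) l x (cf , cg) h =
  cong₂ dis (subst-then-bindᶠ F l x cf λ z → h z ∘ inj₁) (subst-then-bindᶠ G l x cg λ z → h z ∘ inj₂)
subst-then-bindᶠ (all y F) l x cf h with x ≟ y
... | yes refl = cong (all y) (at-binder F l λ z z≢ z∈ → h z (z≢ , z∈))
... | no x≢y with x ∈free? F
...   | yes x∈F = cong (all y) (subst-then-bindᶠ F l x (proj₂ (cf (x≢y , x∈F)))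
          (under-binder F l x≢y (λ _ → proj₁ (cf (x≢y , x∈F))) λ z z≢ z∈ → h z (z≢ , z∈)))
...   | no x∉F  = cong (all y) (trans (cong (bindᶠ _) (substᶠ-fresh F l x∉F))
          (bindᶠ-cong F λ z z∈ → trans (≡-sym (trans
              (cong (bind _) (update-other ids {x} l λ { refl → x∉F z∈ })) (++-identityʳ _)))
            (≡-sym (under-binder F l x≢y (⊥-elim ∘ x∉F) (λ w w≢ w∈ → h w (w≢ , w∈)) z z∈))))
subst-then-bindᶠ (ex y F) l x cf h with x ≟ y
... | yes refl = cong (ex y) (at-binder F l λ z z≢ z∈ → h z (z≢ , z∈))
... | no x≢y with x ∈free? F
...   | yes x∈F = cong (ex y) (subst-then-bindᶠ F l x (proj₂ (cf (x≢y , x∈F)))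
          (under-binder F l x≢y (λ _ → proj₁ (cf (x≢y , x∈F))) λ z z≢ z∈ → h z (z≢ , z∈)))
...   | no x∉F  = cong (ex y) (trans (cong (bindᶠ _) (substᶠ-fresh F l x∉F))
          (bindᶠ-cong F λ z z∈ → trans (≡-sym (trans
              (cong (bind _) (update-other ids {x} l λ { refl → x∉F z∈ })) (++-identityʳ _)))
            (≡-sym (under-binder F l x≢y (⊥-elim ∘ x∉F) (λ w w≢ w∈ → h w (w≢ , w∈)) z z∈))))

CF-ground : (F : Formula S Q) {l : Str S} (x : Var) → Ground l → CF F l x
CF-ground (eq _ _)  x g = tt
CF-ground (rel _ _) x g = tt
CF-ground (neg F)   x g = CF-ground F x g
CF-ground (imp F G) x g = CF-ground F x g , CF-ground G x g
CF-ground (iff F G) x g = CF-ground F x g , CF-ground G x g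
CF-ground (con F G) x g = CF-ground F x g , CF-ground G x g
CF-ground (dis F G) x g = CF-ground F x g , CF-ground G x g
CF-ground (all y F) x g _ = g y , CF-ground F x g
CF-ground (ex y F)  x g _ = g y , CF-ground F x g

bind-ground : (ρ : Env S) (l : Str S) → Ground l → bind ρ l ≡ l
bind-ground ρ l g = trans (bind-cong l λ x x∈ → ⊥-elim (g x x∈)) (bind-ids l)

-- The simultaneous substitution that performs σ from left to right, if the
-- substituted lists are ground.
env : List (Var × Str S) → Env S
env []            = ids
env ((x , l) ∷ σ) = env σ [ x ↦ l ]

substAll≡bindᶠ : (F : Formula S Q) (σ : List (Var × Str S)) → All (λ xl → Ground (proj₂ xl)) σ →
                 substAll F σ ≡ bindᶠ (env σ) F
substAll≡bindᶠ F []            []      = ≡-sym (bindᶠ-ids F)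
substAll≡bindᶠ F ((x , l) ∷ σ) (g ∷ gs) =
  trans (substAll≡bindᶠ (F ⟦ l / x ⟧ᶠ) σ gs)
    (subst-then-bindᶠ F l x (CF-ground F x g) λ z _ → lemma z)
  where
  lemma : ∀ z → (env σ [ x ↦ l ]) z ≡ bind (env σ) ((ids [ x ↦ l ]) z)
  lemma z with x ≟ z
  ... | yes _ = ≡-sym (bind-ground (env σ) l g)
  ... | no  _ = ≡-sym (++-identityʳ _)

∈free-bindᶠ⁻ : (ρ : Env S) (F : Formula S Q) {z : Var} → z ∈free bindᶠ ρ F →
               ∃[ x ] x ∈free F × z ∈var ρ x
private
  either⁻ : {P₁ P₂ R : Var → Set} → (∃[ x ] P₁ x × R x) ⊎ (∃[ x ] P₂ x × R x) →
            ∃[ x ] (P₁ x ⊎ P₂ x) × R x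
  either⁻ (inj₁ (x , p , r)) = x , inj₁ p , r
  either⁻ (inj₂ (x , p , r)) = x , inj₂ p , r

  quantifier⁻ : (ρ : Env S) (F : Formula S Q) {y z : Var} → z ≢ y →
                (∃[ x ] x ∈free F × z ∈var (ρ [ y ↦ ids y ]) x) →
                ∃[ x ] (x ≢ y × x ∈free F) × z ∈var ρ x
  quantifier⁻ ρ F {y} z≢y (x , x∈ , z∈) with y ≟ x
  quantifier⁻ ρ F {y} z≢y (x , x∈ , here refl) | yes _   = ⊥-elim (z≢y refl)
  quantifier⁻ ρ F {y} z≢y (x , x∈ , z∈)        | no  y≢x = x , (y≢x ∘ ≡-sym , x∈) , z∈

∈free-bindᶠ⁻ ρ (eq l m)   z∈ = either⁻ (⊎-map (∈-bind⁻ ρ l) (∈-bind⁻ ρ m) z∈)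
∈free-bindᶠ⁻ ρ (rel p ls) z∈ =
  ∈-bind⁻ ρ (concat (toList ls)) (subst (_ ∈var_) (concat-bind ρ ls) z∈)
∈free-bindᶠ⁻ ρ (neg F)    z∈ = ∈free-bindᶠ⁻ ρ F z∈
∈free-bindᶠ⁻ ρ (imp F G)  z∈ = either⁻ (⊎-map (∈free-bindᶠ⁻ ρ F) (∈free-bindᶠ⁻ ρ G) z∈)
∈free-bindᶠ⁻ ρ (iff F G)  z∈ = either⁻ (⊎-map (∈free-bindᶠ⁻ ρ F) (∈free-bindᶠ⁻ ρ G) z∈)
∈free-bindᶠ⁻ ρ (con F G)  z∈ = either⁻ (⊎-map (∈free-bindᶠ⁻ ρ F) (∈free-bindᶠ⁻ ρ G) z∈)
∈free-bindᶠ⁻ ρ (dis F G)  z∈ = either⁻ (⊎-map (∈free-bindᶠ⁻ ρ F) (∈free-bindᶠ⁻ ρ G) z∈)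
∈free-bindᶠ⁻ ρ (all y F)  (z≢y , z∈) = quantifier⁻ ρ F z≢y (∈free-bindᶠ⁻ _ F z∈)
∈free-bindᶠ⁻ ρ (ex y F)   (z≢y , z∈) = quantifier⁻ ρ F z≢y (∈free-bindᶠ⁻ _ F z∈)

bindᶠ-closed : {ρ : Env S} (F : Formula S Q) → (∀ x → Ground (ρ x)) → Closed (bindᶠ ρ F)
bindᶠ-closed {ρ = ρ} F g z z∈ with ∈free-bindᶠ⁻ ρ F z∈
... | x , _ , z∈ρx = g x z z∈ρx

bindᶠ-freeOnly : {ρ : Env S} (F : Formula S Q) (x : Var) → (∀ y → Ground (ρ y)) →
                 FreeOnly x (bindᶠ (ρ [ x ↦ ids x ]) F)
bindᶠ-freeOnly {ρ = ρ} F x g z z∈ with ∈free-bindᶠ⁻ (ρ [ x ↦ ids x ]) F z∈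
... | y , _ , z∈ρy with x ≟ y | z∈ρy
...   | yes _ | here refl = refl
...   | no  _ | z∈′       = ⊥-elim (g y z z∈′)

formula-mono : {M N : System S Q} → predicates M ⊆ predicates N → lists M ⊆ lists N →
               ∀ F → IsFormula M F → IsFormula N F
formula-mono P⊆ L⊆ (eq l m)   (l∈ , m∈)  = L⊆ l∈ , L⊆ m∈
formula-mono P⊆ L⊆ (rel p ls) (p∈ , ls∈) = P⊆ p∈ , VecAll.map L⊆ ls∈
formula-mono P⊆ L⊆ (neg F)    F∈         = formula-mono P⊆ L⊆ F F∈
formula-mono P⊆ L⊆ (imp F G)  (F∈ , G∈)  = formula-mono P⊆ L⊆ F F∈ , formula-mono P⊆ L⊆ G G∈
formula-mono P⊆ L⊆ (iff F G)  (F∈ , G∈)  = formula-mono P⊆ L⊆ F F∈ , formula-mono P⊆ L⊆ G G∈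
formula-mono P⊆ L⊆ (con F G)  (F∈ , G∈)  = formula-mono P⊆ L⊆ F F∈ , formula-mono P⊆ L⊆ G G∈
formula-mono P⊆ L⊆ (dis F G)  (F∈ , G∈)  = formula-mono P⊆ L⊆ F F∈ , formula-mono P⊆ L⊆ G G∈
formula-mono P⊆ L⊆ (all x F)  F∈         = formula-mono P⊆ L⊆ F F∈
formula-mono P⊆ L⊆ (ex x F)   F∈         = formula-mono P⊆ L⊆ F F∈

bindᶠ-formula : (M : System S Q) → SubstClosed (lists M) → ∀ F {ρ} → (∀ x → lists M (ρ x)) →
                IsFormula M F → IsFormula M (bindᶠ ρ F)
bindᶠ-formula M c (eq l m)   ρ∈ (l∈ , m∈)  = bind∈ c _ ρ∈ l∈ , bind∈ c _ ρ∈ m∈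
bindᶠ-formula M c (rel p ls) ρ∈ (p∈ , ls∈) = p∈ , VecAll-map⁺ (VecAll.map (bind∈ c _ ρ∈) ls∈)
bindᶠ-formula M c (neg F)    ρ∈ F∈         = bindᶠ-formula M c F ρ∈ F∈
bindᶠ-formula M c (imp F G)  ρ∈ (F∈ , G∈)  = bindᶠ-formula M c F ρ∈ F∈ , bindᶠ-formula M c G ρ∈ G∈
bindᶠ-formula M c (iff F G)  ρ∈ (F∈ , G∈)  = bindᶠ-formula M c F ρ∈ F∈ , bindᶠ-formula M c G ρ∈ G∈
bindᶠ-formula M c (con F G)  ρ∈ (F∈ , G∈)  = bindᶠ-formula M c F ρ∈ F∈ , bindᶠ-formula M c G ρ∈ G∈
bindᶠ-formula M c (dis F G)  ρ∈ (F∈ , G∈)  = bindᶠ-formula M c F ρ∈ F∈ , bindᶠ-formula M c G ρ∈ G∈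
bindᶠ-formula M c (all x F)  ρ∈ F∈ =
  bindᶠ-formula M c F (update-all {P = lists M} x ρ∈ (variable∈ c x)) F∈
bindᶠ-formula M c (ex x F)   ρ∈ F∈ =
  bindᶠ-formula M c F (update-all {P = lists M} x ρ∈ (variable∈ c x)) F∈

substᶠ-formula : (M : System S Q) → SubstClosed (lists M) → ∀ F {l} x → lists M l →
                 IsFormula M F → IsFormula M (F ⟦ l / x ⟧ᶠ)
substᶠ-formula M c F {l} x l∈ F∈ = subst (IsFormula M) (≡-sym (substᶠ≡bindᶠ F l x))
  (bindᶠ-formula M c F (update-all {P = lists M} x (variable∈ c) l∈) F∈)

provable-mono : {M N : System S Q} → predicates M ⊆ predicates N → lists M ⊆ lists N →
                basis M ⊆ basis N → ∀ {F} → Provable M F → Provable N F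
provable-mono {M = M} {N} P⊆ L⊆ B⊆ = go
  where
  go : ∀ {F} → Provable M F → Provable N F
  go (basis-axiom F∈)             = basis-axiom (B⊆ F∈)
  go (tautology α F t F∈)         = tautology α F t λ i → formula-mono P⊆ L⊆ (F i) (F∈ i)
  go (eq-refl x)                  = eq-refl x
  go (eq-subst x y l∈ m∈)         = eq-subst x y (L⊆ l∈) (L⊆ m∈)
  go (eq-rel p∈ xys)              = eq-rel (P⊆ p∈) xys
  go (all-elim x {F} F∈)          = all-elim x (formula-mono P⊆ L⊆ F F∈)
  go (all-imp x {F} {G} F∈ G∈ x∉) = all-imp x (formula-mono P⊆ L⊆ F F∈) (formula-mono P⊆ L⊆ G G∈) x∉
  go (all-ex x {F} F∈)            = all-ex x (formula-mono P⊆ L⊆ F F∈)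
  go (mp ⊢F ⊢F⇒G)                 = mp (go ⊢F) (go ⊢F⇒G)
  go (subst-rule x ⊢F l∈ cf)      = subst-rule x (go ⊢F) (L⊆ l∈) cf
  go (gen x ⊢F)                   = gen x (go ⊢F)

-- Truth values

true-or-false : (b : Bool) → b ≡ true ⊎ b ≡ false
true-or-false true  = inj₁ refl
true-or-false false = inj₂ refl

true≢false : {b : Bool} → b ≡ true → b ≡ false → ⊥
true≢false refl ()

bool-ext : {a b : Bool} → (a ≡ true → b ≡ true) → (b ≡ true → a ≡ true) → a ≡ b
bool-ext {true}          f g = ≡-sym (f refl)
bool-ext {false} {true}  f g = g refl
bool-ext {false} {false} f g = refl

⇒ᵇ-intro : {a b : Bool} → (a ≡ true → b ≡ true) → a ⇒ᵇ b ≡ true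
⇒ᵇ-intro {true}  h = h refl
⇒ᵇ-intro {false} h = refl

⇒ᵇ-elim : {a b : Bool} → a ⇒ᵇ b ≡ true → a ≡ true → b ≡ true
⇒ᵇ-elim h refl = h

⇔ᵇ-elim : {a b : Bool} → a ⇔ᵇ b ≡ true → a ≡ b
⇔ᵇ-elim {true}  {true}  h = refl
⇔ᵇ-elim {false} {false} h = refl

⇔ᵇ-refl : (a : Bool) → a ⇔ᵇ a ≡ true
⇔ᵇ-refl true  = refl
⇔ᵇ-refl false = refl

not-true : {b : Bool} → b ≡ false → not b ≡ true
not-true refl = refl

not-true⁻ : {b : Bool} → not b ≡ true → b ≡ false
not-true⁻ {false} _ = refl

-- Semantics of the formulas of [M̂; L̂], open ones included

module Semantics {S Q I : Set} (M : System S Q) (𝒟 : Structure S Q I)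
                 (sys : IsSystem M) (mod : IsModel M 𝒟) where

  open IsSystem sys
  open IsModel mod

  M̂ : System S Q
  M̂ = hat M 𝒟

  L̂-closed : SubstClosed (lists M̂)
  L̂-closed = adjoin-closed (record { variable∈ = variables ; subst∈ = lists-subst })

  -- An assignment of ground lists to all variables.
  GroundEnv : Pred (Env S) 0ℓ
  GroundEnv ρ = ∀ x → GroundLists M̂ (ρ x)

  -- The truth value of F under an assignment.
  T : Env S → Formula S Q → Bool
  T ρ F = truth 𝒟 (bindᶠ ρ F)

  -- Truth under all assignments, which is equivalent to validity but does not
  -- mention the free variables of F.
  Holds : Pred (Formula S Q) 0ℓ
  Holds F = IsFormula M̂ F × (∀ ρ → GroundEnv ρ → T ρ F ≡ true)

  name-ground : ∀ {d} → universe 𝒟 d → GroundLists M̂ [ sym (name 𝒟 d) ]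
  name-ground {d} d∈ =
    step zero (base (variables zero)) (d , d∈ , refl) , λ { x (here ()) ; x (there ()) }

  -- Some ground list, as a default value.
  l₀ : Str S
  l₀ = proj₁ (value-onto (proj₂ nonempty))

  l₀∈ : GroundLists M̂ l₀
  l₀∈ = proj₁ (proj₂ (value-onto (proj₂ nonempty)))

  ρ₀ : Env S
  ρ₀ _ = l₀

  ρ₀∈ : GroundEnv ρ₀
  ρ₀∈ _ = l₀∈

  groundEnv-update : ∀ {ρ l} → GroundEnv ρ → ∀ x → GroundLists M̂ l → GroundEnv (ρ [ x ↦ l ])
  groundEnv-update ρ∈ x = update-all {P = GroundLists M̂} x ρ∈

  bind-groundList : ∀ {ρ l} → GroundEnv ρ → lists M̂ l → GroundLists M̂ (bind ρ l)
  bind-groundList {ρ} {l} ρ∈ l∈ = bind∈ L̂-closed ρ (proj₁ ∘ ρ∈) l∈ , ground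
    where
    ground : Ground (bind ρ l)
    ground z z∈ with ∈-bind⁻ ρ l z∈
    ... | x , _ , z∈ρx = proj₂ (ρ∈ x) z z∈ρx

  bindᶠ-closedFormula : ∀ {ρ} F → GroundEnv ρ → IsFormula M̂ F → ClosedFormulas M̂ (bindᶠ ρ F)
  bindᶠ-closedFormula F ρ∈ F∈ =
    bindᶠ-formula M̂ L̂-closed F (proj₁ ∘ ρ∈) F∈ , bindᶠ-closed F (proj₂ ∘ ρ∈)

  -- Tarski's clauses for T

  T-eq : ∀ {ρ l m} → GroundEnv ρ → lists M̂ l → lists M̂ m →
         (T ρ (eq l m) ≡ true) ⇔ (value 𝒟 (bind ρ l) ≡ value 𝒟 (bind ρ m))
  T-eq {ρ} {l} {m} ρ∈ l∈ m∈ = truth-eq (bindᶠ-closedFormula (eq l m) ρ∈ (l∈ , m∈))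

  T-rel : ∀ {ρ p} {ls : Vec (Str S) (suc n)} → GroundEnv ρ → IsFormula M̂ (rel p ls) →
          (T ρ (rel p ls) ≡ true) ⇔ pred₊ 𝒟 p (Vec.map (value 𝒟) (Vec.map (bind ρ) ls))
  T-rel {p = p} {ls} ρ∈ F∈ = truth-rel₊ (bindᶠ-closedFormula (rel p ls) ρ∈ F∈)

  T-neg : ∀ {ρ} F → GroundEnv ρ → IsFormula M̂ F → T ρ (neg F) ≡ not (T ρ F)
  T-neg F ρ∈ F∈ = truth-neg (bindᶠ-closedFormula F ρ∈ F∈)

  T-imp : ∀ {ρ} F G → GroundEnv ρ → IsFormula M̂ F → IsFormula M̂ G →
          T ρ (imp F G) ≡ T ρ F ⇒ᵇ T ρ G
  T-imp F G ρ∈ F∈ G∈ = truth-imp (bindᶠ-closedFormula F ρ∈ F∈) (bindᶠ-closedFormula G ρ∈ G∈)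

  T-iff : ∀ {ρ} F G → GroundEnv ρ → IsFormula M̂ F → IsFormula M̂ G →
          T ρ (iff F G) ≡ T ρ F ⇔ᵇ T ρ G
  T-iff F G ρ∈ F∈ G∈ = truth-iff (bindᶠ-closedFormula F ρ∈ F∈) (bindᶠ-closedFormula G ρ∈ G∈)

  T-con : ∀ {ρ} F G → GroundEnv ρ → IsFormula M̂ F → IsFormula M̂ G →
          T ρ (con F G) ≡ T ρ F ∧ T ρ G
  T-con F G ρ∈ F∈ G∈ = truth-con (bindᶠ-closedFormula F ρ∈ F∈) (bindᶠ-closedFormula G ρ∈ G∈)

  T-dis : ∀ {ρ} F G → GroundEnv ρ → IsFormula M̂ F → IsFormula M̂ G →
          T ρ (dis F G) ≡ T ρ F ∨ T ρ G
  T-dis F G ρ∈ F∈ G∈ = truth-dis (bindᶠ-closedFormula F ρ∈ F∈) (bindᶠ-closedFormula G ρ∈ G∈)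

  -- Substituting l for the variable x kept free amounts to assigning l to x.
  bindᶠ-update : {ρ : Env S} (F : Formula S Q) (l : Str S) (x : Var) → (∀ y → Ground (ρ y)) →
                 bindᶠ (ρ [ x ↦ ids x ]) F ⟦ l / x ⟧ᶠ ≡ bindᶠ (ρ [ x ↦ l ]) F
  bindᶠ-update {ρ} F l x g = bindᶠ-then-subst F l x simple λ z _ → lemma z
    where
    simple : Simple (ρ [ x ↦ ids x ])
    simple z with x ≟ z
    ... | yes refl = inj₂ refl
    ... | no  _    = inj₁ (g z)

    lemma : ∀ z → (ρ [ x ↦ l ]) z ≡ (ρ [ x ↦ ids x ]) z ⟦ l / x ⟧
    lemma z with x ≟ z
    ... | yes refl = ≡-sym (ids-subst-same l x)
    ... | no  _    = ≡-sym (subst-fresh (ρ z) l (g z x))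

  T-all : ∀ {ρ} x F → GroundEnv ρ → IsFormula M̂ F →
          (T ρ (all x F) ≡ true) ⇔ (∀ l → GroundLists M̂ l → T (ρ [ x ↦ l ]) F ≡ true)
  T-all {ρ} x F ρ∈ F∈ = mk⇔
    (λ h l l∈ → subst (λ G → truth 𝒟 G ≡ true) (bindᶠ-update F l x (proj₂ ∘ ρ∈)) (to clause h l l∈))
    (λ h → from clause λ l l∈ →
      subst (λ G → truth 𝒟 G ≡ true) (≡-sym (bindᶠ-update F l x (proj₂ ∘ ρ∈))) (h l l∈))
    where
    clause = truth-all x
      (bindᶠ-formula M̂ L̂-closed F
        (update-all {P = lists M̂} x (proj₁ ∘ ρ∈) (variable∈ L̂-closed x)) F∈)
      (bindᶠ-freeOnly F x (proj₂ ∘ ρ∈))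

  T-ex : ∀ {ρ} x F → GroundEnv ρ → IsFormula M̂ F →
         (T ρ (ex x F) ≡ true) ⇔ (∃[ l ] GroundLists M̂ l × T (ρ [ x ↦ l ]) F ≡ true)
  T-ex {ρ} x F ρ∈ F∈ = mk⇔
    (λ h → let l , l∈ , Fl = to clause h in
      l , l∈ , subst (λ G → truth 𝒟 G ≡ true) (bindᶠ-update F l x (proj₂ ∘ ρ∈)) Fl)
    (λ (l , l∈ , Fl) → from clause
      (l , l∈ , subst (λ G → truth 𝒟 G ≡ true) (≡-sym (bindᶠ-update F l x (proj₂ ∘ ρ∈))) Fl))
    where
    clause = truth-ex x
      (bindᶠ-formula M̂ L̂-closed F
        (update-all {P = lists M̂} x (proj₁ ∘ ρ∈) (variable∈ L̂-closed x)) F∈)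
      (bindᶠ-freeOnly F x (proj₂ ∘ ρ∈))

  T-cong : ∀ {ρ σ} F → (∀ x → x ∈free F → ρ x ≡ σ x) → T ρ F ≡ T σ F
  T-cong F h = cong (truth 𝒟) (bindᶠ-cong F h)

  T-closed : ∀ {ρ} F → Closed F → T ρ F ≡ truth 𝒟 F
  T-closed F cl = trans (T-cong F λ x x∈ → ⊥-elim (cl x x∈)) (cong (truth 𝒟) (bindᶠ-ids F))

  -- The value of a ground list

  -- As d is the value of some ground list l, the substitution of l and of α_d for
  -- x in the list x gives lists of equal values.
  value-name : ∀ {d} → universe 𝒟 d → value 𝒟 [ sym (name 𝒟 d) ] ≡ d
  value-name {d} d∈ with value-onto d∈
  ... | l , l∈ , refl = ≡-sym (subst₂ (λ k m → value 𝒟 k ≡ value 𝒟 m)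
    (ids-subst-same l zero) (ids-subst-same [ sym (name 𝒟 d) ] zero)
    (value-subst zero (base (variables zero)) (λ { y (here refl) → refl }) l∈))

  value-subst-cong : ∀ {l m k} x → lists M̂ l → (∀ y → y ∈var l → y ≡ x) →
                     GroundLists M̂ m → GroundLists M̂ k → value 𝒟 m ≡ value 𝒟 k →
                     value 𝒟 (l ⟦ m / x ⟧) ≡ value 𝒟 (l ⟦ k / x ⟧)
  value-subst-cong {l} x l∈ l-only m∈ k∈ m≡k =
    trans (value-subst x l∈ l-only m∈)
      (trans (cong (λ d → value 𝒟 (l ⟦ [ sym (name 𝒟 d) ] / x ⟧)) m≡k)
        (≡-sym (value-subst x l∈ l-only k∈)))

  -- The value of a list under an assignment depends only on the individuals
  -- assigned.  The assignments are exchanged one variable at a time.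
  value-cong : ∀ {ρ σ l} → GroundEnv ρ → GroundEnv σ → (∀ x → value 𝒟 (ρ x) ≡ value 𝒟 (σ x)) →
               lists M̂ l → value 𝒟 (bind ρ l) ≡ value 𝒟 (bind σ l)
  value-cong {ρ} {σ} {l} ρ∈ σ∈ ρ≈σ l∈ = go (varsOf l) ρ ρ∈ ρ≈σ (λ x x∈ → inj₂ (varsOf⁺ l x∈))
    where
    go : ∀ xs ρ → GroundEnv ρ → (∀ x → value 𝒟 (ρ x) ≡ value 𝒟 (σ x)) →
         (∀ x → x ∈var l → ρ x ≡ σ x ⊎ x ∈ xs) → value 𝒟 (bind ρ l) ≡ value 𝒟 (bind σ l)
    go [] ρ ρ∈ ρ≈σ agree = cong (value 𝒟) (bind-cong l λ x x∈ → done (agree x x∈))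
      where
      done : ∀ {x} → ρ x ≡ σ x ⊎ x ∈ [] → ρ x ≡ σ x
      done (inj₁ e≡) = e≡
    go (v ∷ xs) ρ ρ∈ ρ≈σ agree =
      trans exchange (go xs ρ′ (groundEnv-update ρ∈ v (σ∈ v)) ρ′≈σ agree′)
      where
      ρ′ : Env S
      ρ′ = ρ [ v ↦ σ v ]

      ρ′≈σ : ∀ x → value 𝒟 (ρ′ x) ≡ value 𝒟 (σ x)
      ρ′≈σ x with v ≟ x
      ... | yes refl = refl
      ... | no  _    = ρ≈σ x

      agree′ : ∀ x → x ∈var l → ρ′ x ≡ σ x ⊎ x ∈ xs
      agree′ x x∈ with v ≟ x
      ... | yes refl = inj₁ refl
      ... | no v≢x with agree x x∈
      ...   | inj₁ e≡           = inj₁ e≡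
      ...   | inj₂ (here refl)  = ⊥-elim (v≢x refl)
      ...   | inj₂ (there x∈xs) = inj₂ x∈xs

      -- l with all variables but v replaced.
      l′ : Str S
      l′ = bind (ρ [ v ↦ ids v ]) l

      l′-subst : ∀ m → l′ ⟦ m / v ⟧ ≡ bind (ρ [ v ↦ m ]) l
      l′-subst m = bind-subst l m v λ y _ → lemma y
        where
        lemma : ∀ y → (ρ [ v ↦ ids v ]) y ⟦ m / v ⟧ ≡ (ρ [ v ↦ m ]) y
        lemma y with v ≟ y
        ... | yes refl = ids-subst-same m v
        ... | no  _    = subst-fresh (ρ y) m (proj₂ (ρ∈ y) v)

      l′-only : ∀ y → y ∈var l′ → y ≡ v
      l′-only y y∈ with ∈-bind⁻ (ρ [ v ↦ ids v ]) l y∈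
      ... | x , _ , y∈ρx with v ≟ x | y∈ρx
      ...   | yes _ | here refl = refl
      ...   | no  _ | y∈′       = ⊥-elim (proj₂ (ρ∈ x) y y∈′)

      ρ-update : ∀ y → (ρ [ v ↦ ρ v ]) y ≡ ρ y
      ρ-update y with v ≟ y
      ... | yes refl = refl
      ... | no  _    = refl

      exchange : value 𝒟 (bind ρ l) ≡ value 𝒟 (bind ρ′ l)
      exchange = subst₂ (λ k m → value 𝒟 k ≡ value 𝒟 m)
        (trans (l′-subst (ρ v)) (bind-cong l λ y _ → ρ-update y)) (l′-subst (σ v))
        (value-subst-cong v
          (bind∈ L̂-closed _ (update-all {P = lists M̂} v (proj₁ ∘ ρ∈) (variable∈ L̂-closed v)) l∈)
          l′-only (ρ∈ v) (σ∈ v) (ρ≈σ v))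

  private
    map-value-cong : ∀ {ρ σ} {ls : Vec (Str S) n} → GroundEnv ρ → GroundEnv σ →
      (∀ x → value 𝒟 (ρ x) ≡ value 𝒟 (σ x)) → VecAll.All (lists M̂) ls →
      Vec.map (value 𝒟) (Vec.map (bind ρ) ls) ≡ Vec.map (value 𝒟) (Vec.map (bind σ) ls)
    map-value-cong ρ∈ σ∈ ρ≈σ []         = refl
    map-value-cong ρ∈ σ∈ ρ≈σ (l∈ ∷ ls∈) =
      cong₂ _∷_ (value-cong ρ∈ σ∈ ρ≈σ l∈) (map-value-cong ρ∈ σ∈ ρ≈σ ls∈)

  -- Truth under an assignment depends only on the individuals assigned.
  T-value-cong : ∀ {ρ σ} F → GroundEnv ρ → GroundEnv σ →
                 (∀ x → value 𝒟 (ρ x) ≡ value 𝒟 (σ x)) → IsFormula M̂ F → T ρ F ≡ T σ F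
  T-value-cong (eq l m) ρ∈ σ∈ ρ≈σ (l∈ , m∈) = bool-ext
    (λ h → from (T-eq σ∈ l∈ m∈) (trans (≡-sym l≡) (trans (to (T-eq ρ∈ l∈ m∈) h) m≡)))
    (λ h → from (T-eq ρ∈ l∈ m∈) (trans l≡ (trans (to (T-eq σ∈ l∈ m∈) h) (≡-sym m≡))))
    where
    l≡ = value-cong ρ∈ σ∈ ρ≈σ l∈
    m≡ = value-cong ρ∈ σ∈ ρ≈σ m∈
  T-value-cong (rel p [])         ρ∈ σ∈ ρ≈σ F∈ = refl
  T-value-cong (rel p (l ∷ ls))   ρ∈ σ∈ ρ≈σ F∈ = bool-ext
    (λ h → from (T-rel {ls = l ∷ ls} σ∈ F∈) (subst (pred₊ 𝒟 p) ls≡ (to (T-rel {ls = l ∷ ls} ρ∈ F∈) h)))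
    (λ h → from (T-rel {ls = l ∷ ls} ρ∈ F∈) (subst (pred₊ 𝒟 p) (≡-sym ls≡) (to (T-rel {ls = l ∷ ls} σ∈ F∈) h)))
    where ls≡ = map-value-cong ρ∈ σ∈ ρ≈σ (proj₂ F∈)
  T-value-cong (neg F) ρ∈ σ∈ ρ≈σ F∈ =
    trans (T-neg F ρ∈ F∈) (trans (cong not (T-value-cong F ρ∈ σ∈ ρ≈σ F∈)) (≡-sym (T-neg F σ∈ F∈)))
  T-value-cong (imp F G) ρ∈ σ∈ ρ≈σ (F∈ , G∈) =
    trans (T-imp F G ρ∈ F∈ G∈)
      (trans (cong₂ _⇒ᵇ_ (T-value-cong F ρ∈ σ∈ ρ≈σ F∈) (T-value-cong G ρ∈ σ∈ ρ≈σ G∈))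
        (≡-sym (T-imp F G σ∈ F∈ G∈)))
  T-value-cong (iff F G) ρ∈ σ∈ ρ≈σ (F∈ , G∈) =
    trans (T-iff F G ρ∈ F∈ G∈)
      (trans (cong₂ _⇔ᵇ_ (T-value-cong F ρ∈ σ∈ ρ≈σ F∈) (T-value-cong G ρ∈ σ∈ ρ≈σ G∈))
        (≡-sym (T-iff F G σ∈ F∈ G∈)))
  T-value-cong (con F G) ρ∈ σ∈ ρ≈σ (F∈ , G∈) =
    trans (T-con F G ρ∈ F∈ G∈)
      (trans (cong₂ _∧_ (T-value-cong F ρ∈ σ∈ ρ≈σ F∈) (T-value-cong G ρ∈ σ∈ ρ≈σ G∈))
        (≡-sym (T-con F G σ∈ F∈ G∈)))
  T-value-cong (dis F G) ρ∈ σ∈ ρ≈σ (F∈ , G∈) =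
    trans (T-dis F G ρ∈ F∈ G∈)
      (trans (cong₂ _∨_ (T-value-cong F ρ∈ σ∈ ρ≈σ F∈) (T-value-cong G ρ∈ σ∈ ρ≈σ G∈))
        (≡-sym (T-dis F G σ∈ F∈ G∈)))
  T-value-cong {ρ} {σ} (all x F) ρ∈ σ∈ ρ≈σ F∈ = bool-ext
    (λ h → from (T-all x F σ∈ F∈) λ l l∈ → trans (≡-sym (IH l l∈)) (to (T-all x F ρ∈ F∈) h l l∈))
    (λ h → from (T-all x F ρ∈ F∈) λ l l∈ → trans (IH l l∈) (to (T-all x F σ∈ F∈) h l l∈))
    where
    IH : ∀ l → GroundLists M̂ l → T (ρ [ x ↦ l ]) F ≡ T (σ [ x ↦ l ]) F
    IH l l∈ = T-value-cong F (groundEnv-update ρ∈ x l∈) (groundEnv-update σ∈ x l∈) ≈ F∈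
      where
      ≈ : ∀ y → value 𝒟 ((ρ [ x ↦ l ]) y) ≡ value 𝒟 ((σ [ x ↦ l ]) y)
      ≈ y with x ≟ y
      ... | yes _ = refl
      ... | no  _ = ρ≈σ y
  T-value-cong {ρ} {σ} (ex x F) ρ∈ σ∈ ρ≈σ F∈ = bool-ext
    (λ h → let l , l∈ , Fl = to (T-ex x F ρ∈ F∈) h in
      from (T-ex x F σ∈ F∈) (l , l∈ , trans (≡-sym (IH l l∈)) Fl))
    (λ h → let l , l∈ , Fl = to (T-ex x F σ∈ F∈) h in
      from (T-ex x F ρ∈ F∈) (l , l∈ , trans (IH l l∈) Fl))
    where
    IH : ∀ l → GroundLists M̂ l → T (ρ [ x ↦ l ]) F ≡ T (σ [ x ↦ l ]) F
    IH l l∈ = T-value-cong F (groundEnv-update ρ∈ x l∈) (groundEnv-update σ∈ x l∈) ≈ F∈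
      where
      ≈ : ∀ y → value 𝒟 ((ρ [ x ↦ l ]) y) ≡ value 𝒟 ((σ [ x ↦ l ]) y)
      ≈ y with x ≟ y
      ... | yes _ = refl
      ... | no  _ = ρ≈σ y

  -- Validity

  private
    env-map : (ρ : Env S) (xs : List Var) {x : Var} → x ∈ xs →
              env (map (λ y → y , ρ y) xs) x ≡ ρ x
    env-map ρ (y ∷ xs) {x} x∈ with y ≟ x | x∈
    ... | yes refl | _           = refl
    ... | no y≢x   | here refl   = ⊥-elim (y≢x refl)
    ... | no _     | there x∈xs  = env-map ρ xs x∈xs

    All-map-pairs : {P : Pred (Str S) 0ℓ} (ρ : Env S) → (∀ x → P (ρ x)) → (xs : List Var) →
                    All (λ xl → P (proj₂ xl)) (map (λ y → y , ρ y) xs)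
    All-map-pairs ρ h []       = []
    All-map-pairs ρ h (x ∷ xs) = h x ∷ All-map-pairs ρ h xs

  valid⇒holds : ∀ {F} → Valid M 𝒟 F → Holds F
  valid⇒holds {F} valid = isFormula , λ ρ ρ∈ → subst (λ G → truth 𝒟 G ≡ true) (instance≡ ρ ρ∈)
    (true-at (σ ρ)
      (subst Unique (≡-sym (keys ρ)) (deduplicate-! _≟_ (freeVars F)))
      (λ x → mk⇔
        (λ x∈ → freeVars⁻ F (∈-deduplicate⁻ _≟_ (freeVars F) (subst (x ∈_) (keys ρ) x∈)))
        (λ x∈ → subst (x ∈_) (≡-sym (keys ρ)) (∈-deduplicate⁺ _≟_ (freeVars⁺ F x∈))))
      (All-map-pairs ρ ρ∈ xs))
    where
    open Valid valid

    xs : List Var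
    xs = deduplicate _≟_ (freeVars F)

    σ : Env S → List (Var × Str S)
    σ ρ = map (λ y → y , ρ y) xs

    keys : ∀ ρ → map proj₁ (σ ρ) ≡ xs
    keys ρ = trans (≡-sym (List-map-∘ xs)) (List-map-id xs)

    instance≡ : ∀ ρ → GroundEnv ρ → substAll F (σ ρ) ≡ bindᶠ ρ F
    instance≡ ρ ρ∈ = trans (substAll≡bindᶠ F (σ ρ) (All-map-pairs ρ (proj₂ ∘ ρ∈) xs))
      (bindᶠ-cong F λ x x∈ → env-map ρ xs (∈-deduplicate⁺ _≟_ (freeVars⁺ F x∈)))

  holds⇒valid : ∀ {F} → Holds F → Valid M 𝒟 F
  holds⇒valid {F} (F∈ , holds) = record
    { isFormula = F∈
    ; true-at   = λ σ _ keys σ∈ → subst (λ G → truth 𝒟 G ≡ true)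
        (≡-sym (trans (substAll≡bindᶠ F σ (All-map proj₂ σ∈))
          (bindᶠ-cong F λ x x∈ → env≡total σ (from (keys x) x∈))))
        (holds (total σ) (total∈ σ∈))
    }
    where
    -- The assignment given by σ, extended to all variables.
    total : List (Var × Str S) → Env S
    total []            = ρ₀
    total ((x , l) ∷ σ) = total σ [ x ↦ l ]

    total∈ : ∀ {σ} → All (λ xl → GroundLists M̂ (proj₂ xl)) σ → GroundEnv (total σ)
    total∈ []                = ρ₀∈
    total∈ (_∷_ {x , _} l∈ σ∈) = groundEnv-update (total∈ σ∈) x l∈

    env≡total : ∀ σ {x} → x ∈ map proj₁ σ → env σ x ≡ total σ x
    env≡total ((y , l) ∷ σ) {x} x∈ with y ≟ x | x∈
    ... | yes _  | _          = refl
    ... | no y≢x | here refl  = ⊥-elim (y≢x refl)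
    ... | no _   | there x∈σ  = env≡total σ x∈σ

  -- Soundness of the calculus

  T-instantiate : ∀ {ρ} (F : Fin n → Formula S Q) (α : PropForm n) → GroundEnv ρ →
                  (∀ i → IsFormula M̂ (F i)) →
                  IsFormula M̂ (instantiate F α) × T ρ (instantiate F α) ≡ eval (T ρ ∘ F) α
  T-instantiate F (atom i) ρ∈ F∈ = F∈ i , refl
  T-instantiate F (neg α) ρ∈ F∈ with T-instantiate F α ρ∈ F∈
  ... | α∈ , α≡ = α∈ , trans (T-neg _ ρ∈ α∈) (cong not α≡)
  T-instantiate F (imp α β) ρ∈ F∈ with T-instantiate F α ρ∈ F∈ | T-instantiate F β ρ∈ F∈
  ... | α∈ , α≡ | β∈ , β≡ = (α∈ , β∈) , trans (T-imp _ _ ρ∈ α∈ β∈) (cong₂ _⇒ᵇ_ α≡ β≡)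
  T-instantiate F (iff α β) ρ∈ F∈ with T-instantiate F α ρ∈ F∈ | T-instantiate F β ρ∈ F∈
  ... | α∈ , α≡ | β∈ , β≡ = (α∈ , β∈) , trans (T-iff _ _ ρ∈ α∈ β∈) (cong₂ _⇔ᵇ_ α≡ β≡)
  T-instantiate F (con α β) ρ∈ F∈ with T-instantiate F α ρ∈ F∈ | T-instantiate F β ρ∈ F∈
  ... | α∈ , α≡ | β∈ , β≡ = (α∈ , β∈) , trans (T-con _ _ ρ∈ α∈ β∈) (cong₂ _∧_ α≡ β≡)
  T-instantiate F (dis α β) ρ∈ F∈ with T-instantiate F α ρ∈ F∈ | T-instantiate F β ρ∈ F∈
  ... | α∈ , α≡ | β∈ , β≡ = (α∈ , β∈) , trans (T-dis _ _ ρ∈ α∈ β∈) (cong₂ _∨_ α≡ β≡)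

  T-imp-intro : ∀ {ρ} F G → GroundEnv ρ → IsFormula M̂ F → IsFormula M̂ G →
                (T ρ F ≡ true → T ρ G ≡ true) → T ρ (imp F G) ≡ true
  T-imp-intro F G ρ∈ F∈ G∈ h = trans (T-imp F G ρ∈ F∈ G∈) (⇒ᵇ-intro h)

  T-imp-elim : ∀ {ρ} F G → GroundEnv ρ → IsFormula M̂ F → IsFormula M̂ G →
               T ρ (imp F G) ≡ true → T ρ F ≡ true → T ρ G ≡ true
  T-imp-elim F G ρ∈ F∈ G∈ h = ⇒ᵇ-elim (trans (≡-sym (T-imp F G ρ∈ F∈ G∈)) h)

  T-neg-false : ∀ {ρ} F → GroundEnv ρ → IsFormula M̂ F → T ρ (neg F) ≡ true → T ρ F ≡ false
  T-neg-false F ρ∈ F∈ h = not-true⁻ (trans (≡-sym (T-neg F ρ∈ F∈)) h)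

  T-neg-true : ∀ {ρ} F → GroundEnv ρ → IsFormula M̂ F → T ρ F ≡ false → T ρ (neg F) ≡ true
  T-neg-true F ρ∈ F∈ h = trans (T-neg F ρ∈ F∈) (not-true h)

  T-subst : ∀ {ρ} F {l} x → CF F l x → T ρ (F ⟦ l / x ⟧ᶠ) ≡ T (ρ [ x ↦ bind ρ l ]) F
  T-subst {ρ} F {l} x cf = cong (truth 𝒟) (subst-then-bindᶠ F l x cf λ z _ → lemma z)
    where
    lemma : ∀ z → (ρ [ x ↦ bind ρ l ]) z ≡ bind ρ ((ids [ x ↦ l ]) z)
    lemma z with x ≟ z
    ... | yes _ = refl
    ... | no  _ = ≡-sym (++-identityʳ _)

  T-update-self : ∀ {ρ} F x → T (ρ [ x ↦ ρ x ]) F ≡ T ρ F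
  T-update-self {ρ} F x = T-cong F λ y _ → lemma y
    where
    lemma : ∀ y → (ρ [ x ↦ ρ x ]) y ≡ ρ y
    lemma y with x ≟ y
    ... | yes refl = refl
    ... | no  _    = refl

  private
    L̂-var : ∀ x → lists M̂ [ var x ]
    L̂-var = variable∈ L̂-closed

    eqVars⇒-formula : (xys : Vec (Var × Var) n) → ∀ {G} → IsFormula M̂ G →
                      IsFormula M̂ (eqVars⇒ xys G)
    eqVars⇒-formula []              G∈ = G∈
    eqVars⇒-formula ((x , y) ∷ xys) G∈ = (L̂-var x , L̂-var y) , eqVars⇒-formula xys G∈

    eqVars⇒-intro : ∀ {ρ} (xys : Vec (Var × Var) n) {G} → GroundEnv ρ → IsFormula M̂ G →
      (VecAll.All (λ xy → value 𝒟 (bind ρ [ var (proj₁ xy) ]) ≡ value 𝒟 (bind ρ [ var (proj₂ xy) ])) xys →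
        T ρ G ≡ true) →
      T ρ (eqVars⇒ xys G) ≡ true
    eqVars⇒-intro []              ρ∈ G∈ h = h []
    eqVars⇒-intro ((x , y) ∷ xys) ρ∈ G∈ h =
      T-imp-intro (eqVar (x , y)) _ ρ∈ (L̂-var x , L̂-var y) (eqVars⇒-formula xys G∈) λ x=y →
        eqVars⇒-intro xys ρ∈ G∈ λ xys= → h (to (T-eq ρ∈ (L̂-var x) (L̂-var y)) x=y ∷ xys=)

    VecAll-total : {P : Pred X 0ℓ} → (∀ x → P x) → (xs : Vec X n) → VecAll.All P xs
    VecAll-total h []       = []
    VecAll-total h (x ∷ xs) = h x ∷ VecAll-total h xs

    rel-vars : ∀ {p} → predicates M p → (f : Var × Var → Var) (xys : Vec (Var × Var) n) →
               IsFormula M̂ (rel p (Vec.map (λ xy → [ var (f xy) ]) xys))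
    rel-vars p∈ f xys = p∈ , VecAll-map⁺ (VecAll-total (λ xy → L̂-var (f xy)) xys)

    values≡ : ∀ {ρ} {xys : Vec (Var × Var) n} →
      VecAll.All (λ xy → value 𝒟 (bind ρ [ var (proj₁ xy) ]) ≡ value 𝒟 (bind ρ [ var (proj₂ xy) ])) xys →
      Vec.map (value 𝒟) (Vec.map (bind ρ) (Vec.map (λ xy → [ var (proj₁ xy) ]) xys))
        ≡ Vec.map (value 𝒟) (Vec.map (bind ρ) (Vec.map (λ xy → [ var (proj₂ xy) ]) xys))
    values≡ []       = refl
    values≡ (e ∷ es) = cong₂ _∷_ e (values≡ es)

  sound : ∀ {F} → Provable (M″ M 𝒟) F → Holds F
  sound (basis-axiom valid) = valid⇒holds valid
  sound (tautology α F taut F∈) = proj₁ (T-instantiate F α ρ₀∈ F∈′) , λ ρ ρ∈ →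
    trans (proj₂ (T-instantiate F α ρ∈ F∈′)) (taut (T ρ ∘ F))
    where
    F∈′ = λ i → formula-mono {N = M̂} id id (F i) (F∈ i)
  sound (eq-refl x) =
    (L̂-var x , L̂-var x) , λ ρ ρ∈ → from (T-eq ρ∈ (L̂-var x) (L̂-var x)) refl
  sound (eq-subst x y {l} {m} l∈ m∈) =
    (l′m′∈ , xy∈ , l∈ , m∈) , λ ρ ρ∈ →
      T-imp-intro (eq _ _) (imp (eqVar (x , y)) (eq l m)) ρ∈ l′m′∈ (xy∈ , l∈ , m∈) λ l′=m′ →
      T-imp-intro (eqVar (x , y)) (eq l m) ρ∈ xy∈ (l∈ , m∈) λ x=y →
      from (T-eq ρ∈ l∈ m∈)
        (trans (≡-sym (lemma ρ ρ∈ x=y l∈))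
          (trans (to (T-eq ρ∈ (proj₁ l′m′∈) (proj₂ l′m′∈)) l′=m′) (lemma ρ ρ∈ x=y m∈)))
    where
    xy∈ : IsFormula M̂ (eqVar (x , y))
    xy∈ = L̂-var x , L̂-var y

    l′m′∈ : IsFormula M̂ (eq (l ⟦ [ var x ] / y ⟧) (m ⟦ [ var x ] / y ⟧))
    l′m′∈ = subst∈ L̂-closed y l∈ (L̂-var x) , subst∈ L̂-closed y m∈ (L̂-var x)

    lemma : ∀ ρ → GroundEnv ρ → T ρ (eqVar (x , y)) ≡ true → ∀ {k} → lists M̂ k →
            value 𝒟 (bind ρ (k ⟦ [ var x ] / y ⟧)) ≡ value 𝒟 (bind ρ k)
    lemma ρ ρ∈ x=y {k} k∈ =
      trans (cong (value 𝒟) (bind-after-subst k [ var x ] y λ z _ → e≡ z))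
        (value-cong (groundEnv-update ρ∈ y (ρ∈ x)) ρ∈ ≈ k∈)
      where
      e≡ : ∀ z → (ρ [ y ↦ ρ x ]) z ≡ bind ρ ((ids [ y ↦ [ var x ] ]) z)
      e≡ z with y ≟ z
      ... | yes _ = ≡-sym (++-identityʳ _)
      ... | no  _ = ≡-sym (++-identityʳ _)

      ≈ : ∀ z → value 𝒟 ((ρ [ y ↦ ρ x ]) z) ≡ value 𝒟 (ρ z)
      ≈ z with y ≟ z
      ... | yes refl = subst₂ (λ l m → value 𝒟 l ≡ value 𝒟 m) (++-identityʳ _) (++-identityʳ _)
                         (to (T-eq ρ∈ (L̂-var x) (L̂-var y)) x=y)
      ... | no  _    = refl
  sound (eq-rel {p = p} p∈ xys) =
    eqVars⇒-formula xys (px∈ , py∈) , λ ρ ρ∈ →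
      eqVars⇒-intro xys ρ∈ (px∈ , py∈) λ x=y →
        T-imp-intro (rel p _) (rel p _) ρ∈ px∈ py∈ λ px →
          from (T-rel {ls = Vec.map (λ xy → [ var (proj₂ xy) ]) xys} ρ∈ py∈)
            (subst (pred₊ 𝒟 p) (values≡ x=y)
              (to (T-rel {ls = Vec.map (λ xy → [ var (proj₁ xy) ]) xys} ρ∈ px∈) px))
    where
    px∈ = rel-vars p∈ proj₁ xys
    py∈ = rel-vars p∈ proj₂ xys
  sound (all-elim x {F} F∈) = (F∈′ , F∈′) , λ ρ ρ∈ →
    T-imp-intro (all x F) F ρ∈ F∈′ F∈′ λ h →
      trans (≡-sym (T-update-self F x)) (to (T-all x F ρ∈ F∈′) h (ρ x) (ρ∈ x))
    where F∈′ = formula-mono {N = M̂} id id F F∈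
  sound (all-imp x {F} {G} F∈ G∈ x∉F) = ((F∈′ , G∈′) , F∈′ , G∈′) , λ ρ ρ∈ →
    T-imp-intro (all x (imp F G)) (imp F (all x G)) ρ∈ (F∈′ , G∈′) (F∈′ , G∈′) λ h →
    T-imp-intro F (all x G) ρ∈ F∈′ G∈′ λ hF →
    from (T-all x G ρ∈ G∈′) λ l l∈ →
      T-imp-elim F G (groundEnv-update ρ∈ x l∈) F∈′ G∈′ (to (T-all x (imp F G) ρ∈ (F∈′ , G∈′)) h l l∈)
        (trans (T-cong F λ z z∈ → update-other ρ {x} l λ { refl → x∉F z∈ }) hF)
    where
    F∈′ = formula-mono {N = M̂} id id F F∈
    G∈′ = formula-mono {N = M̂} id id G G∈
  sound (all-ex x {F} F∈) = (F∈′ , F∈′) , λ ρ ρ∈ →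
    trans (T-iff (neg (all x (neg F))) (ex x F) ρ∈ F∈′ F∈′)
      (trans (cong (_⇔ᵇ T ρ (ex x F)) (equivalent ρ ρ∈)) (⇔ᵇ-refl (T ρ (ex x F))))
    where
    F∈′ = formula-mono {N = M̂} id id F F∈

    equivalent : ∀ ρ → GroundEnv ρ → T ρ (neg (all x (neg F))) ≡ T ρ (ex x F)
    equivalent ρ ρ∈ with true-or-false (T ρ (ex x F))
    ... | inj₁ h with to (T-ex x F ρ∈ F∈′) h
    ...   | l , l∈ , Fl with true-or-false (T ρ (all x (neg F)))
    ...     | inj₁ k = ⊥-elim (true≢false Fl
                (T-neg-false F (groundEnv-update ρ∈ x l∈) F∈′ (to (T-all x (neg F) ρ∈ F∈′) k l l∈)))
    ...     | inj₂ k = trans (T-neg-true (all x (neg F)) ρ∈ F∈′ k) (≡-sym h)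
    equivalent ρ ρ∈ | inj₂ h =
      trans (T-neg (all x (neg F)) ρ∈ F∈′) (trans (cong not none) (≡-sym h))
      where
      none : T ρ (all x (neg F)) ≡ true
      none = from (T-all x (neg F) ρ∈ F∈′) λ l l∈ →
        T-neg-true F (groundEnv-update ρ∈ x l∈) F∈′ (false-at l l∈ (true-or-false _))
        where
        false-at : ∀ l → GroundLists M̂ l →
                   T (ρ [ x ↦ l ]) F ≡ true ⊎ T (ρ [ x ↦ l ]) F ≡ false → T (ρ [ x ↦ l ]) F ≡ false
        false-at l l∈ (inj₁ Fl) = ⊥-elim (true≢false (from (T-ex x F ρ∈ F∈′) (l , l∈ , Fl)) h)
        false-at l l∈ (inj₂ Fl) = Fl
  sound (mp {F} {G} ⊢F ⊢F⇒G) with sound ⊢F | sound ⊢F⇒G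
  ... | F∈ , hF | (_ , G∈) , hFG = G∈ , λ ρ ρ∈ → T-imp-elim F G ρ∈ F∈ G∈ (hFG ρ ρ∈) (hF ρ ρ∈)
  sound (subst-rule x {l} {F} ⊢F l∈ cf) with sound ⊢F
  ... | F∈ , hF = substᶠ-formula M̂ L̂-closed F x l∈ F∈ , λ ρ ρ∈ →
    trans (T-subst F x cf) (hF _ (groundEnv-update ρ∈ x (bind-groundList ρ∈ l∈)))
  sound (gen x {F} ⊢F) with sound ⊢F
  ... | F∈ , hF = F∈ , λ ρ ρ∈ → from (T-all x F ρ∈ F∈) λ l l∈ → hF _ (groundEnv-update ρ∈ x l∈)

  holds-closed : ∀ {F} → ClosedFormulas M̂ F → truth 𝒟 F ≡ true → Holds F
  holds-closed {F} (F∈ , cl) h = F∈ , λ ρ _ → trans (T-closed F cl) h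

  truth-of-holds : ∀ {F} → Closed F → Holds F → truth 𝒟 F ≡ true
  truth-of-holds {F} cl (_ , h) = trans (≡-sym (T-closed F cl)) (h ρ₀ ρ₀∈)

  -- A system whose theorems are exactly those of its formulas that hold in 𝒟
  -- is complete.
  complete : (N : System S Q) → (∀ F → IsFormula N F → IsFormula M̂ F) →
             (∀ {F} → Provable N F → Holds F) →
             (∀ {F} → IsFormula N F → Holds F → Provable N F) → IsComplete N
  complete N N⊆ ⊢⇒holds holds⇒⊢ F F∈ cl = mk⇔ decide refute
    where
    F∈̂ : ClosedFormulas M̂ F
    F∈̂ = N⊆ F F∈ , cl

    decide : ¬ Provable N F → Provable N (neg F)
    decide ⊬F with true-or-false (truth 𝒟 F)
    ... | inj₁ h = ⊥-elim (⊬F (holds⇒⊢ F∈ (holds-closed F∈̂ h)))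
    ... | inj₂ h = holds⇒⊢ F∈ (holds-closed {neg F} F∈̂ (trans (truth-neg F∈̂) (not-true h)))

    refute : Provable N (neg F) → ¬ Provable N F
    refute ⊢¬F ⊢F = true≢false (truth-of-holds cl (⊢⇒holds ⊢F))
      (not-true⁻ (trans (≡-sym (truth-neg F∈̂)) (truth-of-holds {neg F} cl (⊢⇒holds ⊢¬F))))

  -- The system M″

  M″-provable : ∀ {F} → Holds F → Provable (M″ M 𝒟) F
  M″-provable h = basis-axiom (holds⇒valid h)

  M″-isSystem : IsSystem (M″ M 𝒟)
  M″-isSystem = record
    { lists⊆IsList   = adjoin-isList (isList-mono inj₁ ∘ lists⊆IsList) inj₂
    ; variables      = L̂-var
    ; lists-subst    = subst∈ L̂-closed
    ; basis⊆formulas = λ {F} valid → formula-mono {M = M̂} id id F (Valid.isFormula valid)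
    }

  M″-complete : IsComplete (M″ M 𝒟)
  M″-complete = complete (M″ M 𝒟) (λ F → formula-mono {N = M̂} id id F) sound (λ _ → M″-provable)

  -- If x is the only free variable of F, the rest of the assignment is irrelevant.
  T-subst-ground : ∀ {ρ σ} F {l} x → FreeOnly x F → Ground l →
                   T ρ (F ⟦ l / x ⟧ᶠ) ≡ T (σ [ x ↦ l ]) F
  T-subst-ground {ρ} {σ} F {l} x F-only g =
    trans (T-subst F x (CF-ground F x g)) (T-cong F λ z z∈ → lemma (F-only z z∈))
    where
    lemma : ∀ {z} → z ≡ x → (ρ [ x ↦ bind ρ l ]) z ≡ (σ [ x ↦ l ]) z
    lemma refl = trans (update-same ρ x _)
      (trans (bind-ground ρ l g) (≡-sym (update-same σ x l)))

  quantified-closed : ∀ {F : Formula S Q} {x} → FreeOnly x F → Closed (ex x F)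
  quantified-closed F-only y (y≢x , y∈) = y≢x (F-only y y∈)

  -- It suffices to consider a single assignment, as both formulas are closed.
  henkin-axiom-holds : ∀ {F} x {d} → IsFormula M̂ F → FreeOnly x F → universe 𝒟 d →
                       (T ρ₀ (ex x F) ≡ true → T (ρ₀ [ x ↦ [ sym (name 𝒟 d) ] ]) F ≡ true) →
                       Holds (imp (ex x F) (F ⟦ [ sym (name 𝒟 d) ] / x ⟧ᶠ))
  henkin-axiom-holds {F} x {d} F∈ F-only d∈ h = (F∈ , Fc∈) , λ ρ ρ∈ →
    T-imp-intro (ex x F) _ ρ∈ F∈ Fc∈ λ hex →
      trans (T-subst-ground F x F-only (proj₂ (name-ground d∈)))
        (h (trans (T-cong (ex x F) λ y y∈ → ⊥-elim (quantified-closed {F = F} F-only y y∈)) hex))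
    where Fc∈ = substᶠ-formula M̂ L̂-closed F x (proj₁ (name-ground d∈)) F∈

  M″-henkin : IsHenkin (M″ M 𝒟)
  M″-henkin x F F∈ F-only = from-witness witness
    where
    F∈′ : IsFormula M̂ F
    F∈′ = formula-mono {N = M̂} id id F F∈

    -- If ∃xF is false, then every individual will do.
    Witness : Set
    Witness = ∃[ d ] universe 𝒟 d ×
      (T ρ₀ (ex x F) ≡ true → T (ρ₀ [ x ↦ [ sym (name 𝒟 d) ] ]) F ≡ true)

    witness : Witness
    witness with true-or-false (T ρ₀ (ex x F))
    ... | inj₂ h = proj₁ nonempty , proj₂ nonempty , λ h′ → ⊥-elim (true≢false h′ h)
    ... | inj₁ h with to (T-ex x F ρ₀∈ F∈′) h
    ...   | l , l∈ , Fl = value 𝒟 l , value∈universe l∈ , λ _ →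
            trans (≡-sym (T-value-cong F (groundEnv-update ρ₀∈ x l∈)
              (groundEnv-update ρ₀∈ x (name-ground (value∈universe l∈))) ≈ F∈′)) Fl
      where
      ≈ : ∀ y → value 𝒟 ((ρ₀ [ x ↦ l ]) y)
                ≡ value 𝒟 ((ρ₀ [ x ↦ [ sym (name 𝒟 (value 𝒟 l)) ] ]) y)
      ≈ y with x ≟ y
      ... | yes _ = ≡-sym (value-name (value∈universe l∈))
      ... | no  _ = refl

    from-witness : Witness →
      ∃[ c ] symbols M̂ c × lists M̂ [ sym c ]
           × Provable (M″ M 𝒟) (imp (ex x F) (F ⟦ [ sym c ] / x ⟧ᶠ))
    from-witness (d , d∈ , h) = name 𝒟 d , inj₂ (d , d∈ , refl) , proj₁ (name-ground d∈) ,
      M″-provable (henkin-axiom-holds x F∈′ F-only d∈ h)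

-- Codes

infixr 6 _∙_

-- Binary trees with numbers at the leaves, an intermediate stage between
-- formulas and their codes.
data Tree : Set where
  nat : ℕ → Tree
  _∙_ : Tree → Tree → Tree

private
  unary : ℕ → ℕᵇ → ℕᵇ
  unary zero    b = 2[1+ b ]
  unary (suc n) b = 1+[2 unary n b ]

  unary-injective : ∀ m n {b c} → unary m b ≡ unary n c → m ≡ n × b ≡ c
  unary-injective zero    zero    e = refl , 2[1+_]-injective e
  unary-injective (suc m) (suc n) e with unary-injective m n (1+[2_]-injective e)
  ... | refl , b≡c = refl , b≡c

  -- The digits that describe the tree in prefix notation, put in front of b.
  serialize : Tree → ℕᵇ → ℕᵇ
  serialize (nat n) b = 2[1+ unary n b ]
  serialize (s ∙ t) b = 1+[2 serialize s (serialize t b) ]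

  serialize-injective : ∀ s t {b c} → serialize s b ≡ serialize t c → s ≡ t × b ≡ c
  serialize-injective (nat m) (nat n) e with unary-injective m n (2[1+_]-injective e)
  ... | refl , b≡c = refl , b≡c
  serialize-injective (s ∙ t) (s′ ∙ t′) e with serialize-injective s s′ (1+[2_]-injective e)
  ... | refl , e′ with serialize-injective t t′ e′
  ...   | refl , b≡c = refl , b≡c

-- The number with these binary digits.  It determines the tree because the
-- digits of a tree are never the beginning of those of another.
treeCode : Tree → ℕ
treeCode t = toℕ (serialize t 0ᵇ)

treeCode-injective : ∀ {s t} → treeCode s ≡ treeCode t → s ≡ t
treeCode-injective {s} {t} e = proj₁ (serialize-injective s t (toℕ-injective e))

-- An injection of K into ℕ that does not depend on the evidence for
-- membership.
record Coding (K : Pred X 0ℓ) : Set where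
  field
    code      : ∀ {a} → K a → ℕ
    injective : ∀ {a b} (p : K a) (q : K b) → code p ≡ code q → a ≡ b
    canonical : ∀ {a} (p q : K a) → code p ≡ code q

  decide : ∀ {a b} → K a → K b → Dec (a ≡ b)
  decide p q = map′ (injective p q) (λ { refl → canonical p q }) (code p ≟ code q)

module Codes {S Q : Set} {A : Pred S 0ℓ} {P : Pred Q 0ℓ} (cA : Coding A) (cP : Coding P) where

  -- Expressions are related to the trees that code them.  A relation is used
  -- since only expressions over A and P have a code.
  data TokenCode : Token S → Tree → Set where
    var : ∀ x → TokenCode (var x) (nat 0 ∙ nat x)
    sym : ∀ {a k} (p : A a) → Coding.code cA p ≡ k → TokenCode (sym a) (nat 1 ∙ nat k)
    lp  : TokenCode lp (nat 2)
    rp  : TokenCode rp (nat 3)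

  data StrCode : Str S → Tree → Set where
    []  : StrCode [] (nat 0)
    _∷_ : ∀ {t l u v} → TokenCode t u → StrCode l v → StrCode (t ∷ l) (u ∙ v)

  data VecCode : ∀ {n} → Vec (Str S) n → Tree → Set where
    []  : VecCode [] (nat 0)
    _∷_ : ∀ {l u v} {ls : Vec (Str S) n} → StrCode l u → VecCode ls v → VecCode (l ∷ ls) (u ∙ v)

  data FormulaCode : Formula S Q → Tree → Set where
    eq  : ∀ {l m u v} → StrCode l u → StrCode m v → FormulaCode (eq l m) (nat 0 ∙ u ∙ v)
    rel : ∀ {p k u} {ls : Vec (Str S) n} (q : P p) → Coding.code cP q ≡ k → VecCode ls u →
          FormulaCode (rel p ls) (nat 1 ∙ nat k ∙ u)
    neg : ∀ {F u} → FormulaCode F u → FormulaCode (neg F) (nat 2 ∙ u)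
    imp : ∀ {F G u v} → FormulaCode F u → FormulaCode G v → FormulaCode (imp F G) (nat 3 ∙ u ∙ v)
    iff : ∀ {F G u v} → FormulaCode F u → FormulaCode G v → FormulaCode (iff F G) (nat 4 ∙ u ∙ v)
    con : ∀ {F G u v} → FormulaCode F u → FormulaCode G v → FormulaCode (con F G) (nat 5 ∙ u ∙ v)
    dis : ∀ {F G u v} → FormulaCode F u → FormulaCode G v → FormulaCode (dis F G) (nat 6 ∙ u ∙ v)
    all : ∀ {F u} x → FormulaCode F u → FormulaCode (all x F) (nat 7 ∙ nat x ∙ u)
    ex  : ∀ {F u} x → FormulaCode F u → FormulaCode (ex x F) (nat 8 ∙ nat x ∙ u)

  private
    token-injective : ∀ {t t′ u} → TokenCode t u → TokenCode t′ u → t ≡ t′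
    token-injective (var x)   (var .x)   = refl
    token-injective (sym p e) (sym q e′) = cong sym (Coding.injective cA p q (trans e (≡-sym e′)))
    token-injective lp        lp         = refl
    token-injective rp        rp         = refl

    str-injective : ∀ {l l′ u} → StrCode l u → StrCode l′ u → l ≡ l′
    str-injective []       []         = refl
    str-injective (t ∷ ts) (t′ ∷ ts′) = cong₂ _∷_ (token-injective t t′) (str-injective ts ts′)

    vec-injective : ∀ {u} {ls : Vec (Str S) n} {ls′ : Vec (Str S) m} → VecCode ls u → VecCode ls′ u →
                    _≡_ {A = ∃ (Vec (Str S))} (n , ls) (m , ls′)
    vec-injective []       []         = refl
    vec-injective (l ∷ ls) (l′ ∷ ls′) with str-injective l l′ | vec-injective ls ls′
    ... | refl | refl = refl

  formula-injective : ∀ {F G u} → FormulaCode F u → FormulaCode G u → F ≡ G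
  formula-injective (eq l m) (eq l′ m′) = cong₂ eq (str-injective l l′) (str-injective m m′)
  formula-injective (rel p e ls) (rel p′ e′ ls′)
    with Coding.injective cP p p′ (trans e (≡-sym e′)) | vec-injective ls ls′
  ... | refl | refl = refl
  formula-injective (neg F)   (neg F′)    = cong neg (formula-injective F F′)
  formula-injective (imp F G) (imp F′ G′) = cong₂ imp (formula-injective F F′) (formula-injective G G′)
  formula-injective (iff F G) (iff F′ G′) = cong₂ iff (formula-injective F F′) (formula-injective G G′)
  formula-injective (con F G) (con F′ G′) = cong₂ con (formula-injective F F′) (formula-injective G G′)
  formula-injective (dis F G) (dis F′ G′) = cong₂ dis (formula-injective F F′) (formula-injective G G′)
  formula-injective (all x F) (all .x F′) = cong (all x) (formula-injective F F′)
  formula-injective (ex x F)  (ex .x F′)  = cong (ex x) (formula-injective F F′)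

  private
    token-functional : ∀ {t u u′} → TokenCode t u → TokenCode t u′ → u ≡ u′
    token-functional (var x) (var .x) = refl
    token-functional (sym p refl) (sym q refl) = cong (λ k → nat 1 ∙ nat k) (Coding.canonical cA p q)
    token-functional lp      lp       = refl
    token-functional rp      rp       = refl

    str-functional : ∀ {l u u′} → StrCode l u → StrCode l u′ → u ≡ u′
    str-functional []       []         = refl
    str-functional (t ∷ ts) (t′ ∷ ts′) = cong₂ _∙_ (token-functional t t′) (str-functional ts ts′)

    vec-functional : ∀ {u u′} {ls : Vec (Str S) n} → VecCode ls u → VecCode ls u′ → u ≡ u′
    vec-functional []       []         = refl
    vec-functional (l ∷ ls) (l′ ∷ ls′) = cong₂ _∙_ (str-functional l l′) (vec-functional ls ls′)

  formula-functional : ∀ {F u u′} → FormulaCode F u → FormulaCode F u′ → u ≡ u′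
  formula-functional (eq l m)   (eq l′ m′)   = cong₂ (λ u v → nat 0 ∙ u ∙ v) (str-functional l l′) (str-functional m m′)
  formula-functional (rel p refl ls) (rel p′ refl ls′) = cong₂ (λ k u → nat 1 ∙ nat k ∙ u) (Coding.canonical cP p p′) (vec-functional ls ls′)
  formula-functional (neg F)    (neg F′)     = cong (nat 2 ∙_) (formula-functional F F′)
  formula-functional (imp F G)  (imp F′ G′)  = cong₂ (λ u v → nat 3 ∙ u ∙ v) (formula-functional F F′) (formula-functional G G′)
  formula-functional (iff F G)  (iff F′ G′)  = cong₂ (λ u v → nat 4 ∙ u ∙ v) (formula-functional F F′) (formula-functional G G′)
  formula-functional (con F G)  (con F′ G′)  = cong₂ (λ u v → nat 5 ∙ u ∙ v) (formula-functional F F′) (formula-functional G G′)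
  formula-functional (dis F G)  (dis F′ G′)  = cong₂ (λ u v → nat 6 ∙ u ∙ v) (formula-functional F F′) (formula-functional G G′)
  formula-functional (all x F)  (all .x F′)  = cong (λ u → nat 7 ∙ nat x ∙ u) (formula-functional F F′)
  formula-functional (ex x F)   (ex .x F′)   = cong (λ u → nat 8 ∙ nat x ∙ u) (formula-functional F F′)

  str-total : ∀ l → All A (symbolsOfStr l) → ∃ (StrCode l)
  str-total []          _         = _ , []
  str-total (var x ∷ l) as        = _ , var x ∷ proj₂ (str-total l as)
  str-total (sym a ∷ l) (a∈ ∷ as) = _ , sym a∈ refl ∷ proj₂ (str-total l as)
  str-total (lp ∷ l)    as        = _ , lp ∷ proj₂ (str-total l as)
  str-total (rp ∷ l)    as        = _ , rp ∷ proj₂ (str-total l as)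

  private
    vec-total : {ls : Vec (Str S) n} → VecAll.All (λ l → ∃ (StrCode l)) ls → ∃ (VecCode ls)
    vec-total []             = _ , []
    vec-total ((_ , l) ∷ ls) = _ , l ∷ proj₂ (vec-total ls)

  formula-total : (M : System S Q) → (∀ {l} → lists M l → All A (symbolsOfStr l)) →
                  predicates M ⊆ P → ∀ F → IsFormula M F → ∃ (FormulaCode F)
  formula-total M L⊆ P⊆ = go
    where
    go : ∀ F → IsFormula M F → ∃ (FormulaCode F)
    go (eq l m)   (l∈ , m∈)  = _ , eq (proj₂ (str-total l (L⊆ l∈))) (proj₂ (str-total m (L⊆ m∈)))
    go (rel p ls) (p∈ , ls∈) = _ , rel (P⊆ p∈) refl (proj₂ (vec-total (VecAll.map (λ l∈ → str-total _ (L⊆ l∈)) ls∈)))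
    go (neg F)    F∈         = _ , neg (proj₂ (go F F∈))
    go (imp F G)  (F∈ , G∈)  = _ , imp (proj₂ (go F F∈)) (proj₂ (go G G∈))
    go (iff F G)  (F∈ , G∈)  = _ , iff (proj₂ (go F F∈)) (proj₂ (go G G∈))
    go (con F G)  (F∈ , G∈)  = _ , con (proj₂ (go F F∈)) (proj₂ (go G G∈))
    go (dis F G)  (F∈ , G∈)  = _ , dis (proj₂ (go F F∈)) (proj₂ (go G G∈))
    go (all x F)  F∈         = _ , all x (proj₂ (go F F∈))
    go (ex x F)   F∈         = _ , ex x (proj₂ (go F F∈))

-- The symbols of lists and formulas

symbolsOfStr-++ : (l m : Str S) → symbolsOfStr (l ++ m) ≡ symbolsOfStr l ++ symbolsOfStr m
symbolsOfStr-++ []          m = refl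
symbolsOfStr-++ (var _ ∷ l) m = symbolsOfStr-++ l m
symbolsOfStr-++ (sym a ∷ l) m = cong (a ∷_) (symbolsOfStr-++ l m)
symbolsOfStr-++ (lp ∷ l)    m = symbolsOfStr-++ l m
symbolsOfStr-++ (rp ∷ l)    m = symbolsOfStr-++ l m

isList⇒symbols : {A : Pred S 0ℓ} {l : Str S} → IsList A l → All A (symbolsOfStr l)
isList⇒symbols (variable-list _) = []
isList⇒symbols (symbol-list a∈)  = a∈ ∷ []
isList⇒symbols {A = A} (application {l = l} f∈ l∈) =
  f∈ ∷ subst (All A) (≡-sym (symbolsOfStr-++ l [ rp ])) (All-++⁺ (isList⇒symbols l∈) [])
isList⇒symbols {A = A} (concatenation {l} {m} l∈ m∈) =
  subst (All A) (≡-sym (symbolsOfStr-++ l m)) (All-++⁺ (isList⇒symbols l∈) (isList⇒symbols m∈))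

formula⇒symbols : {A : Pred S 0ℓ} (M : System S Q) → (∀ {l} → lists M l → All A (symbolsOfStr l)) →
                  ∀ F → IsFormula M F → All A (symbolsOf F)
formula⇒symbols {S} {Q} {A} M L⊆ = go
  where
  go-vec : {ls : Vec (Str S) n} → VecAll.All (lists M) ls → All A (symbolsOfStr (concat (toList ls)))
  go-vec []                     = []
  go-vec {ls = l ∷ ls} (l∈ ∷ ls∈) =
    subst (All A) (≡-sym (symbolsOfStr-++ l (concat (toList ls)))) (All-++⁺ (L⊆ l∈) (go-vec ls∈))

  go : (F : Formula S Q) → IsFormula M F → All A (symbolsOf F)
  go (eq l m)   (l∈ , m∈) = All-++⁺ (L⊆ l∈) (L⊆ m∈)
  go (rel p ls) (_ , ls∈) = go-vec ls∈
  go (neg F)    F∈        = go F F∈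
  go (imp F G)  (F∈ , G∈) = All-++⁺ (go F F∈) (go G G∈)
  go (iff F G)  (F∈ , G∈) = All-++⁺ (go F F∈) (go G G∈)
  go (con F G)  (F∈ , G∈) = All-++⁺ (go F F∈) (go G G∈)
  go (dis F G)  (F∈ , G∈) = All-++⁺ (go F F∈) (go G G∈)
  go (all x F)  F∈        = go F F∈
  go (ex x F)   F∈        = go F F∈

-- Replacement of symbols

-- Replacement of each variable x by the token ρ x and of each symbol a by a
-- token t with R a t.  R is a relation, and not a function, because membership
-- of a symbol in a given set need not be decidable.
data TokenRel (ρ : Var → Token S) (R : S → Token S → Set) : Token S → Token S → Set where
  var : ∀ {x t} → t ≡ ρ x → TokenRel ρ R (var x) t
  sym : ∀ {a t} → R a t → TokenRel ρ R (sym a) t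
  lp  : TokenRel ρ R lp lp
  rp  : TokenRel ρ R rp rp

StrRel : (Var → Token S) → (S → Token S → Set) → Str S → Str S → Set
StrRel ρ R = Pointwise (TokenRel ρ R)

-- G is F with every symbol a replaced by a token t such that R a t.
data FormulaRel {S Q : Set} (R : S → Token S → Set) : Formula S Q → Formula S Q → Set where
  eq  : ∀ {l l′ m m′} → StrRel var R l l′ → StrRel var R m m′ → FormulaRel R (eq l m) (eq l′ m′)
  rel : ∀ {p} {ls ls′ : Vec (Str S) n} → VecPW.Pointwise (StrRel var R) ls ls′ →
        FormulaRel R (rel p ls) (rel p ls′)
  neg : ∀ {F F′} → FormulaRel R F F′ → FormulaRel R (neg F) (neg F′)
  imp : ∀ {F F′ G G′} → FormulaRel R F F′ → FormulaRel R G G′ → FormulaRel R (imp F G) (imp F′ G′)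
  iff : ∀ {F F′ G G′} → FormulaRel R F F′ → FormulaRel R G G′ → FormulaRel R (iff F G) (iff F′ G′)
  con : ∀ {F F′ G G′} → FormulaRel R F F′ → FormulaRel R G G′ → FormulaRel R (con F G) (con F′ G′)
  dis : ∀ {F F′ G G′} → FormulaRel R F F′ → FormulaRel R G G′ → FormulaRel R (dis F G) (dis F′ G′)
  all : ∀ {x F F′} → FormulaRel R F F′ → FormulaRel R (all x F) (all x F′)
  ex  : ∀ {x F F′} → FormulaRel R F F′ → FormulaRel R (ex x F) (ex x F′)

Functional : (S → Token S → Set) → Set
Functional R = ∀ {a t u} → R a t → R a u → t ≡ u

module _ {R : S → Token S → Set} (functional : Functional R) where

  private
    token-functional : ∀ {ρ t u v} → TokenRel ρ R t u → TokenRel ρ R t v → u ≡ v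
    token-functional (var e) (var e′) = trans e (≡-sym e′)
    token-functional (sym r) (sym r′) = functional r r′
    token-functional lp      lp       = refl
    token-functional rp      rp       = refl

    str-functional : ∀ {ρ l m k} → StrRel ρ R l m → StrRel ρ R l k → m ≡ k
    str-functional []       []         = refl
    str-functional (t ∷ ts) (t′ ∷ ts′) = cong₂ _∷_ (token-functional t t′) (str-functional ts ts′)

    vec-functional : {ls ms ks : Vec (Str S) n} → VecPW.Pointwise (StrRel var R) ls ms →
                     VecPW.Pointwise (StrRel var R) ls ks → ms ≡ ks
    vec-functional []       []         = refl
    vec-functional (l ∷ ls) (l′ ∷ ls′) = cong₂ _∷_ (str-functional l l′) (vec-functional ls ls′)

  formulaRel-functional : {F G H : Formula S Q} → FormulaRel R F G → FormulaRel R F H → G ≡ H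
  formulaRel-functional (eq l m)   (eq l′ m′)  = cong₂ eq (str-functional l l′) (str-functional m m′)
  formulaRel-functional (rel ls)   (rel ls′)   = cong (rel _) (vec-functional ls ls′)
  formulaRel-functional (neg F)    (neg F′)    = cong neg (formulaRel-functional F F′)
  formulaRel-functional (imp F G)  (imp F′ G′) = cong₂ imp (formulaRel-functional F F′) (formulaRel-functional G G′)
  formulaRel-functional (iff F G)  (iff F′ G′) = cong₂ iff (formulaRel-functional F F′) (formulaRel-functional G G′)
  formulaRel-functional (con F G)  (con F′ G′) = cong₂ con (formulaRel-functional F F′) (formulaRel-functional G G′)
  formulaRel-functional (dis F G)  (dis F′ G′) = cong₂ dis (formulaRel-functional F F′) (formulaRel-functional G G′)
  formulaRel-functional (all F)    (all F′)    = cong (all _) (formulaRel-functional F F′)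
  formulaRel-functional (ex F)     (ex F′)     = cong (ex _) (formulaRel-functional F F′)

All-symbols-∷⁻ : {P : Pred S 0ℓ} (l : Str S) (ls : Vec (Str S) n) →
                 All P (symbolsOfStr (concat (toList (l ∷ ls)))) →
                 All P (symbolsOfStr l) × All P (symbolsOfStr (concat (toList ls)))
All-symbols-∷⁻ {P = P} l ls h =
  All-++⁻ (symbolsOfStr l) (subst (All P) (symbolsOfStr-++ l (concat (toList ls))) h)

module _ {R : S → Token S → Set} where

  strRel-refl : ∀ l → All (λ a → R a (sym a)) (symbolsOfStr l) → StrRel var R l l
  strRel-refl []          _        = []
  strRel-refl (var x ∷ l) rs       = var refl ∷ strRel-refl l rs
  strRel-refl (sym a ∷ l) (r ∷ rs) = sym r ∷ strRel-refl l rs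
  strRel-refl (lp ∷ l)    rs       = lp ∷ strRel-refl l rs
  strRel-refl (rp ∷ l)    rs       = rp ∷ strRel-refl l rs

  formulaRel-refl : (F : Formula S Q) → All (λ a → R a (sym a)) (symbolsOf F) → FormulaRel R F F
  formulaRel-refl (eq l m) rs with All-++⁻ (symbolsOfStr l) rs
  ... | ls , ms = eq (strRel-refl l ls) (strRel-refl m ms)
  formulaRel-refl (rel p ls) rs = rel (vec ls rs)
    where
    vec : (ls : Vec (Str S) n) → All (λ a → R a (sym a)) (symbolsOfStr (concat (toList ls))) →
          VecPW.Pointwise (StrRel var R) ls ls
    vec []       _  = []
    vec (l ∷ ls) rs with All-symbols-∷⁻ l ls rs
    ... | r , rs′ = strRel-refl l r ∷ vec ls rs′
  formulaRel-refl (neg F) rs = neg (formulaRel-refl F rs)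
  formulaRel-refl (imp F G) rs with All-++⁻ (symbolsOf F) rs
  ... | fs , gs = imp (formulaRel-refl F fs) (formulaRel-refl G gs)
  formulaRel-refl (iff F G) rs with All-++⁻ (symbolsOf F) rs
  ... | fs , gs = iff (formulaRel-refl F fs) (formulaRel-refl G gs)
  formulaRel-refl (con F G) rs with All-++⁻ (symbolsOf F) rs
  ... | fs , gs = con (formulaRel-refl F fs) (formulaRel-refl G gs)
  formulaRel-refl (dis F G) rs with All-++⁻ (symbolsOf F) rs
  ... | fs , gs = dis (formulaRel-refl F fs) (formulaRel-refl G gs)
  formulaRel-refl (all x F) rs = all (formulaRel-refl F rs)
  formulaRel-refl (ex x F)  rs = ex (formulaRel-refl F rs)

  strRel-total : ∀ l → All (λ a → ∃ (R a)) (symbolsOfStr l) → ∃ (StrRel var R l)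
  strRel-total []          _            = _ , []
  strRel-total (var x ∷ l) rs           = _ , var refl ∷ proj₂ (strRel-total l rs)
  strRel-total (sym a ∷ l) ((_ , r) ∷ rs) = _ , sym r ∷ proj₂ (strRel-total l rs)
  strRel-total (lp ∷ l)    rs           = _ , lp ∷ proj₂ (strRel-total l rs)
  strRel-total (rp ∷ l)    rs           = _ , rp ∷ proj₂ (strRel-total l rs)

  formulaRel-total : (F : Formula S Q) → All (λ a → ∃ (R a)) (symbolsOf F) → ∃ (FormulaRel R F)
  formulaRel-total (eq l m) rs with All-++⁻ (symbolsOfStr l) rs
  ... | ls , ms = _ , eq (proj₂ (strRel-total l ls)) (proj₂ (strRel-total m ms))
  formulaRel-total (rel p ls) rs = _ , rel (proj₂ (vec ls rs))
    where
    vec : (ls : Vec (Str S) n) → All (λ a → ∃ (R a)) (symbolsOfStr (concat (toList ls))) →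
          ∃[ ls′ ] VecPW.Pointwise (StrRel var R) {n = n} ls ls′
    vec []       _  = _ , []
    vec (l ∷ ls) rs with All-symbols-∷⁻ l ls rs
    ... | r , rs′ = _ , proj₂ (strRel-total l r) ∷ proj₂ (vec ls rs′)
  formulaRel-total (neg F) rs = _ , neg (proj₂ (formulaRel-total F rs))
  formulaRel-total (imp F G) rs with All-++⁻ (symbolsOf F) rs
  ... | fs , gs = _ , imp (proj₂ (formulaRel-total F fs)) (proj₂ (formulaRel-total G gs))
  formulaRel-total (iff F G) rs with All-++⁻ (symbolsOf F) rs
  ... | fs , gs = _ , iff (proj₂ (formulaRel-total F fs)) (proj₂ (formulaRel-total G gs))
  formulaRel-total (con F G) rs with All-++⁻ (symbolsOf F) rs
  ... | fs , gs = _ , con (proj₂ (formulaRel-total F fs)) (proj₂ (formulaRel-total G gs))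
  formulaRel-total (dis F G) rs with All-++⁻ (symbolsOf F) rs
  ... | fs , gs = _ , dis (proj₂ (formulaRel-total F fs)) (proj₂ (formulaRel-total G gs))
  formulaRel-total (all x F) rs = _ , all (proj₂ (formulaRel-total F rs))
  formulaRel-total (ex x F)  rs = _ , ex (proj₂ (formulaRel-total F rs))

  formulaRel⇒formula : (M N : System S Q) → predicates M ⊆ predicates N →
    (∀ {l l′} → lists M l → StrRel var R l l′ → lists N l′) →
    ∀ {F F′} → IsFormula M F → FormulaRel R F F′ → IsFormula N F′
  formulaRel⇒formula M N P⊆ h = go
    where
    vec : {ls ls′ : Vec (Str S) n} → VecAll.All (lists M) ls →
          VecPW.Pointwise (StrRel var R) ls ls′ → VecAll.All (lists N) ls′
    vec []         []       = []
    vec (l∈ ∷ ls∈) (l ∷ ls) = h l∈ l ∷ vec ls∈ ls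

    go : ∀ {F F′} → IsFormula M F → FormulaRel R F F′ → IsFormula N F′
    go (l∈ , m∈)  (eq l m)  = h l∈ l , h m∈ m
    go (p∈ , ls∈) (rel ls)  = P⊆ p∈ , vec ls∈ ls
    go F∈         (neg F)   = go F∈ F
    go (F∈ , G∈)  (imp F G) = go F∈ F , go G∈ G
    go (F∈ , G∈)  (iff F G) = go F∈ F , go G∈ G
    go (F∈ , G∈)  (con F G) = go F∈ F , go G∈ G
    go (F∈ , G∈)  (dis F G) = go F∈ F , go G∈ G
    go F∈         (all F)   = go F∈ F
    go F∈         (ex F)    = go F∈ F

  formulaRel⇒replace : {cxs : List (S × Var)} →
    (∀ {a t} → R a t → ReplaceToken cxs (sym a) t) →
    {F G : Formula S Q} → FormulaRel R F G → Replace cxs F G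
  formulaRel⇒replace {Q} {cxs} h = go
    where
    token : ∀ {t u} → TokenRel var R t u → ReplaceToken cxs t u
    token (var refl) = var
    token (sym r)    = h r
    token lp         = lp
    token rp         = rp

    str : ∀ {l m} → StrRel var R l m → Pointwise (ReplaceToken cxs) l m
    str = PW.map token

    go : {F G : Formula S Q} → FormulaRel R F G → Replace cxs F G
    go (eq l m)  = eq (str l) (str m)
    go (rel ls)  = rel (VecPW.map str ls)
    go (neg F)   = neg (go F)
    go (imp F G) = imp (go F) (go G)
    go (iff F G) = iff (go F) (go G)
    go (con F G) = con (go F) (go G)
    go (dis F G) = dis (go F) (go G)
    go (all F)   = all (go F)
    go (ex F)    = ex (go F)

  formulaRel-free : {F G : Formula S Q} {x : Var} →
                    FormulaRel R F G → x ∈free F → x ∈free G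
  formulaRel-free {x = x} = go
    where
    str : ∀ {l m} → StrRel var R l m → x ∈var l → x ∈var m
    str (var refl ∷ _) (here refl) = here refl
    str (_ ∷ ts)       (there x∈)  = there (str ts x∈)

    vec : {ls ms : Vec (Str S) n} → VecPW.Pointwise (StrRel var R) ls ms →
          StrRel var R (concat (toList ls)) (concat (toList ms))
    vec []       = []
    vec (l ∷ ls) = PW.++⁺ l (vec ls)

    go : ∀ {F G} → FormulaRel R F G → x ∈free F → x ∈free G
    go (eq l m)  = ⊎-map (str l) (str m)
    go (rel ls)  = str (vec ls)
    go (neg F)   = go F
    go (imp F G) = ⊎-map (go F) (go G)
    go (iff F G) = ⊎-map (go F) (go G)
    go (con F G) = ⊎-map (go F) (go G)
    go (dis F G) = ⊎-map (go F) (go G)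
    go (all F)   (x≢ , x∈) = x≢ , go F x∈
    go (ex F)    (x≢ , x∈) = x≢ , go F x∈

  -- If R fixes all symbols of l, then only the variables are replaced.
  strRel⇒bind : ∀ {ρ l l′} → All (λ a → ∀ {t} → R a t → t ≡ sym a) (symbolsOfStr l) →
                StrRel ρ R l l′ → l′ ≡ bind (λ x → [ ρ x ]) l
  strRel⇒bind fixed       []             = refl
  strRel⇒bind fixed       (var e ∷ ts)   = cong₂ _∷_ e (strRel⇒bind fixed ts)
  strRel⇒bind (f ∷ fixed) (sym r ∷ ts)   = cong₂ _∷_ (f r) (strRel⇒bind fixed ts)
  strRel⇒bind fixed       (lp ∷ ts)      = cong (lp ∷_) (strRel⇒bind fixed ts)
  strRel⇒bind fixed       (rp ∷ ts)      = cong (rp ∷_) (strRel⇒bind fixed ts)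

  strRel-subst : (∀ {a t} → R a t → ∃[ b ] t ≡ sym b) → ∀ {l m a b} x → StrRel var R l m →
                 R a (sym b) → StrRel var R (l ⟦ [ sym a ] / x ⟧) (m ⟦ [ sym b ] / x ⟧)
  strRel-subst to-sym x []                    r = []
  strRel-subst to-sym x (var {y} refl ∷ ts)   r with x ≟ y
  ... | yes _ = sym r ∷ strRel-subst to-sym x ts r
  ... | no  _ = var refl ∷ strRel-subst to-sym x ts r
  strRel-subst to-sym x (sym r′ ∷ ts)         r with to-sym r′
  ... | _ , refl = sym r′ ∷ strRel-subst to-sym x ts r
  strRel-subst to-sym x (lp ∷ ts)             r = lp ∷ strRel-subst to-sym x ts r
  strRel-subst to-sym x (rp ∷ ts)             r = rp ∷ strRel-subst to-sym x ts r

  -- The image of a list under the constant substitution c/x determines an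
  -- image of the list itself.
  strRel-subst⁻ : Functional R → ∀ {ρ c t} x l {l′} → R c t →
                  StrRel ρ R (l ⟦ [ sym c ] / x ⟧) l′ → StrRel (ρ [ x ↦ t ]) R l l′
  strRel-subst⁻ functional x [] r [] = []
  strRel-subst⁻ functional {ρ} {c} {t} x (var y ∷ l) r ts = go ts
    where
    go : ∀ {l′} → StrRel ρ R ((var y ∷ l) ⟦ [ sym c ] / x ⟧) l′ → StrRel (ρ [ x ↦ t ]) R (var y ∷ l) l′
    go ts with x ≟ y in e
    go (sym r′ ∷ ts) | yes refl =
      var (trans (functional r′ r) (≡-sym (update-same ρ x t))) ∷ strRel-subst⁻ functional x l r ts
    go (var e′ ∷ ts) | no x≢y =
      var (trans e′ (≡-sym (update-other ρ {x} t x≢y))) ∷ strRel-subst⁻ functional x l r ts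
  strRel-subst⁻ functional x (sym a ∷ l) r (sym r′ ∷ ts) = sym r′ ∷ strRel-subst⁻ functional x l r ts
  strRel-subst⁻ functional x (lp ∷ l)    r (lp ∷ ts)     = lp ∷ strRel-subst⁻ functional x l r ts
  strRel-subst⁻ functional x (rp ∷ l)    r (rp ∷ ts)     = rp ∷ strRel-subst⁻ functional x l r ts

  strRel-subst-defined : ∀ {ρ c} x l {l′} → x ∈var l → StrRel ρ R (l ⟦ [ sym c ] / x ⟧) l′ → ∃ (R c)
  strRel-subst-defined {ρ} {c} x (var y ∷ l) x∈ ts = go x∈ ts
    where
    go : ∀ {l′} → x ∈var (var y ∷ l) → StrRel ρ R ((var y ∷ l) ⟦ [ sym c ] / x ⟧) l′ → ∃ (R c)
    go x∈ ts with x ≟ y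
    go x∈          (sym r ∷ ts) | yes _  = _ , r
    go (here refl) (_ ∷ ts)     | no x≢x = ⊥-elim (x≢x refl)
    go (there x∈)  (_ ∷ ts)     | no _   = strRel-subst-defined x l x∈ ts
  strRel-subst-defined x (sym a ∷ l) (there x∈) (_ ∷ ts) = strRel-subst-defined x l x∈ ts
  strRel-subst-defined x (lp ∷ l)    (there x∈) (_ ∷ ts) = strRel-subst-defined x l x∈ ts
  strRel-subst-defined x (rp ∷ l)    (there x∈) (_ ∷ ts) = strRel-subst-defined x l x∈ ts

  -- If the images of the lists of L lie in L′ whenever the variables are replaced
  -- by good tokens, then so do the images of the lists of Adjoin L K, provided
  -- that the members of K are replaced by good tokens, too.
  adjoin-image : {L L′ : Pred (Str S) 0ℓ} {K : Pred S 0ℓ} {Good : Pred (Token S) 0ℓ} →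
    Functional R → (∀ {c t} → K c → R c t → Good t) →
    (∀ ρ → (∀ x → Good (ρ x)) → ∀ {l l′} → L l → StrRel ρ R l l′ → L′ l′) →
    ∀ ρ → (∀ x → Good (ρ x)) → ∀ {l l′} → Adjoin L K l → StrRel ρ R l l′ → L′ l′
  adjoin-image functional K-good L-image ρ ρ-good (base l∈) r = L-image ρ ρ-good l∈ r
  adjoin-image {L′ = L′} {Good = Good} functional K-good L-image ρ ρ-good (step {l} {c} x l∈ c∈K) r
    with _∈?_ _≟_ x (varsOf l)
  ... | no x∉l = adjoin-image functional K-good L-image ρ ρ-good l∈
          (subst (λ k → StrRel ρ R k _) (subst-fresh l [ sym c ] (x∉l ∘ varsOf⁺ l)) r)
  ... | yes x∈l with strRel-subst-defined x l (varsOf⁻ l x∈l) r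
  ...   | t , ct = adjoin-image functional K-good L-image (ρ [ x ↦ t ])
            (update-all {P = Good} x ρ-good (K-good c∈K ct)) l∈ (strRel-subst⁻ functional x l ct r)

-- Two successive replacements R₁ and R₂, followed by a substitution for the
-- variables satisfying V, amount to the replacement R₃.  In the application R₁
-- introduces the variables satisfying V.
module _ {R₁ R₂ R₃ : S → Token S → Set} {ρ : Env S} {V : Pred Var 0ℓ}
         (ρ-fixed : ∀ x → ¬ V x → ρ x ≡ ids x)
         (compose : ∀ {a t u} → R₁ a t → TokenRel var R₂ t u → ∃[ v ] R₃ a v × bindToken ρ u ≡ [ v ]) where

  private
    str : ∀ {l k m} → (∀ x → x ∈var l → ¬ V x) → StrRel var R₁ l k → StrRel var R₂ k m →
          StrRel var R₃ l (bind ρ m)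
    str new []                     []             = []
    str new (_∷_ {y = y} (var {x} refl) ts) (var refl ∷ us) rewrite ρ-fixed x (new x (here refl)) =
      var refl ∷ str (λ z → new z ∘ there) ts us
    str new (sym r ∷ ts) (u ∷ us) with compose r u
    ... | v , r′ , e rewrite e = sym r′ ∷ str (λ z → new z ∘ there) ts us
    str new (lp ∷ ts) (lp ∷ us) = lp ∷ str (λ z → new z ∘ there) ts us
    str new (rp ∷ ts) (rp ∷ us) = rp ∷ str (λ z → new z ∘ there) ts us

    vec : {ls ks ms : Vec (Str S) n} → (∀ x → x ∈var concat (toList ls) → ¬ V x) →
          VecPW.Pointwise (StrRel var R₁) ls ks → VecPW.Pointwise (StrRel var R₂) ks ms →
          VecPW.Pointwise (StrRel var R₃) ls (Vec.map (bind ρ) ms)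
    vec new [] [] = []
    vec {ls = l ∷ _} new (r ∷ rs) (r′ ∷ rs′) =
      str (λ x → new x ∘ ∈-++⁺ˡ) r r′ ∷ vec (λ x → new x ∘ ∈-++⁺ʳ l) rs rs′

    under : ∀ {x} → ¬ V x → (F : Formula S Q) → bindᶠ (ρ [ x ↦ ids x ]) F ≡ bindᶠ ρ F
    under {x = x} ¬Vx F = bindᶠ-cong F λ y _ → lemma y
      where
      lemma : ∀ y → (ρ [ x ↦ ids x ]) y ≡ ρ y
      lemma y with x ≟ y
      ... | yes refl = ≡-sym (ρ-fixed x ¬Vx)
      ... | no  _    = refl

  -- The variables satisfying V do not occur in F, not even bound; so no quantifier
  -- interferes with the substitution for them.
  formulaRel-compose : {F G H : Formula S Q} → (∀ x → x ∈varᶠ F → ¬ V x) →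
    FormulaRel R₁ F G → FormulaRel R₂ G H → FormulaRel R₃ F (bindᶠ ρ H)
  formulaRel-compose new (eq l m)  (eq l′ m′)  =
    eq (str (λ x → new x ∘ inj₁) l l′) (str (λ x → new x ∘ inj₂) m m′)
  formulaRel-compose new (rel ls)  (rel ls′)   = rel (vec new ls ls′)
  formulaRel-compose new (neg F)   (neg F′)    = neg (formulaRel-compose new F F′)
  formulaRel-compose new (imp F G) (imp F′ G′) =
    imp (formulaRel-compose (λ x → new x ∘ inj₁) F F′) (formulaRel-compose (λ x → new x ∘ inj₂) G G′)
  formulaRel-compose new (iff F G) (iff F′ G′) =
    iff (formulaRel-compose (λ x → new x ∘ inj₁) F F′) (formulaRel-compose (λ x → new x ∘ inj₂) G G′)
  formulaRel-compose new (con F G) (con F′ G′) =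
    con (formulaRel-compose (λ x → new x ∘ inj₁) F F′) (formulaRel-compose (λ x → new x ∘ inj₂) G G′)
  formulaRel-compose new (dis F G) (dis F′ G′) =
    dis (formulaRel-compose (λ x → new x ∘ inj₁) F F′) (formulaRel-compose (λ x → new x ∘ inj₂) G G′)
  formulaRel-compose new (all {x} F) (all {F′ = H} F′) =
    subst (λ K → FormulaRel R₃ _ (all x K)) (≡-sym (under (new x (inj₁ refl)) H))
      (all (formulaRel-compose (λ y → new y ∘ inj₂) F F′))
  formulaRel-compose new (ex {x} F) (ex {F′ = H} F′) =
    subst (λ K → FormulaRel R₃ _ (ex x K)) (≡-sym (under (new x (inj₁ refl)) H))
      (ex (formulaRel-compose (λ y → new y ∘ inj₂) F F′))

-- Fresh variables and enumerations

private
  either-bound : {P₁ P₂ : Pred Var 0ℓ} → (∃[ n ] ∀ x → P₁ x → x < n) → (∃[ n ] ∀ x → P₂ x → x < n) →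
                 ∃[ n ] ∀ x → P₁ x ⊎ P₂ x → x < n
  either-bound (m , f) (n , g) = m ⊔ n , λ
    { x (inj₁ p) → <-≤-trans (f x p) (m≤m⊔n m n)
    ; x (inj₂ p) → <-≤-trans (g x p) (m≤n⊔m m n) }

  singleton-bound : ∀ y → ∃[ n ] ∀ x → x ≡ y → x < n
  singleton-bound y = suc y , λ { x refl → ≤-refl }

varᶠ-bound : (F : Formula S Q) → ∃[ n ] ∀ x → x ∈varᶠ F → x < n
varᶠ-bound (eq l m)   = either-bound (bound l , λ _ → <-bound l) (bound m , λ _ → <-bound m)
varᶠ-bound (rel p ls) = bound (concat (toList ls)) , λ _ → <-bound (concat (toList ls))
varᶠ-bound (neg F)    = varᶠ-bound F
varᶠ-bound (imp F G)  = either-bound (varᶠ-bound F) (varᶠ-bound G)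
varᶠ-bound (iff F G)  = either-bound (varᶠ-bound F) (varᶠ-bound G)
varᶠ-bound (con F G)  = either-bound (varᶠ-bound F) (varᶠ-bound G)
varᶠ-bound (dis F G)  = either-bound (varᶠ-bound F) (varᶠ-bound G)
varᶠ-bound (all y F)  = either-bound (singleton-bound y) (varᶠ-bound F)
varᶠ-bound (ex y F)   = either-bound (singleton-bound y) (varᶠ-bound F)

-- The members of cs are paired with the variables n, n + 1, …
number : ℕ → List S → List (S × Var)
number n []       = []
number n (c ∷ cs) = (c , n) ∷ number (suc n) cs

number-keys : ∀ n (cs : List S) → map proj₁ (number n cs) ≡ cs
number-keys n []       = refl
number-keys n (c ∷ cs) = cong (c ∷_) (number-keys (suc n) cs)

number-≥ : ∀ n (cs : List S) → All (λ cx → n ≤ proj₂ cx) (number n cs)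
number-≥ n []       = []
number-≥ n (c ∷ cs) = ≤-refl ∷ All-map <⇒≤ (number-≥ (suc n) cs)

number-unique : ∀ n (cs : List S) → Unique (map proj₂ (number n cs))
number-unique n []       = []
number-unique n (c ∷ cs) = distinct (number-≥ (suc n) cs) ∷ number-unique (suc n) cs
  where
  distinct : {cxs : List (S × Var)} → All (λ cx → n < proj₂ cx) cxs → All (n ≢_) (map proj₂ cxs)
  distinct []       = []
  distinct (p ∷ ps) = (λ e → <-irrefl e p) ∷ distinct ps

unique-map : {f : X → Y} {xs : List X} {a b : X} → Unique (map f xs) → a ∈ xs → b ∈ xs → f a ≡ f b → a ≡ b
unique-map (_ ∷ _)  (here refl) (here refl) e = refl
unique-map {f = f} (d ∷ _)  (here refl) (there b∈)  e = ⊥-elim (All-lookup d (∈-map⁺ f b∈) e)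
unique-map {f = f} (d ∷ _)  (there a∈)  (here refl) e = ⊥-elim (All-lookup d (∈-map⁺ f a∈) (≡-sym e))
unique-map (_ ∷ ds) (there a∈)  (there b∈)  e = unique-map ds a∈ b∈ e

private
  -- cs without a, where only equality of a with the members of cs is decidable.
  remove : {R : X → X → Set} (a : X) (cs : List X) → (∀ {c} → c ∈ cs → Dec (a ≡ c)) → AllPairs R cs →
           ∃[ cs′ ] AllPairs R cs′ × (∀ c → c ∈ cs′ ⇔ (c ∈ cs × a ≢ c))
  remove a [] decide [] = [] , [] , λ c → mk⇔ (λ ()) (λ { (() , _) })
  remove a (b ∷ cs) decide (r ∷ rs) with remove a cs (decide ∘ there) rs | decide (here refl)
  ... | cs′ , rs′ , exact | yes refl = cs′ , rs′ , λ c → mk⇔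
        (λ c∈ → let c∈cs , a≢c = to (exact c) c∈ in there c∈cs , a≢c)
        (λ { (here refl , a≢c) → ⊥-elim (a≢c refl) ; (there c∈cs , a≢c) → from (exact c) (c∈cs , a≢c) })
  ... | cs′ , rs′ , exact | no a≢b = b ∷ cs′ ,
        All-tabulate (λ c∈ → All-lookup r (proj₁ (to (exact _) c∈))) ∷ rs′ , λ c → mk⇔
        (λ { (here refl) → here refl , a≢b
           ; (there c∈)  → let c∈cs , a≢c = to (exact c) c∈ in there c∈cs , a≢c })
        (λ { (here refl , a≢c) → here refl ; (there c∈cs , a≢c) → there (from (exact c) (c∈cs , a≢c)) })

-- The members of K in s, without repetition and ordered by first occurrence.
-- Each member of K found is removed from the enumeration of the rest of s.
enumerate : {N K : Pred X 0ℓ} → (∀ {a b} → K a → K b → Dec (a ≡ b)) → (∀ {a} → N a → ¬ K a) →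
            (s : List X) → All (N ∪ K) s →
            ∃[ cs ] AllPairs (λ c d → c ≢ d × FirstBefore s c d) cs × (∀ c → c ∈ cs ⇔ (K c × c ∈ s))
enumerate decide disjoint [] [] = [] , [] , λ c → mk⇔ (λ ()) (λ { (_ , ()) })
enumerate {X} {N} {K} decide disjoint (a ∷ s) (nk ∷ nks) with enumerate decide disjoint s nks
... | cs , rs , exact = go nk
  where
  later : ∀ {c d} → a ≢ d → c ≢ d × FirstBefore s c d → c ≢ d × FirstBefore (a ∷ s) c d
  later a≢d (c≢d , u , v , refl , d∉u) =
    c≢d , a ∷ u , v , refl , λ { (here refl) → a≢d refl ; (there d∈u) → d∉u d∈u }

  all-later : ∀ {cs} → (∀ {d} → d ∈ cs → a ≢ d) → AllPairs (λ c d → c ≢ d × FirstBefore s c d) cs →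
              AllPairs (λ c d → c ≢ d × FirstBefore (a ∷ s) c d) cs
  all-later a∉cs []       = []
  all-later a∉cs (r ∷ rs) =
    All-tabulate (λ d∈ → later (a∉cs (there d∈)) (All-lookup r d∈)) ∷ all-later (a∉cs ∘ there) rs

  go : N a ⊎ K a →
       ∃[ cs′ ] AllPairs (λ c d → c ≢ d × FirstBefore (a ∷ s) c d) cs′ × (∀ c → c ∈ cs′ ⇔ (K c × c ∈ a ∷ s))
  go (inj₁ Na) = cs , all-later (λ d∈ → λ { refl → disjoint Na (proj₁ (to (exact a) d∈)) }) rs , λ c → mk⇔
    (λ c∈ → let Kc , c∈s = to (exact c) c∈ in Kc , there c∈s)
    (λ { (Kc , here refl) → ⊥-elim (disjoint Na Kc) ; (Kc , there c∈s) → from (exact c) (Kc , c∈s) })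
  go (inj₂ Ka) with remove a cs (λ c∈ → decide Ka (proj₁ (to (exact _) c∈))) rs
  ... | cs′ , rs′ , exact′ =
    a ∷ cs′ ,
    All-tabulate (λ d∈ → let _ , a≢d = to (exact′ _) d∈ in a≢d , [] , s , refl , λ ())
      ∷ all-later (λ d∈ → proj₂ (to (exact′ _) d∈)) rs′ ,
    λ c → mk⇔
      (λ { (here refl) → Ka , here refl
         ; (there c∈)  → let Kc , c∈s = to (exact c) (proj₁ (to (exact′ c) c∈)) in Kc , there c∈s })
      (λ { (Kc , here refl)  → here refl ; (Kc , there c∈s) → member c (from (exact c) (Kc , c∈s)) (decide Ka Kc) })
    where
    member : ∀ c → c ∈ cs → Dec (a ≡ c) → c ∈ a ∷ cs′
    member c c∈ (yes refl) = here refl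
    member c c∈ (no a≢c)   = there (from (exact′ c) (c∈ , a≢c))

irrelevant-coding : {K : Pred X 0ℓ} → Irrelevant K → Countable K → Coding K
irrelevant-coding irr (code , inj) = record
  { code      = code
  ; injective = inj
  ; canonical = λ p q → cong code (irr p q)
  }

split : {P R : Pred X 0ℓ} {xs : List X} → All (P ∪ R) xs → All P xs ⊎ ∃[ x ] R x × x ∈ xs
split [] = inj₁ []
split (inj₂ r ∷ prs) = inj₂ (_ , r , here refl)
split (inj₁ p ∷ prs) with split prs
... | inj₁ ps           = inj₁ (p ∷ ps)
... | inj₂ (x , r , x∈) = inj₂ (x , r , there x∈)

-- The levels with Henkin constants, the function ψ and the system [M′; L′].
module Construction {S Q I : Set} (M : System S Q) (𝒟 : Structure S Q I)
    (ω : Var → Formula S Q → S) (ψ : Formula S Q → Formula S Q) (δ : S → I)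
    (sys : IsSystem M) (irrS : Irrelevant (symbols M)) (irrP : Irrelevant (predicates M))
    (cnt : IsCountable M) (mod : IsModel M 𝒟)
    (henkins : AreHenkinConstants M ω) (psi : IsPsi M 𝒟 ω ψ δ) where

  open IsSystem sys
  open IsModel mod
  open AreHenkinConstants henkins
  open IsPsi psi
  open Semantics M 𝒟 sys mod

  -- The systems with Henkin constants

  lv : ℕ → System S Q
  lv = level M ω

  H : ℕ → Pred S 0ℓ
  H = Henkin M ω

  lv-predicates⊆ : ∀ n → predicates (lv n) ⊆ predicates M
  lv-predicates⊆ zero    p = p
  lv-predicates⊆ (suc n) p = p

  predicates⊆lv : ∀ n → predicates M ⊆ predicates (lv n)
  predicates⊆lv zero    p = p
  predicates⊆lv (suc n) p = p

  lv-closed : ∀ n → SubstClosed (lists (lv n))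
  lv-closed zero    = record { variable∈ = variables ; subst∈ = lists-subst }
  lv-closed (suc n) = adjoin-closed (lv-closed n)

  lv-isList : ∀ n → lists (lv n) ⊆ IsList (symbols (lv n))
  lv-isList zero    = lists⊆IsList
  lv-isList (suc n) = adjoin-isList (isList-mono inj₁ ∘ lv-isList n) inj₂

  lv-list-symbols : ∀ n {l} → lists (lv n) l → All (symbols (lv n)) (symbolsOfStr l)
  lv-list-symbols n l∈ = isList⇒symbols (lv-isList n l∈)

  lv-formula-symbols : ∀ n F → IsFormula (lv n) F → All (symbols (lv n)) (symbolsOf F)
  lv-formula-symbols n = formula⇒symbols (lv n) (lv-list-symbols n)

  lv-lists-mono′ : ∀ {m n} → m ≤′ n → lists (lv m) ⊆ lists (lv n)
  lv-lists-mono′ ≤′-refl        l∈ = l∈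
  lv-lists-mono′ (≤′-step m≤n) l∈ = base (lv-lists-mono′ m≤n l∈)

  lv-lists-mono : ∀ {m n} → m ≤ n → lists (lv m) ⊆ lists (lv n)
  lv-lists-mono = lv-lists-mono′ ∘ ≤⇒≤′

  symbols⊆lv : ∀ n → symbols M ⊆ symbols (lv n)
  symbols⊆lv zero    a∈ = a∈
  symbols⊆lv (suc n) a∈ = inj₁ (symbols⊆lv n a∈)

  henkin-new : ∀ {n c} → H (suc n) c → ¬ symbols M c
  henkin-new {n} c∈ a∈ = new n (symbols⊆lv n a∈) c∈

  hasRank⇒formula : ∀ n {x F} → HasRank M ω (suc n) x F → IsFormula (lv n) F
  hasRank⇒formula zero    (F∈ , _) = F∈
  hasRank⇒formula (suc n) (F∈ , _) = F∈

  predicate-coding : Coding (predicates M)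
  predicate-coding = irrelevant-coding irrP (proj₂ cnt)

  -- Equality of the symbols of each level is decidable, because such a symbol is
  -- determined by a code: a Henkin constant ω x F by a code of x and F.
  lv-coding : ∀ n → Coding (symbols (lv n))
  lv-coding zero    = irrelevant-coding irrS (proj₁ cnt)
  lv-coding (suc n) = record { code = treeCode ∘ tree ; injective = inj ; canonical = can }
    where
    module C = Coding (lv-coding n)
    open Codes (lv-coding n) predicate-coding

    formula-code : ∀ F → IsFormula (lv n) F → ∃ (FormulaCode F)
    formula-code = formula-total (lv n) (lv-list-symbols n) (lv-predicates⊆ n)

    rank-code : ∀ {x F} → HasRank M ω (suc n) x F → ∃ (FormulaCode F)
    rank-code {F = F} r = formula-code F (hasRank⇒formula n r)

    tree : ∀ {a} → symbols (lv (suc n)) a → Tree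
    tree (inj₁ p)               = nat 0 ∙ nat (C.code p)
    tree (inj₂ (x , F , r , _)) = nat 1 ∙ nat x ∙ proj₁ (rank-code r)

    inj : ∀ {a b} (p : symbols (lv (suc n)) a) (q : symbols (lv (suc n)) b) →
          treeCode (tree p) ≡ treeCode (tree q) → a ≡ b
    inj p q e = tree-injective p q (treeCode-injective {tree p} {tree q} e)
      where
      parts : ∀ {x y s t} → nat 1 ∙ nat x ∙ s ≡ nat 1 ∙ nat y ∙ t → x ≡ y × s ≡ t
      parts refl = refl , refl

      part : ∀ {x y} → nat 0 ∙ nat x ≡ nat 0 ∙ nat y → x ≡ y
      part refl = refl

      tree-injective : ∀ {a b} (p : symbols (lv (suc n)) a) (q : symbols (lv (suc n)) b) →
                       tree p ≡ tree q → a ≡ b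
      tree-injective (inj₁ p) (inj₁ q) e = C.injective p q (part e)
      tree-injective (inj₂ (x , F , r , refl)) (inj₂ (y , G , r′ , refl)) e with parts e
      ... | refl , e′ = cong (ω x) (formula-injective (proj₂ (rank-code r))
                          (subst (FormulaCode G) (≡-sym e′) (proj₂ (rank-code r′))))

    can : ∀ {a} (p q : symbols (lv (suc n)) a) → treeCode (tree p) ≡ treeCode (tree q)
    can p q = cong treeCode (tree-canonical p q)
      where
      tree-canonical : ∀ {a} (p q : symbols (lv (suc n)) a) → tree p ≡ tree q
      tree-canonical (inj₁ p) (inj₁ q) = cong (λ k → nat 0 ∙ nat k) (C.canonical p q)
      tree-canonical (inj₁ p) (inj₂ q) = ⊥-elim (new n p q)
      tree-canonical (inj₂ p) (inj₁ q) = ⊥-elim (new n q p)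
      tree-canonical (inj₂ (x , F , r , refl)) (inj₂ (y , G , r′ , e))
        with distinct (suc n) (suc n) r r′ e
      ... | refl , refl = cong (λ t → nat 1 ∙ nat x ∙ t)
                            (formula-functional (proj₂ (rank-code r)) (proj₂ (rank-code r′)))

  -- The function ψ

  -- The interpretation of the symbols under ψ: those of M are kept, and a
  -- Henkin constant c becomes the name ψ(c).
  data Interp : S → Token S → Set where
    keep   : ∀ {a} → symbols M a → Interp a (sym a)
    henkin : ∀ {n c} → H (suc n) c → Interp c (sym (name 𝒟 (δ c)))

  interp-functional : Functional Interp
  interp-functional (keep _)   (keep _)    = refl
  interp-functional (keep a∈)  (henkin c∈) = ⊥-elim (henkin-new c∈ a∈)
  interp-functional (henkin c∈) (keep a∈)  = ⊥-elim (henkin-new c∈ a∈)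
  interp-functional (henkin _) (henkin _)  = refl

  interp-symbol : ∀ {a t} → Interp a t → ∃[ b ] t ≡ sym b
  interp-symbol (keep _)   = _ , refl
  interp-symbol (henkin _) = _ , refl

  -- The replacement of Henkin constants of rank n + 1 by variables, as given by
  -- cxs.  It is undefined for the constants that are not listed in cxs.
  data Abstract (n : ℕ) (cxs : List (S × Var)) : S → Token S → Set where
    replaced : ∀ {c x} → H (suc n) c → (c , x) ∈ cxs → Abstract n cxs c (var x)
    kept     : ∀ {a} → symbols (lv n) a → Abstract n cxs a (sym a)

  -- Removal of all Henkin constants of rank n + 1 leads to level n.
  abstract-formula : ∀ n {cxs F G} → Unique (map proj₁ cxs) → IsFormula (lv (suc n)) F →
                     FormulaRel (Abstract n cxs) F G → IsFormula (lv n) G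
  abstract-formula n {cxs} cxs! F∈ r =
    formulaRel⇒formula (lv (suc n)) (lv n) (predicates⊆lv n)
      (λ l∈ → adjoin-image functional constant-good list-image var (λ x → x , refl) l∈) F∈ r
    where
    functional : Functional (Abstract n cxs)
    functional (replaced _ p) (replaced _ q) with unique-map cxs! p q refl
    ... | refl = refl
    functional (replaced c∈ _) (kept a∈)      = ⊥-elim (new n a∈ c∈)
    functional (kept a∈)      (replaced c∈ _) = ⊥-elim (new n a∈ c∈)
    functional (kept _)       (kept _)        = refl

    IsVariable : Pred (Token S) 0ℓ
    IsVariable t = ∃[ x ] t ≡ var x

    constant-good : ∀ {c t} → H (suc n) c → Abstract n cxs c t → IsVariable t
    constant-good _  (replaced _ _) = _ , refl
    constant-good c∈ (kept a∈)      = ⊥-elim (new n a∈ c∈)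

    list-image : ∀ ρ → (∀ x → IsVariable (ρ x)) → ∀ {l l′} → lists (lv n) l →
                 StrRel ρ (Abstract n cxs) l l′ → lists (lv n) l′
    list-image ρ ρ-var l∈ r = subst (lists (lv n)) (≡-sym (strRel⇒bind fixed r))
      (bind∈ (lv-closed n) _ (λ x → variable-image x (ρ-var x)) l∈)
      where
      fixed = All-map
        (λ { a∈ (replaced c∈ _) → ⊥-elim (new n a∈ c∈) ; a∈ (kept _) → refl }) (lv-list-symbols n l∈)

      variable-image : ∀ x → IsVariable (ρ x) → lists (lv n) [ ρ x ]
      variable-image x (y , e) rewrite e = variable∈ (lv-closed n) y

  -- The case of no Henkin constants of rank n + 1, where F is its own abstraction.
  lower-formula : ∀ n F → IsFormula (lv (suc n)) F → All (symbols (lv n)) (symbolsOf F) →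
                  IsFormula (lv n) F
  lower-formula n F F∈ as =
    abstract-formula n {[]} [] F∈ (formulaRel-refl F (All-map kept as))

  -- The step from rank n to rank n + 1, for a formula F in which the Henkin
  -- constants cs of rank n + 1 occur.
  ψ-interprets-step : ∀ n F (cs : List S) → IsFormula (lv (suc n)) F → cs ≢ [] →
    AllPairs (λ c d → c ≢ d × FirstBefore (symbolsOf F) c d) cs →
    (∀ c → c ∈ cs ⇔ (H (suc n) c × c ∈ symbolsOf F)) →
    (∀ G → IsFormula (lv n) G → FormulaRel Interp G (ψ G)) →
    FormulaRel Interp F (ψ F)
  ψ-interprets-step n F cs F∈ cs≢[] cs-pairs exact IH =
    subst (FormulaRel Interp F) (≡-sym ψF≡)
      (formulaRel-compose {R₁ = Abstract n cxs} {V = _∈ map proj₂ cxs} env-fixed compose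
        (λ x x∈F x∈ → fresh x∈F x∈) (proj₂ F~G) (IH G G∈))
    where
    N : ℕ
    N = proj₁ (varᶠ-bound F)

    cxs : List (S × Var)
    cxs = number N cs

    keys : map proj₁ cxs ≡ cs
    keys = number-keys N cs

    cs! : Unique cs
    cs! = AllPairs-map proj₁ cs-pairs

    cxs! : Unique (map proj₁ cxs)
    cxs! = subst Unique (≡-sym keys) cs!

    cxs≢[] : cxs ≢ []
    cxs≢[] e = cs≢[] (trans (≡-sym keys) (cong (map proj₁) e))

    paired : ∀ {c} → c ∈ map proj₁ cxs → ∃[ x ] (c , x) ∈ cxs
    paired c∈ with ∈-map⁻ proj₁ c∈
    ... | (_ , x) , cx∈ , refl = x , cx∈

    symbol-image : ∀ {a} → a ∈ symbolsOf F → symbols (lv (suc n)) a → ∃ (Abstract n cxs a)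
    symbol-image a∈F (inj₁ a∈) = _ , kept a∈
    symbol-image {a} a∈F (inj₂ a∈)
      with paired (subst (a ∈_) (≡-sym keys) (from (exact a) (a∈ , a∈F)))
    ... | x , ax∈ = _ , replaced a∈ ax∈

    F~G : ∃ (FormulaRel (Abstract n cxs) F)
    F~G = formulaRel-total F (All-tabulate λ a∈F →
      symbol-image a∈F (All-lookup (lv-formula-symbols (suc n) F F∈) a∈F))

    G : Formula S Q
    G = proj₁ F~G

    G∈ : IsFormula (lv n) G
    G∈ = abstract-formula n cxs! F∈ (proj₂ F~G)

    fresh-at : All (λ cx → ¬ proj₂ cx ∈varᶠ F) cxs
    fresh-at = All-map (λ N≤x x∈F → <-irrefl refl (<-≤-trans (proj₂ (varᶠ-bound F) _ x∈F) N≤x))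
                 (number-≥ N cs)

    fresh : ∀ {x} → x ∈varᶠ F → ¬ x ∈ map proj₂ cxs
    fresh x∈F x∈ with ∈-map⁻ proj₂ x∈
    ... | _ , cx∈ , refl = All-lookup fresh-at cx∈ x∈F

    to-replace : ∀ {a t} → Abstract n cxs a t → ReplaceToken cxs (sym a) t
    to-replace (replaced _ cx∈) = replaced cx∈
    to-replace {a} (kept a∈) = kept λ a∈cxs →
      new n a∈ (proj₁ (to (exact a) (subst (a ∈_) keys a∈cxs)))

    σ : List (S × Var) → List (Var × Str S)
    σ = map λ cx → proj₂ cx , [ sym (name 𝒟 (δ (proj₁ cx))) ]

    σ-ground : ∀ cxs → All (λ xl → Ground (proj₂ xl)) (σ cxs)
    σ-ground []       = []
    σ-ground (_ ∷ cxs) = (λ { x (here ()) ; x (there ()) }) ∷ σ-ground cxs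

    ψF≡ : ψ F ≡ bindᶠ (env (σ cxs)) (ψ G)
    ψF≡ = trans
      (ψ-step n cxs F∈ cxs≢[]
        (subst (Enumerates (H (suc n)) F) (≡-sym keys) (record
          { unique  = cs!
          ; exactly = exact
          ; ordered = AllPairs-map proj₂ cs-pairs }))
        (number-unique N cs) fresh-at (formulaRel⇒replace to-replace (proj₂ F~G)))
      (substAll≡bindᶠ (ψ G) (σ cxs) (σ-ground cxs))

    env-fixed : ∀ x → ¬ x ∈ map proj₂ cxs → env (σ cxs) x ≡ ids x
    env-fixed = go cxs
      where
      go : ∀ cxs x → ¬ x ∈ map proj₂ cxs → env (σ cxs) x ≡ ids x
      go [] x _ = refl
      go ((c , y) ∷ cxs) x x∉ with y ≟ x
      ... | yes refl = ⊥-elim (x∉ (here refl))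
      ... | no  _    = go cxs x (x∉ ∘ there)

    env-at : ∀ {c x} → (c , x) ∈ cxs → env (σ cxs) x ≡ [ sym (name 𝒟 (δ c)) ]
    env-at = go cxs (number-unique N cs)
      where
      go : ∀ cxs → Unique (map proj₂ cxs) → ∀ {c x} → (c , x) ∈ cxs →
           env (σ cxs) x ≡ [ sym (name 𝒟 (δ c)) ]
      go ((d , y) ∷ cxs) (y∉ ∷ u) {c} {x} cx∈ with y ≟ x | cx∈
      ... | yes refl | here refl   = refl
      ... | yes refl | there cx∈′  = ⊥-elim (All-lookup y∉ (∈-map⁺ proj₂ cx∈′) refl)
      ... | no y≢x   | here refl   = ⊥-elim (y≢x refl)
      ... | no _     | there cx∈′  = go cxs u cx∈′

    compose : ∀ {a t u} → Abstract n cxs a t → TokenRel var Interp t u →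
              ∃[ v ] Interp a v × bindToken (env (σ cxs)) u ≡ [ v ]
    compose (replaced c∈ cx∈) (var refl) = _ , henkin c∈ , env-at cx∈
    compose (kept a∈)         (sym i) with interp-symbol i
    ... | _ , refl = _ , i , refl

  -- ψ(F) arises from F by replacing each Henkin constant c by ψ(c).
  ψ-interprets : ∀ n F → IsFormula (lv n) F → FormulaRel Interp F (ψ F)
  ψ-interprets zero F F∈ = subst (FormulaRel Interp F) (≡-sym (ψ-base F∈))
    (formulaRel-refl F (All-map keep (lv-formula-symbols zero F F∈)))
  ψ-interprets (suc n) F F∈ =
    by-cases (split F-symbols) (enumerate decide (new n) (symbolsOf F) F-symbols)
    where
    F-symbols : All (symbols (lv (suc n))) (symbolsOf F)
    F-symbols = lv-formula-symbols (suc n) F F∈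

    decide : ∀ {c d} → H (suc n) c → H (suc n) d → Dec (c ≡ d)
    decide p q = Coding.decide (lv-coding (suc n)) (inj₂ p) (inj₂ q)

    by-cases : All (symbols (lv n)) (symbolsOf F) ⊎ (∃[ c ] H (suc n) c × c ∈ symbolsOf F) →
               ∃[ cs ] AllPairs (λ c d → c ≢ d × FirstBefore (symbolsOf F) c d) cs
                     × (∀ c → c ∈ cs ⇔ (H (suc n) c × c ∈ symbolsOf F)) →
               FormulaRel Interp F (ψ F)
    by-cases (inj₁ as) _ = ψ-interprets n F (lower-formula n F F∈ as)
    by-cases (inj₂ (c , c∈ , c∈F)) (cs , cs-pairs , exact) =
      ψ-interprets-step n F cs F∈ cs≢[] cs-pairs exact (ψ-interprets n)
      where
      cs≢[] : cs ≢ []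
      cs≢[] e with subst (c ∈_) e (from (exact c) (c∈ , c∈F))
      ... | ()

  -- The system [M′; L′]

  M₁ : System S Q
  M₁ = M′ M 𝒟 ω ψ δ

  D₀ : Structure S Q I
  D₀ = 𝒟₀ M 𝒟 ω ψ δ

  names′ : Pred S 0ℓ
  names′ = N′ M 𝒟 ω ψ δ

  name-new′ : ∀ {n c} → H n c → ¬ symbols M (name 𝒟 (δ c))
  name-new′ {n} c∈ = name-new (choice∈ n c∈)

  henkin-name : ∀ {n c} → H (suc n) c → names′ (name 𝒟 (δ c))
  henkin-name {n} c∈ = (suc n , inj₂ (_ , c∈ , refl)) , name-new′ c∈

  symbols~-henkin : ∀ n {s} → symbols~ M 𝒟 ω ψ δ n s → ¬ symbols M s →
                    ∃[ k ] ∃[ c ] H (suc k) c × s ≡ name 𝒟 (δ c)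
  symbols~-henkin zero    s∈                s∉ = ⊥-elim (s∉ s∈)
  symbols~-henkin (suc n) (inj₁ s∈)         s∉ = symbols~-henkin n s∈ s∉
  symbols~-henkin (suc n) (inj₂ (c , c∈ , e)) s∉ = n , c , c∈ , e

  name-henkin : ∀ {s} → names′ s → ∃[ k ] ∃[ c ] H (suc k) c × s ≡ name 𝒟 (δ c)
  name-henkin ((n , s∈) , s∉) = symbols~-henkin n s∈ s∉

  -- The set of lists of [M′; L′], obtained in a single step from that of M.
  L′ : Pred (Str S) 0ℓ
  L′ = Adjoin (lists M) names′

  lists~⊆L′ : ∀ n {l} → lists~ M 𝒟 ω ψ δ n l → L′ l
  lists~⊆L′ zero    l∈ = base l∈
  lists~⊆L′ (suc n) l∈ = flatten l∈
    where
    flatten : ∀ {l} → lists~ M 𝒟 ω ψ δ (suc n) l → L′ l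
    flatten (base l∈)                  = lists~⊆L′ n l∈
    flatten (step x l∈ (s∈ , s∉)) = step x (flatten l∈) ((suc n , s∈) , s∉)

  symbols~-mono′ : ∀ {m n} → m ≤′ n → symbols~ M 𝒟 ω ψ δ m ⊆ symbols~ M 𝒟 ω ψ δ n
  symbols~-mono′ ≤′-refl        s∈ = s∈
  symbols~-mono′ (≤′-step m≤n) s∈ = inj₁ (symbols~-mono′ m≤n s∈)

  lists~-mono′ : ∀ {m n} → m ≤′ n → lists~ M 𝒟 ω ψ δ m ⊆ lists~ M 𝒟 ω ψ δ n
  lists~-mono′ ≤′-refl        l∈ = l∈
  lists~-mono′ (≤′-step m≤n) l∈ = base (lists~-mono′ m≤n l∈)

  L′⊆lists : ∀ {l} → L′ l → lists M₁ l
  L′⊆lists (base l∈) = zero , l∈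
  L′⊆lists (step x l∈ ((k , s∈) , s∉)) with L′⊆lists l∈
  ... | n , l∈′ = suc (k ⊔ n) ,
    step x (base (lists~-mono′ (≤⇒≤′ (m≤n⊔m k n)) l∈′))
      (inj₁ (symbols~-mono′ (≤⇒≤′ (m≤m⊔n k n)) s∈) , s∉)

  lists⊆L′ : ∀ {l} → lists M₁ l → L′ l
  lists⊆L′ (n , l∈) = lists~⊆L′ n l∈

  L′-closed : SubstClosed L′
  L′-closed = adjoin-closed (record { variable∈ = variables ; subst∈ = lists-subst })

  names′⊆names : names′ ⊆ Names 𝒟
  names′⊆names s∈ with name-henkin s∈
  ... | k , c , c∈ , e = δ c , choice∈ (suc k) c∈ , e

  L′⊆L̂ : L′ ⊆ lists M̂
  L′⊆L̂ = adjoin-mono id names′⊆names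

  M₁⊆M̂ : ∀ F → IsFormula M₁ F → IsFormula M̂ F
  M₁⊆M̂ = formula-mono {M = M₁} {N = M̂} id (L′⊆L̂ ∘ lists⊆L′)

  -- Each Adjoin step is undone by assigning to its variable the name that the
  -- constant becomes.
  interp-list : ∀ n ρ → (∀ x → L′ [ ρ x ]) → ∀ {l l′} → lists (lv n) l → StrRel ρ Interp l l′ → L′ l′
  interp-list zero ρ ρ∈ l∈ r = subst L′ (≡-sym (strRel⇒bind fixed r))
      (bind∈ L′-closed _ ρ∈ (base l∈))
    where
    fixed = All-map
      (λ { a∈ (keep _) → refl ; a∈ (henkin c∈) → ⊥-elim (henkin-new c∈ a∈) }) (lv-list-symbols zero l∈)
  interp-list (suc n) ρ ρ∈ l∈ r =
    adjoin-image {Good = λ t → L′ [ t ]} interp-functional constant-good (interp-list n) ρ ρ∈ l∈ r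
    where
    name-list : ∀ {s} → names′ s → L′ [ sym s ]
    name-list s∈ = step zero (base (variables zero)) s∈

    constant-good : ∀ {c t} → H (suc n) c → Interp c t → L′ [ t ]
    constant-good c∈ (keep a∈)   = ⊥-elim (henkin-new c∈ a∈)
    constant-good _  (henkin c∈) = name-list (henkin-name c∈)

  ψ-formula : ∀ n F → IsFormula (lv n) F → IsFormula M₁ (ψ F)
  ψ-formula n F F∈ = formulaRel⇒formula (lv n) M₁ (lv-predicates⊆ n)
    (λ l∈ r → L′⊆lists (interp-list n var (λ x → base (variables x)) l∈ r)) F∈ (ψ-interprets n F F∈)

  henkin-list : ∀ n {c} → H (suc n) c → lists (lv (suc n)) [ sym c ]
  henkin-list n c∈ = step zero (variable∈ (lv-closed (suc n)) zero) c∈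

  -- A name in l is replaced by a Henkin constant from which it comes.
  list-preimage : ∀ {l} → L′ l → ∃[ n ] ∃[ l′ ] lists (lv n) l′ × StrRel var Interp l′ l
  list-preimage {l} (base l∈) = zero , l , l∈ ,
    strRel-refl l (All-map keep (lv-list-symbols zero l∈))
  list-preimage (step x l∈ c∈) with list-preimage l∈ | name-henkin c∈
  ... | n , l′ , l′∈ , r | k , d , d∈ , refl =
    n ⊔ suc k , l′ ⟦ [ sym d ] / x ⟧ ,
    subst∈ (lv-closed (n ⊔ suc k)) x (lv-lists-mono (m≤m⊔n n (suc k)) l′∈)
      (lv-lists-mono (m≤n⊔m n (suc k)) (henkin-list k d∈)) ,
    strRel-subst interp-symbol x r (henkin d∈)

  -- F is the interpretation of a formula of level n.
  Preimage : ℕ → Pred (Formula S Q) 0ℓ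
  Preimage n F = ∃[ G ] IsFormula (lv n) G × FormulaRel Interp G F

  preimage-mono : ∀ {m n F} → m ≤ n → Preimage m F → Preimage n F
  preimage-mono {m} {n} m≤n (G , G∈ , r) =
    G , formula-mono {M = lv m} {N = lv n} (predicates⊆lv n ∘ lv-predicates⊆ m) (lv-lists-mono m≤n) G G∈ , r

  private
    binary : ∀ {F G K} → (∀ n → Preimage n F → Preimage n G → Preimage n K) →
             ∃[ n ] Preimage n F → ∃[ n ] Preimage n G → ∃[ n ] Preimage n K
    binary f (m , F) (n , G) = m ⊔ n ,
      f (m ⊔ n) (preimage-mono (m≤m⊔n m n) F) (preimage-mono (m≤n⊔m m n) G)

    vec-preimage : ∀ {k} {ls : Vec (Str S) k} → VecAll.All (lists M₁) ls →
      ∃[ n ] ∃[ ls′ ] VecAll.All (lists (lv n)) ls′ × VecPW.Pointwise (StrRel var Interp) {m = k} ls′ ls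
    vec-preimage [] = zero , [] , [] , []
    vec-preimage (l∈ ∷ ls∈) with list-preimage (lists⊆L′ l∈) | vec-preimage ls∈
    ... | m , l′ , l′∈ , r | n , ls′ , ls′∈ , rs =
      m ⊔ n , l′ ∷ ls′ ,
      lv-lists-mono (m≤m⊔n m n) l′∈ ∷ VecAll.map (lv-lists-mono (m≤n⊔m m n)) ls′∈ , r ∷ rs

  preimage : ∀ F → IsFormula M₁ F → ∃[ n ] Preimage n F
  preimage (eq l m) (l∈ , m∈) with list-preimage (lists⊆L′ l∈) | list-preimage (lists⊆L′ m∈)
  ... | j , l′ , l′∈ , r | k , m′ , m′∈ , r′ =
    j ⊔ k , eq l′ m′ , (lv-lists-mono (m≤m⊔n j k) l′∈ , lv-lists-mono (m≤n⊔m j k) m′∈) , eq r r′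
  preimage (rel p ls) (p∈ , ls∈) with vec-preimage ls∈
  ... | n , ls′ , ls′∈ , rs = n , rel p ls′ , (predicates⊆lv n p∈ , ls′∈) , rel rs
  preimage (neg F) F∈ with preimage F F∈
  ... | n , G , G∈ , r = n , neg G , G∈ , neg r
  preimage (imp F G) (F∈ , G∈) = binary
    (λ { n (F′ , F′∈ , r) (G′ , G′∈ , s) → imp F′ G′ , (F′∈ , G′∈) , imp r s }) (preimage F F∈) (preimage G G∈)
  preimage (iff F G) (F∈ , G∈) = binary
    (λ { n (F′ , F′∈ , r) (G′ , G′∈ , s) → iff F′ G′ , (F′∈ , G′∈) , iff r s }) (preimage F F∈) (preimage G G∈)
  preimage (con F G) (F∈ , G∈) = binary
    (λ { n (F′ , F′∈ , r) (G′ , G′∈ , s) → con F′ G′ , (F′∈ , G′∈) , con r s }) (preimage F F∈) (preimage G G∈)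
  preimage (dis F G) (F∈ , G∈) = binary
    (λ { n (F′ , F′∈ , r) (G′ , G′∈ , s) → dis F′ G′ , (F′∈ , G′∈) , dis r s }) (preimage F F∈) (preimage G G∈)
  preimage (all x F) F∈ with preimage F F∈
  ... | n , G , G∈ , r = n , all x G , G∈ , all r
  preimage (ex x F) F∈ with preimage F F∈
  ... | n , G , G∈ , r = n , ex x G , G∈ , ex r

  ψ-onto : ∀ F → IsFormula M₁ F → ∃[ n ] ∃[ G ] IsFormula (lv n) G × FormulaRel Interp G F × F ≡ ψ G
  ψ-onto F F∈ with preimage F F∈
  ... | n , G , G∈ , r = n , G , G∈ , r ,
    formulaRel-functional interp-functional r (ψ-interprets n G G∈)

  -- Theorems of [M′; L′]

  basis⇒valid : ∀ {F} → basis M₁ F → Valid M 𝒟 F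
  basis⇒valid (zero  , _ , valid)            = valid
  basis⇒valid (suc n , G , _ , refl , valid) = valid

  M₁⊢⇒M₂⊢ : ∀ {F} → Provable M₁ F → Provable (M″ M 𝒟) F
  M₁⊢⇒M₂⊢ = provable-mono {M = M₁} {N = M″ M 𝒟} id (L′⊆L̂ ∘ lists⊆L′) basis⇒valid

  M₁⊢⇒holds : ∀ {F} → Provable M₁ F → Holds F
  M₁⊢⇒holds = sound ∘ M₁⊢⇒M₂⊢

  -- A valid formula of [M′; L′] is an axiom, being a value of ψ.
  holds⇒M₁⊢ : ∀ {F} → IsFormula M₁ F → Holds F → Provable M₁ F
  holds⇒M₁⊢ {F} F∈ holds with ψ-onto F F∈
  ... | n , G , G∈ , _ , refl = basis-axiom (suc n , G ,
    formula-mono {M = lv n} {N = lv (suc n)} (lv-predicates⊆ n) base G G∈ , refl , holds⇒valid holds)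

  M₁-isSystem : IsSystem M₁
  M₁-isSystem = record
    { lists⊆IsList   = adjoin-isList (isList-mono (zero ,_) ∘ lists⊆IsList) proj₁ ∘ lists⊆L′
    ; variables      = λ x → zero , variables x
    ; lists-subst    = λ x l∈ m∈ → L′⊆lists (subst∈ L′-closed x (lists⊆L′ l∈) (lists⊆L′ m∈))
    ; basis⊆formulas = λ
        { {F} (zero , F∈ , _)         → formula-mono {M = M} {N = M₁} id (zero ,_) F F∈
        ; (suc n , G , G∈ , refl , _) → ψ-formula (suc n) G G∈ }
    }

  M₁-complete : IsComplete M₁
  M₁-complete = complete M₁ M₁⊆M̂ M₁⊢⇒holds holds⇒M₁⊢

  M₁-extends-M : IsExtension M M₁
  M₁-extends-M = record
    { symbols⊆    = zero ,_
    ; predicates⊆ = id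
    ; lists⊆      = zero ,_
    ; provable⊆   = provable-mono {M = M} {N = M₁} id (zero ,_)
                      (λ F∈ → zero , basis⊆formulas F∈ , basis-valid F∈)
    }

  M₂-extends-M₁ : IsConservativeExtension M₁ (M″ M 𝒟)
  M₂-extends-M₁ = record
    { isExtension = record
      { symbols⊆    = λ { (n , s∈) → symbols~⊆ n s∈ }
      ; predicates⊆ = id
      ; lists⊆      = L′⊆L̂ ∘ lists⊆L′
      ; provable⊆   = M₁⊢⇒M₂⊢
      }
    ; conservative = λ F∈ ⊢F → holds⇒M₁⊢ F∈ (sound ⊢F)
    }
    where
    symbols~⊆ : ∀ n {s} → symbols~ M 𝒟 ω ψ δ n s → symbols M̂ s
    symbols~⊆ zero    s∈                  = inj₁ s∈
    symbols~⊆ (suc n) (inj₁ s∈)           = symbols~⊆ n s∈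
    symbols~⊆ (suc n) (inj₂ (c , c∈ , e)) = inj₂ (δ c , choice∈ (suc n) c∈ , e)

  -- Countability

  -- A member of A′ as a symbol of M or as the name given to a Henkin constant.
  Origin : Pred S 0ℓ
  Origin s = symbols M s ⊎ (∃[ k ] ∃[ c ] H (suc k) c × s ≡ name 𝒟 (δ c))

  origin : ∀ n {s} → symbols~ M 𝒟 ω ψ δ n s → Origin s
  origin zero    s∈                  = inj₁ s∈
  origin (suc n) (inj₁ s∈)           = origin n s∈
  origin (suc n) (inj₂ (c , c∈ , e)) = inj₂ (n , c , c∈ , e)

  origin-countable : Countable Origin
  origin-countable = treeCode ∘ tree , λ p q e → inj p q (treeCode-injective {tree p} {tree q} e)
    where
    tree : ∀ {s} → Origin s → Tree
    tree (inj₁ s∈)               = nat (proj₁ (proj₁ cnt) s∈)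
    tree (inj₂ (k , c , c∈ , _)) = nat k ∙ nat (Coding.code (lv-coding (suc k)) (inj₂ c∈))

    nat-injective : ∀ {i j} → nat i ≡ nat j → i ≡ j
    nat-injective refl = refl

    pair-injective : ∀ {i j i′ j′} → nat i ∙ nat j ≡ nat i′ ∙ nat j′ → i ≡ i′ × j ≡ j′
    pair-injective refl = refl , refl

    inj : ∀ {s t} (p : Origin s) (q : Origin t) → tree p ≡ tree q → s ≡ t
    inj (inj₁ p) (inj₁ q) e = proj₂ (proj₁ cnt) p q (nat-injective e)
    inj (inj₂ (k , c , c∈ , refl)) (inj₂ (j , d , d∈ , refl)) e = same-rank j d∈ (pair-injective e)
      where
      same-rank : ∀ j {d} (d∈ : H (suc j) d) →
        k ≡ j × Coding.code (lv-coding (suc k)) (inj₂ c∈) ≡ Coding.code (lv-coding (suc j)) (inj₂ d∈) →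
        name 𝒟 (δ c) ≡ name 𝒟 (δ d)
      same-rank j d∈ (refl , e) =
        cong (name 𝒟 ∘ δ) (Coding.injective (lv-coding (suc k)) (inj₂ c∈) (inj₂ d∈) e)

  symbols′-countable : Countable (symbols M₁)
  symbols′-countable = (λ { (n , s∈) → proj₁ origin-countable (origin n s∈) }) ,
    λ { (m , p) (n , q) → proj₂ origin-countable (origin m p) (origin n q) }

  names′-countable : Countable names′
  names′-countable = proj₁ symbols′-countable ∘ proj₁ ,
    λ p q → proj₂ symbols′-countable (proj₁ p) (proj₁ q)

  universe₀-countable : Countable (universe D₀)
  universe₀-countable = proj₁ names′-countable ∘ proj₂ ,
    λ { (d∈ , p) (e∈ , q) c≡ → name-injective d∈ e∈ (proj₂ names′-countable p q c≡) }

  -- Henkin witnesses in [M′; L′]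

  -- The rank of (x; F) is one more than the highest rank of a Henkin constant
  -- occurring in F, or 1 if there is none.
  rank : ∀ n x F → IsFormula (lv n) F → FreeOnly x F → ∃[ k ] HasRank M ω (suc k) x F
  rank zero    x F F∈ F-only = zero , F∈ , F-only
  rank (suc n) x F F∈ F-only with split (lv-formula-symbols (suc n) F F∈)
  ... | inj₁ as = rank n x F (lower-formula n F F∈ as) F-only
  ... | inj₂ c  = suc n , F∈ , quantified-closed {F = F} F-only , c

  name-list′ : ∀ {s} → names′ s → L′ [ sym s ]
  name-list′ s∈ = step zero (base (variables zero)) s∈

  -- The witness for ∃xF with F = ψ(G) is ψ(c), where c is the Henkin constant of
  -- the pair (x; G).
  witness′ : ∀ x F → IsFormula M₁ F → FreeOnly x F →
             ∃[ d ] universe D₀ d × Holds (imp (ex x F) (F ⟦ [ sym (name 𝒟 d) ] / x ⟧ᶠ))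
  witness′ x F F∈ F-only = from-preimage (ψ-onto F F∈)
    where
    from-preimage : (∃[ n ] ∃[ G ] IsFormula (lv n) G × FormulaRel Interp G F × F ≡ ψ G) →
      ∃[ d ] universe D₀ d × Holds (imp (ex x F) (F ⟦ [ sym (name 𝒟 d) ] / x ⟧ᶠ))
    from-preimage (n , G , G∈ , r , refl)
      with rank n x G G∈ (λ y y∈ → F-only y (formulaRel-free r y∈))
    ... | k , G-rank with sound (choice (suc k) G-rank)
    ...   | (F∈̂ , Fc∈) , h =
      δ (ω x G) , (choice∈ (suc k) c∈ , henkin-name c∈) , (F∈̂ , Fc∈) , λ ρ ρ∈ →
        T-imp-intro (ex x F) _ ρ∈ F∈̂ Fc∈ λ hF →
          trans (≡-sym (⇔ᵇ-elim (trans (≡-sym (T-iff (ex x F) _ ρ∈ F∈̂ Fc∈)) (h ρ ρ∈)))) hF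
      where
      c∈ : H (suc k) (ω x G)
      c∈ = x , G , G-rank , refl

  M₁-henkin : IsHenkin M₁
  M₁-henkin x F F∈ F-only with witness′ x F F∈ F-only
  ... | d , (_ , d∈) , holds = name 𝒟 d , proj₁ d∈ , c-list , holds⇒M₁⊢ (F∈ , Fc∈) holds
    where
    c-list : lists M₁ [ sym (name 𝒟 d) ]
    c-list = L′⊆lists (name-list′ d∈)

    Fc∈ : IsFormula M₁ (F ⟦ [ sym (name 𝒟 d) ] / x ⟧ᶠ)
    Fc∈ = substᶠ-formula M₁ (record
      { variable∈ = IsSystem.variables M₁-isSystem
      ; subst∈    = IsSystem.lists-subst M₁-isSystem }) F x c-list F∈

  -- The model 𝒟₀

  groundLists⊆ : GroundLists M₁ ⊆ GroundLists M̂
  groundLists⊆ (l∈ , g) = L′⊆L̂ (lists⊆L′ l∈) , g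

  -- The witness for ∃x (x = l) has the same value as l.
  value∈universe₀ : ∀ {l} → GroundLists M₁ l → universe D₀ (value 𝒟 l)
  value∈universe₀ {l} l∈ = from-witness (witness′ zero F F∈ F-only)
    where
    l∈̂ : GroundLists M̂ l
    l∈̂ = groundLists⊆ l∈

    F : Formula S Q
    F = eq [ var zero ] l

    F∈ : IsFormula M₁ F
    F∈ = (zero , variables zero) , proj₁ l∈

    F-only : FreeOnly zero F
    F-only y (inj₁ (here refl)) = refl
    F-only y (inj₂ y∈)          = ⊥-elim (proj₂ l∈ y y∈)

    T-F : ∀ {m} → GroundLists M̂ m →
          (T (ρ₀ [ zero ↦ m ]) F ≡ true) ⇔ (value 𝒟 m ≡ value 𝒟 l)
    T-F {m} m∈ = subst₂ (λ j k → (T (ρ₀ [ zero ↦ m ]) F ≡ true) ⇔ (value 𝒟 j ≡ value 𝒟 k))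
      (++-identityʳ m) (bind-ground (ρ₀ [ zero ↦ m ]) l (proj₂ l∈))
      (T-eq (groundEnv-update ρ₀∈ zero m∈) (proj₁ (M₁⊆M̂ F F∈)) (proj₂ (M₁⊆M̂ F F∈)))

    from-witness : (∃[ d ] universe D₀ d × Holds (imp (ex zero F) (F ⟦ [ sym (name 𝒟 d) ] / zero ⟧ᶠ))) →
                   universe D₀ (value 𝒟 l)
    from-witness (d , (d∈ , d∈′) , (F∈̂ , Fc∈) , h) =
      subst (universe D₀) (trans (≡-sym (value-name d∈)) (to (T-F (name-ground d∈)) Fd)) (d∈ , d∈′)
      where
      exists : T ρ₀ (ex zero F) ≡ true
      exists = from (T-ex zero F ρ₀∈ (M₁⊆M̂ F F∈)) (l , l∈̂ , from (T-F l∈̂) refl)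

      Fd : T (ρ₀ [ zero ↦ [ sym (name 𝒟 d) ] ]) F ≡ true
      Fd = trans (≡-sym (T-subst-ground {ρ₀} F zero F-only (proj₂ (name-ground d∈))))
        (T-imp-elim (ex zero F) (F ⟦ [ sym (name 𝒟 d) ] / zero ⟧ᶠ) ρ₀∈ F∈̂ Fc∈ (h ρ₀ ρ₀∈) exists)

  names-D₀ : Names D₀ ≐ names′
  names-D₀ = (λ { (d , (_ , d∈) , refl) → d∈ }) , λ s∈ → from-henkin s∈ (name-henkin s∈)
    where
    from-henkin : ∀ {s} → names′ s → (∃[ k ] ∃[ c ] H (suc k) c × s ≡ name 𝒟 (δ c)) → Names D₀ s
    from-henkin s∈ (k , c , c∈ , refl) = δ c , (choice∈ (suc k) c∈ , s∈) , refl

  hat-lists : lists (hat M D₀) ≐ lists M₁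
  hat-lists = L′⊆lists ∘ adjoin-mono id (proj₁ names-D₀) ,
              adjoin-mono id (proj₂ names-D₀) ∘ lists⊆L′

  hatD₀⊆M₁ : ∀ F → IsFormula (hat M D₀) F → IsFormula M₁ F
  hatD₀⊆M₁ = formula-mono {M = hat M D₀} {N = M₁} id (proj₁ hat-lists)

  ground₀⊆ : GroundLists (hat M D₀) ⊆ GroundLists M₁
  ground₀⊆ (l∈ , g) = proj₁ hat-lists l∈ , g

  name-ground₀ : ∀ {d} → universe D₀ d → GroundLists (hat M D₀) [ sym (name 𝒟 d) ]
  name-ground₀ (d∈ , d∈′) =
    proj₂ hat-lists (L′⊆lists (name-list′ d∈′)) , proj₂ (name-ground d∈)

  instance-closed : ∀ F {l} x → IsFormula M̂ F → FreeOnly x F → GroundLists M̂ l →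
                    ClosedFormulas M̂ (F ⟦ l / x ⟧ᶠ)
  instance-closed F {l} x F∈ F-only (l∈ , g) =
    substᶠ-formula M̂ L̂-closed F x l∈ F∈ , λ z z∈ →
      closed z (∈free-bindᶠ⁻ (ids [ x ↦ l ]) F (subst (z ∈free_) (substᶠ≡bindᶠ F l x) z∈))
    where
    closed : ∀ z → ¬ (∃[ y ] y ∈free F × z ∈var (ids [ x ↦ l ]) y)
    closed z (y , y∈ , z∈) with F-only y y∈
    ... | refl = g z (subst (z ∈var_) (update-same ids x l) z∈)

  -- A true existential formula of [M′; L′] has a true instance for the name of an
  -- individual of 𝒟₀.
  instance′ : ∀ {F} x → IsFormula M₁ F → FreeOnly x F → truth 𝒟 (ex x F) ≡ true →
              ∃[ d ] universe D₀ d × truth 𝒟 (F ⟦ [ sym (name 𝒟 d) ] / x ⟧ᶠ) ≡ true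
  instance′ {F} x F∈ F-only hex with witness′ x F F∈ F-only
  ... | d , d∈ , holds = d , d∈ , ⇒ᵇ-elim (trans (≡-sym (truth-imp ex∈ Fd∈))
      (truth-of-holds closed holds)) hex
    where
    ex∈ : ClosedFormulas M̂ (ex x F)
    ex∈ = M₁⊆M̂ F F∈ , quantified-closed {F = F} F-only

    Fd∈ : ClosedFormulas M̂ (F ⟦ [ sym (name 𝒟 d) ] / x ⟧ᶠ)
    Fd∈ = instance-closed F x (M₁⊆M̂ F F∈) F-only (name-ground (proj₁ d∈))

    closed : Closed (imp (ex x F) (F ⟦ [ sym (name 𝒟 d) ] / x ⟧ᶠ))
    closed z (inj₁ z∈) = proj₂ ex∈ z z∈
    closed z (inj₂ z∈) = proj₂ Fd∈ z z∈

  -- A counterexample to F in 𝒟 would yield one in 𝒟₀, by the witness for ∃x¬F.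
  D₀-truth-all : ∀ {F} x → IsFormula (hat M D₀) F → FreeOnly x F →
    (truth 𝒟 (all x F) ≡ true) ⇔ (∀ l → GroundLists (hat M D₀) l → truth 𝒟 (F ⟦ l / x ⟧ᶠ) ≡ true)
  D₀-truth-all {F} x F∈ F-only = mk⇔
    (λ h l l∈ → to (truth-all x F∈̂ F-only) h l (groundLists⊆ (ground₀⊆ l∈)))
    (λ h → from (truth-all x F∈̂ F-only) λ l l∈ → no-counterexample h l l∈ (true-or-false _))
    where
    F∈̂ : IsFormula M̂ F
    F∈̂ = M₁⊆M̂ F (hatD₀⊆M₁ F F∈)

    no-counterexample :
      (∀ l → GroundLists (hat M D₀) l → truth 𝒟 (F ⟦ l / x ⟧ᶠ) ≡ true) →
      ∀ l → GroundLists M̂ l →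
      truth 𝒟 (F ⟦ l / x ⟧ᶠ) ≡ true ⊎ truth 𝒟 (F ⟦ l / x ⟧ᶠ) ≡ false →
      truth 𝒟 (F ⟦ l / x ⟧ᶠ) ≡ true
    no-counterexample h l l∈ (inj₁ t) = t
    no-counterexample h l l∈ (inj₂ f)
      with instance′ {neg F} x (hatD₀⊆M₁ F F∈) F-only
             (from (truth-ex x F∈̂ F-only)
               (l , l∈ , trans (truth-neg (instance-closed F x F∈̂ F-only l∈)) (not-true f)))
    ... | d , d∈ , ¬Fd = ⊥-elim (true≢false (h _ (name-ground₀ d∈))
      (not-true⁻ (trans (≡-sym (truth-neg (instance-closed F x F∈̂ F-only (name-ground (proj₁ d∈))))) ¬Fd)))

  D₀-truth-ex : ∀ {F} x → IsFormula (hat M D₀) F → FreeOnly x F →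
    (truth 𝒟 (ex x F) ≡ true) ⇔ (∃[ l ] GroundLists (hat M D₀) l × truth 𝒟 (F ⟦ l / x ⟧ᶠ) ≡ true)
  D₀-truth-ex {F} x F∈ F-only = mk⇔
    (λ h → let d , d∈ , Fd = instance′ x (hatD₀⊆M₁ F F∈) F-only h in _ , name-ground₀ d∈ , Fd)
    (λ { (l , l∈ , Fl) → from (truth-ex x (M₁⊆M̂ F (hatD₀⊆M₁ F F∈)) F-only)
                           (l , groundLists⊆ (ground₀⊆ l∈) , Fl) })

  values∈universe₀ : (ls : Vec (Str S) n) → VecAll.All (lists (hat M D₀)) ls →
                     Ground (concat (toList ls)) → VecAll.All (universe D₀) (Vec.map (value 𝒟) ls)
  values∈universe₀ []       []         g = []
  values∈universe₀ (l ∷ ls) (l∈ ∷ ls∈) g =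
    value∈universe₀ (proj₁ hat-lists l∈ , λ x → g x ∘ ∈-++⁺ˡ)
      ∷ values∈universe₀ ls ls∈ (λ x → g x ∘ ∈-++⁺ʳ l)

  D₀-model : IsModel M D₀
  D₀-model = record
    { nonempty       = nonempty₀ (witness′ zero (eq [ var zero ] [ var zero ])
                         ((zero , variables zero) , (zero , variables zero))
                         λ { y (inj₁ (here refl)) → refl ; y (inj₂ (here refl)) → refl })
    ; name-injective = λ d∈ e∈ → name-injective (proj₁ d∈) (proj₁ e∈)
    ; name-new       = λ d∈ → name-new (proj₁ d∈)
    ; value∈universe = value∈universe₀ ∘ ground₀⊆
    ; value-onto     = λ d∈ → _ , name-ground₀ d∈ , value-name (proj₁ d∈)
    ; value-subst    = λ x l∈ l-only m∈ →
                         value-subst x (L̂₀⊆L̂ l∈) l-only (groundLists⊆ (ground₀⊆ m∈))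
    ; pred⊆universe  = λ _ → proj₂
    ; truth-eq       = λ {l} {m} F∈ → truth-eq (closed⊆ (eq l m) F∈)
    ; truth-rel₀     = λ {p} F∈ → truth-rel₀ (closed⊆ (rel p []) F∈)
    ; truth-rel₊     = λ {_} {p} {ls} F∈ → mk⇔
        (λ h → to (truth-rel₊ (closed⊆ (rel p ls) F∈)) h , values∈universe₀ ls (proj₂ (proj₁ F∈)) (proj₂ F∈))
        (λ h → from (truth-rel₊ (closed⊆ (rel p ls) F∈)) (proj₁ h))
    ; truth-neg      = λ {F} F∈ → truth-neg (closed⊆ F F∈)
    ; truth-imp      = λ {F} {G} F∈ G∈ → truth-imp (closed⊆ F F∈) (closed⊆ G G∈)
    ; truth-iff      = λ {F} {G} F∈ G∈ → truth-iff (closed⊆ F F∈) (closed⊆ G G∈)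
    ; truth-con      = λ {F} {G} F∈ G∈ → truth-con (closed⊆ F F∈) (closed⊆ G G∈)
    ; truth-dis      = λ {F} {G} F∈ G∈ → truth-dis (closed⊆ F F∈) (closed⊆ G G∈)
    ; truth-all      = D₀-truth-all
    ; truth-ex       = D₀-truth-ex
    ; basis-valid    = λ {F} F∈ → record
        { isFormula = formula-mono {M = M} {N = hat M D₀} id base F (basis⊆formulas F∈)
        ; true-at   = λ σ σ! keys σ∈ → Valid.true-at (basis-valid F∈) σ σ! keys
                        (All-map (groundLists⊆ ∘ ground₀⊆) σ∈)
        }
    }
    where
    nonempty₀ : {P : Pred I 0ℓ} → (∃[ d ] universe D₀ d × P d) → ∃[ d ] universe D₀ d
    nonempty₀ (d , d∈ , _) = d , d∈

    L̂₀⊆L̂ : lists (hat M D₀) ⊆ lists M̂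
    L̂₀⊆L̂ = L′⊆L̂ ∘ lists⊆L′ ∘ proj₁ hat-lists

    closed⊆ : ∀ F → ClosedFormulas (hat M D₀) F → ClosedFormulas M̂ F
    closed⊆ F (F∈ , cl) = M₁⊆M̂ F (hatD₀⊆M₁ F F∈) , cl

theorem4p2 :
    {S Q I : Set}
    (M : System S Q) (𝒟 : Structure S Q I) (ω : Var → Formula S Q → S)
    (ψ : Formula S Q → Formula S Q) (δ : S → I) →
    IsSystem M →
    Irrelevant (symbols M) → Irrelevant (predicates M) →
    IsCountable M →
    IsModel M 𝒟 →
    AreHenkinConstants M ω →
    IsPsi M 𝒟 ω ψ δ →
    let M₁ = M′ M 𝒟 ω ψ δ
        M₂ = M″ M 𝒟
        D₀ = 𝒟₀ M 𝒟 ω ψ δ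
    in
    -- (a)
    ( IsSystem M₁ × IsComplete M₁ × IsCountable M₁ × IsHenkin M₁
      × IsExtension M M₁ )
    ×
    -- (b)
    ( IsSystem M₂ × IsComplete M₂ × IsHenkin M₂
      × IsConservativeExtension M₁ M₂ )
    ×
    -- (c)
    ( Countable (universe D₀)
      × GroundLists M₁ ⊆ GroundLists M₂
      × (∀ {l} → GroundLists M₁ l → universe D₀ (value 𝒟 l))
      × Names D₀ ≐ N′ M 𝒟 ω ψ δ
      × Countable (N′ M 𝒟 ω ψ δ)
      × lists (hat M D₀) ≐ lists M₁
      × IsModel M D₀
      × ElementarilyEquivalent M 𝒟 D₀ )
theorem4p2 M 𝒟 ω ψ δ sys irrS irrP cnt mod henkins psi =
  (M₁-isSystem , M₁-complete , (symbols′-countable , proj₂ cnt) , M₁-henkin , M₁-extends-M) ,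
  (M″-isSystem , M″-complete , M″-henkin , M₂-extends-M₁) ,
  universe₀-countable , groundLists⊆ , value∈universe₀ , names-D₀ , names′-countable ,
  hat-lists , D₀-model , λ _ _ → refl
  where
  open Semantics M 𝒟 sys mod
  open Construction M 𝒟 ω ψ δ sys irrS irrP cnt mod henkins psi
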